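{- Let $G$ be an $n$-unexceptional $2$-connected graph of order $n \ge 6$. Then $\eta(G) \ge 2n-4$.
   Context: All graphs are finite, simple and connected; the order of a graph is its number of vertices. Let $d_G(u,v)$ be the usual shortest-path distance. The Wiener index is $W(G)=\sum_{\{u,v\}\subseteq V(G)} d_G(u,v)$, the sum being over unordered pairs of distinct vertices. For an edge $ab\in E(G)$ let $n_{ab}(a)=|\{c\in V(G): d_G(c,a)<d_G(c,b)\}|$ and $n_{ab}(b)=|\{c\in V(G): d_G(c,b)<d_G(c,a)\}|$. The Szeged index is $Sz(G)=\sum_{ab\in E(G)} n_{ab}(a)\,n_{ab}(b)$. The Szeged--Wiener gap is $\eta(G)=Sz(G)-W(G)$. For integers $n,t$ with $1\le t\le n-1$, $K_n^t$ denotes the graph of order $n$ obtained from the complete graph $K_{n-1}$ by adding one new vertex adjacent to exactly $t$ vertices of $K_{n-1}$. A graph $G$ is $n$-exceptional if it is isomorphic to one of $K_n$, $K_n^2$, $K_n^{n-2}$, and $n$-unexceptional otherwise. -}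

module Defs where

open import Data.Bool.Base using (if_then_else_)
open import Data.Empty using (⊥)
open import Data.Fin.Base as Fin using (Fin; zero; suc; toℕ; punchIn)
import Data.Fin.Properties as Fin
open import Data.Fin.Permutation using (Permutation′; _⟨$⟩ʳ_)
open import Data.Fin.Subset using (Subset; ∣_∣; _∈_)
open import Data.Fin.Subset.Properties using (_∈?_)
open import Data.Integer.Base as ℤ using (ℤ; +_)
open import Data.Nat.Base using (ℕ; zero; suc; pred; _+_; _*_; _∸_; _≤_; _<_; z≤n; s≤s)
open import Data.Nat.Induction using (<-rec)
open import Data.Nat.Properties
open import Data.Product.Base using (∃; _×_; _,_)
open import Data.Sum.Base using (_⊎_)
open import Data.Vec.Base using (tabulate)
open import Function.Base using (_∘_)
open import Function.Bundles using (_⇔_)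
open import Level using (0ℓ)
open import Relation.Binary.Core using (Rel)
import Relation.Binary.Definitions as B
open import Relation.Binary.PropositionalEquality
open import Relation.Nullary using (¬_; yes; no; does; contradiction)
open import Relation.Nullary.Decidable using (map′; _×-dec_; ¬?)
open import Relation.Unary using (Decidable)

open import Algebra.Properties.CommutativeMonoid.Sum +-0-commutativeMonoid
  using (sum-syntax)

record Graph (n : ℕ) : Set₁ where
  infix 4 _~_ _~?_
  field
    _~_      : Rel (Fin n) 0ℓ
    ~-sym    : B.Symmetric _~_
    ~-irrefl : ∀ {u} → ¬ (u ~ u)
    _~?_     : B.Decidable _~_

open Graph

private variable
  n k : ℕ

infix 4 _≅_
_≅_ : Graph n → Graph n → Set
_≅_ {n} G H = ∃ λ (π : Permutation′ n) →
  ∀ u v → _~_ G u v ⇔ _~_ H (π ⟨$⟩ʳ u) (π ⟨$⟩ʳ v)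

infixr 5 _∷_
data Walk (G : Graph n) : ℕ → Rel (Fin n) 0ℓ where
  []  : ∀ {u} → Walk G 0 u u
  _∷_ : ∀ {k u v w} → _~_ G u v → Walk G k v w → Walk G (suc k) u w

walk? : (G : Graph n) (k : ℕ) → B.Decidable (Walk G k)
walk? G zero    u v = map′ (λ { refl → [] }) (λ { [] → refl }) (u Fin.≟ v)
walk? G (suc k) u v = map′ there back (Fin.any? λ w → _~?_ G u w ×-dec walk? G k w v)
  where
  there : (∃ λ w → _~_ G u w × Walk G k w v) → Walk G (suc k) u v
  there (_ , e , p) = e ∷ p

  back : Walk G (suc k) u v → ∃ λ w → _~_ G u w × Walk G k w v
  back (e ∷ p) = _ , e , p

Connected : Graph n → Set
Connected G = ∀ u v → ∃ λ k → Walk G k u v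

-- The least k < b satisfying P, or b if there is none.
least : {P : ℕ → Set} → Decidable P → ℕ → ℕ
least P? zero    = zero
least P? (suc b) = if does (P? 0) then 0 else suc (least (P? ∘ suc) b)

-- A shortest walk visits no vertex twice, so it has length less than n; the
-- cut-off at n only matters when v cannot be reached from u.  See dist-walk
-- and dist-minimal.
dist : Graph n → Fin n → Fin n → ℕ
dist {n} G u v = least (λ k → walk? G k u v) n

-- The summand is meant to be symmetric: each unordered pair of distinct
-- vertices is represented by its increasing ordering.
∑-pairs : (Fin n → Fin n → ℕ) → ℕ
∑-pairs {n} f = ∑[ u < n ] ∑[ v < n ] (if does (u Fin.<? v) then f u v else 0)

∑-edges : Graph n → (Fin n → Fin n → ℕ) → ℕ
∑-edges G f = ∑-pairs λ a b → if does (_~?_ G a b) then f a b else 0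

wiener : Graph n → ℕ
wiener G = ∑-pairs (dist G)

-- The vertices strictly closer to a than to b.
closer : Graph n → Fin n → Fin n → Subset n
closer G a b = tabulate λ c → does (dist G c a <? dist G c b)

szeged : Graph n → ℕ
szeged G = ∑-edges G λ a b → ∣ closer G a b ∣ * ∣ closer G b a ∣

η : Graph n → ℤ
η G = + szeged G ℤ.- + wiener G

infixl 6 _-_
_-_ : Graph n → Fin n → Graph (pred n)
_-_ {suc n} G x = record
  { _~_      = λ u v → _~_ G (punchIn x u) (punchIn x v)
  ; ~-sym    = ~-sym G
  ; ~-irrefl = ~-irrefl G
  ; _~?_     = λ u v → _~?_ G (punchIn x u) (punchIn x v)
  }

TwoConnected : Graph n → Set
TwoConnected {n} G = 3 ≤ n × Connected G × (∀ x → Connected (G - x))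

complete : ∀ n → Graph n
complete n = record
  { _~_      = _≢_
  ; ~-sym    = ≢-sym
  ; ~-irrefl = λ u≢u → u≢u refl
  ; _~?_     = λ u v → ¬? (u Fin.≟ v)
  }

-- Add a new vertex, zero, whose neighbourhood is S.
addVertex : Graph n → Subset n → Graph (suc n)
addVertex {n} G S = record
  { _~_ = Adj ; ~-sym = λ {u} {v} → adj-sym u v ; ~-irrefl = λ {u} → adj-irrefl u ; _~?_ = adj? }
  where
  Adj : Rel (Fin (suc n)) 0ℓ
  Adj zero    zero    = ⊥
  Adj zero    (suc v) = v ∈ S
  Adj (suc u) zero    = u ∈ S
  Adj (suc u) (suc v) = _~_ G u v

  adj-sym : ∀ u v → Adj u v → Adj v u
  adj-sym zero    (suc v) p = p
  adj-sym (suc u) zero    p = p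
  adj-sym (suc u) (suc v) p = ~-sym G p

  adj-irrefl : ∀ u → ¬ Adj u u
  adj-irrefl (suc u) p = ~-irrefl G p

  adj? : B.Decidable Adj
  adj? zero    zero    = no λ ()
  adj? zero    (suc v) = v ∈? S
  adj? (suc u) zero    = u ∈? S
  adj? (suc u) (suc v) = _~?_ G u v

firstVertices : ∀ t → Subset n
firstVertices t = tabulate λ i → does (toℕ i <? t)

-- K n t is Kₙᵗ for 1 ≤ t ≤ n - 1; other values of t, and n = 0, are junk.
K : ∀ n → ℕ → Graph n
K zero    t = complete zero
K (suc m) t = addVertex (complete m) (firstVertices t)

Exceptional : Graph n → Set
Exceptional {n} G = G ≅ complete n ⊎ G ≅ K n 2 ⊎ G ≅ K n (n ∸ 2)

Unexceptional : Graph n → Set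
Unexceptional G = ¬ Exceptional G

least-≤ : ∀ {P : ℕ → Set} (P? : Decidable P) b {k} → P k → least P? b ≤ k
least-≤ P? zero    p = z≤n
least-≤ P? (suc b) p with P? 0
... | yes _ = z≤n
least-≤ P? (suc b) {zero}  p | no ¬p = contradiction p ¬p
least-≤ P? (suc b) {suc k} p | no _  = s≤s (least-≤ (P? ∘ suc) b p)

least-holds : ∀ {P : ℕ → Set} (P? : Decidable P) b {k} → k < b → P k → P (least P? b)
least-holds P? (suc b) k<b p with P? 0
... | yes p₀ = p₀
least-holds P? (suc b) {zero}  _         p | no ¬p = contradiction p ¬p
least-holds P? (suc b) {suc k} (s≤s k<b) p | no _  = least-holds (P? ∘ suc) b k<b p

module _ (G : Graph n) where

  vertexAt : ∀ {u v} → Walk G k u v → Fin (suc k) → Fin n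
  vertexAt {u = u} _ zero    = u
  vertexAt (_ ∷ p)   (suc i) = vertexAt p i

  upTo : ∀ {u v} (p : Walk G k u v) i → Walk G (toℕ i) u (vertexAt p i)
  upTo _       zero    = []
  upTo (e ∷ p) (suc i) = e ∷ upTo p i

  from : ∀ {u v} (p : Walk G k u v) i → Walk G (k ∸ toℕ i) (vertexAt p i) v
  from p       zero    = p
  from (_ ∷ p) (suc i) = from p i

  infixr 5 _++_
  _++_ : ∀ {j u v w} → Walk G j u v → Walk G k v w → Walk G (j + k) u w
  []      ++ q = q
  (e ∷ p) ++ q = e ∷ (p ++ q)

  shorten : ∀ {u v} → n ≤ k → Walk G k u v → ∃ λ j → j < k × Walk G j u v
  shorten {k} n≤k p with Fin.pigeonhole (s≤s n≤k) (vertexAt p)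
  ... | i , j , i<j , eq = toℕ i + (k ∸ toℕ j) , shorter , upTo p i ++ rest
    where
    rest = subst (λ x → Walk G (k ∸ toℕ j) x _) (sym eq) (from p j)
    shorter : toℕ i + (k ∸ toℕ j) < k
    shorter = <-≤-trans (+-monoˡ-< (k ∸ toℕ j) i<j)
      (≤-reflexive (m+[n∸m]≡n (Fin.toℕ≤pred[n] j)))

  shortWalk : ∀ {u v} k → Walk G k u v → ∃ λ j → j < n × Walk G j u v
  shortWalk {u} {v} = <-rec (λ k → Walk G k u v → _) λ k rec p → go k rec p
    where
    go : ∀ k → (∀ {j} → j < k → Walk G j u v → ∃ λ i → i < n × Walk G i u v) →
         Walk G k u v → ∃ λ i → i < n × Walk G i u v
    go k rec p with k <? n
    ... | yes k<n = k , k<n , p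
    ... | no  k≮n with _ , j<k , q ← shorten (≮⇒≥ k≮n) p = rec j<k q

  dist-minimal : ∀ {u v} → Walk G k u v → dist G u v ≤ k
  dist-minimal = least-≤ (λ k → walk? G k _ _) n

  dist-walk : Connected G → ∀ u v → Walk G (dist G u v) u v
  dist-walk conn u v with _ , p ← conn u v with _ , j<n , q ← shortWalk _ p =
    least-holds (λ k → walk? G k u v) n j<n q

{-# OPTIONS --safe #-}

-- Call an edge a b good for (x , y) if a is nearer to x and b is nearer to y.
-- The Szeged index is the number of good edges summed over all pairs {x , y},
-- and the edges of a geodesic from x to y are good, so the gap is the sum over
-- the pairs of the excess e x y, the number of good edges beyond d x y.
--
-- The excess inside a vertex set S inducing a 2-connected graph is compared
-- with 2 |S| - 4 while S grows (the code doubles everything: E S runs over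
-- ordered pairs).  A vertex with two neighbours in S brings an excess of at
-- least 2.  If no vertex has two, a shortest cycle through an edge of S and an
-- edge leaving S is isometric; its m new vertices bring at least 2 m, and more
-- if S has diameter 2.  Hence it suffices to find a starting set with excess
-- at least 2 |S| - 4.  A maximal clique together with a vertex having two or
-- more neighbours and a non-neighbour in it has excess at least 2 |S| - 6, and
-- the first growth step supplies the missing 2, except that it may lead to a
-- fan on five vertices, which the next step repairs; if S is already
-- everything, then G is exceptional or the excess of S is large enough.
-- Without such a configuration there is no induced diamond, and a non-complete
-- G contains an induced square or an isometric longer cycle to start from.  Of
-- these only the pentagon falls short, by 1, which the next step supplies.

module Submission where

-- The excess of a pair is measured in the whole graph, and nothing is known about shortcuts outside
-- `S`. Good edges are therefore exhibited one by one, and every bound has to settle whether they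
-- could lie on a geodesic, where they would not count; the recurring exception is a walk of length
-- three that is itself a geodesic. A vertex adjacent to all of `S` may contribute nothing. Hence
-- every vertex outside a growing set must have a non-neighbour inside, which is why the seed clique
-- is taken maximal. The constants come from the seed: if `x` has 2 + i neighbours and 1 + j
-- non-neighbours in the clique, its row gives excess at least 2 |S| - 6 + 2 i j. For a spanning
-- seed the product vanishes only for `K n 2` and `K n (n ∸ 2)`. A seed that does not span may have
-- i j = 0 in an unexceptional graph, so the doubled deficit `δ`, which is 4 for a seed and 2 for
-- the fan and the pentagon, must be recovered while the set is still small, from its shape:
-- diameter two, and enough neighbours around each edge.

open import Defs renaming (_++_ to _+++_)
open import Data.Bool.Base using (Bool; true; false; _∧_; T; if_then_else_)
open import Data.Empty using (⊥; ⊥-elim)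
open import Data.Fin.Base as Fin using (Fin; zero; suc; toℕ)
import Data.Fin.Permutation as Permutation
open import Data.Fin.Permutation using (permutation)
import Data.Fin.Properties as Fin
import Data.Fin.Subset as Subset
open import Data.Fin.Subset using (∣_∣)
open import Data.Integer.Base as ℤ using (ℤ; -[1+_]; 0ℤ; 1ℤ)
import Data.Integer.Properties as ℤ
open import Data.Integer.Tactic.RingSolver using () renaming (solve-∀ to ℤ-solve-∀)
open import Data.List.Base as List
  using (List; []; _∷_; _++_; concatMap; length; map; allFin; tabulate; cartesianProduct; filter)
open import Data.List.Membership.Propositional using (_∈_; _∉_; find)
open import Data.List.Membership.Propositional.Properties
import Data.List.Properties as List
open import Data.List.Relation.Unary.All as All using (All; []; _∷_)
import Data.List.Relation.Unary.All.Properties as All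
open import Data.List.Relation.Unary.AllPairs using ([]; _∷_)
import Data.List.Relation.Unary.Any as Any
open import Data.List.Relation.Unary.Any using (here; there)
import Data.List.Relation.Unary.Any.Properties as Any
open import Data.List.Relation.Unary.Unique.Propositional using (Unique)
import Data.List.Relation.Unary.Unique.Propositional.Properties as Unique
open import Data.Maybe.Base using (Maybe; just; nothing)
open import Data.Nat.Base using (ℕ; zero; suc; _+_; _*_; _∸_; _≤_; _<_; z≤n; s≤s)
open import Data.Nat.DivMod using (_/_; _%_; m%n<n; m≡m%n+[m/n]*n; [m+kn]%n≡m%n; m<n⇒m%n≡m)
open import Data.Nat.Induction using (<-rec)
open import Data.Nat.Properties hiding (_≟_)
open import Data.Nat.Properties using () renaming (_≟_ to _≟ℕ_)
open import Algebra.Properties.CommutativeMonoid.Sum +-0-commutativeMonoid using (sum)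
open import Data.Nat.Tactic.RingSolver using () renaming (solve-∀ to ℕ-solve-∀)
open import Data.Product.Base using (∃; ∃₂; _×_; _,_; proj₁; proj₂)
open import Data.Sum.Base using (_⊎_; inj₁; inj₂)
open import Data.Unit.Base using (tt)
open import Data.Vec.Base as Vec using (Vec; []; _∷_)
open import Data.Vec.N-ary using (N-ary; _$ⁿ_)
import Data.Vec.Properties as Vec
open import Function.Base using (_∘_; id)
open import Function.Bundles using (_⇔_; mk⇔; Equivalence)
open import Relation.Binary.Definitions using (tri<; tri≈; tri>)
open import Relation.Binary.PropositionalEquality
open import Relation.Nullary using (¬_; Dec; yes; no; does; contradiction)
open import Relation.Nullary.Decidable using (_×-dec_; _⊎-dec_; ¬?; dec-true; dec-false; map′)

-- Linear arithmetic over ℕ by Fourier–Motzkin elimination: a row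
-- represents the inequality 0 ≤ a₁x₁ + … + aₖxₖ + c.
module Linear where

  open import Data.Integer.Base using (+_)

  Row : ℕ → Set
  Row zero    = ℤ
  Row (suc k) = ℤ × Row k

  eval : ∀ {k} → Row k → Vec ℕ k → ℤ
  eval {zero}  c       []       = c
  eval {suc k} (a , r) (x ∷ xs) = a ℤ.* + x ℤ.+ eval r xs

  const : ∀ k → ℤ → Row k
  const zero    c = c
  const (suc k) c = 0ℤ , const k c

  unit : ∀ {k} → Fin k → Row k
  unit {suc k} zero    = 1ℤ , const k 0ℤ
  unit {suc k} (suc i) = 0ℤ , unit i

  infixl 6 _⊕_
  _⊕_ : ∀ {k} → Row k → Row k → Row k
  _⊕_ {zero}  c       c′       = c ℤ.+ c′
  _⊕_ {suc k} (a , r) (a′ , r′) = a ℤ.+ a′ , r ⊕ r′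

  scale : ∀ {k} → ℤ → Row k → Row k
  scale {zero}  m c       = m ℤ.* c
  scale {suc k} m (a , r) = m ℤ.* a , scale m r

  eval-const : ∀ {k} c (xs : Vec ℕ k) → eval (const k c) xs ≡ c
  eval-const c []       = refl
  eval-const c (x ∷ xs) rewrite eval-const c xs = ℤ.+-identityˡ c

  eval-unit : ∀ {k} (i : Fin k) xs → eval (unit i) xs ≡ + Vec.lookup xs i
  eval-unit zero    (x ∷ xs) rewrite eval-const 0ℤ xs =
    trans (ℤ.+-identityʳ _) (ℤ.*-identityˡ (+ x))
  eval-unit (suc i) (x ∷ xs) rewrite eval-unit i xs = ℤ.+-identityˡ _

  eval-⊕ : ∀ {k} (r r′ : Row k) xs → eval (r ⊕ r′) xs ≡ eval r xs ℤ.+ eval r′ xs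
  eval-⊕ c       c′        []       = refl
  eval-⊕ (a , r) (a′ , r′) (x ∷ xs) rewrite eval-⊕ r r′ xs =
    rearrange a a′ (+ x) (eval r xs) (eval r′ xs)
    where
    rearrange : ∀ a a′ x y y′ →
      (a ℤ.+ a′) ℤ.* x ℤ.+ (y ℤ.+ y′) ≡ a ℤ.* x ℤ.+ y ℤ.+ (a′ ℤ.* x ℤ.+ y′)
    rearrange = ℤ-solve-∀

  eval-scale : ∀ {k} m (r : Row k) xs → eval (scale m r) xs ≡ m ℤ.* eval r xs
  eval-scale m c       []       = refl
  eval-scale m (a , r) (x ∷ xs) rewrite eval-scale m r xs =
    rearrange m a (+ x) (eval r xs)
    where
    rearrange : ∀ m a x y → m ℤ.* a ℤ.* x ℤ.+ m ℤ.* y ≡ m ℤ.* (a ℤ.* x ℤ.+ y)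
    rearrange = ℤ-solve-∀

  infixl 7 _:*_
  infixl 6 _:+_
  infix  4 _:≤_ _:<_ _:≡_
  infixr 3 _⇒_

  data Expr (k : ℕ) : Set where
    var  : Fin k → Expr k
    con  : ℕ → Expr k
    _:+_ : Expr k → Expr k → Expr k
    _:*_ : ℕ → Expr k → Expr k

  data Form (k : ℕ) : Set where
    _:≤_ _:≡_ : Expr k → Expr k → Form k
    absurdity : Form k

  _:<_ : ∀ {k} → Expr k → Expr k → Form k
  e :< f = con 1 :+ e :≤ f

  data Seq (k : ℕ) : Set where
    _⇒_ : Form k → Seq k → Seq k
    ⊢_  : Form k → Seq k

  infix 3 ⊢_

  ⟦_⟧ : ∀ {k} → Expr k → Vec ℕ k → ℕ
  ⟦ var i  ⟧ xs = Vec.lookup xs i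
  ⟦ con c  ⟧ xs = c
  ⟦ e :+ f ⟧ xs = ⟦ e ⟧ xs + ⟦ f ⟧ xs
  ⟦ m :* e ⟧ xs = m * ⟦ e ⟧ xs

  ⟦_⟧ᶠ : ∀ {k} → Form k → Vec ℕ k → Set
  ⟦ e :≤ f ⟧ᶠ xs = ⟦ e ⟧ xs ≤ ⟦ f ⟧ xs
  ⟦ e :≡ f ⟧ᶠ xs = ⟦ e ⟧ xs ≡ ⟦ f ⟧ xs
  ⟦ absurdity ⟧ᶠ xs = ⊥

  ⟦_⟧ˢ : ∀ {k} → Seq k → Vec ℕ k → Set
  ⟦ h ⇒ s ⟧ˢ xs = ⟦ h ⟧ᶠ xs → ⟦ s ⟧ˢ xs
  ⟦ ⊢ g   ⟧ˢ xs = ⟦ g ⟧ᶠ xs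

  linear : ∀ {k} → Expr k → Row k
  linear     (var i)  = unit i
  linear {k} (con c)  = const k (+ c)
  linear     (e :+ f) = linear e ⊕ linear f
  linear     (m :* e) = scale (+ m) (linear e)

  eval-linear : ∀ {k} (e : Expr k) xs → eval (linear e) xs ≡ + ⟦ e ⟧ xs
  eval-linear (var i)  xs = eval-unit i xs
  eval-linear (con c)  xs = eval-const (+ c) xs
  eval-linear (e :+ f) xs = trans (eval-⊕ (linear e) (linear f) xs)
    (cong₂ ℤ._+_ (eval-linear e xs) (eval-linear f xs))
  eval-linear (m :* e) xs = trans (eval-scale (+ m) (linear e) xs)
    (trans (cong (+ m ℤ.*_) (eval-linear e xs)) (sym (ℤ.pos-* m _)))

  difference : ∀ {k} → Expr k → Expr k → Row k
  difference e f = linear f ⊕ scale ℤ.-1ℤ (linear e)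

  Holds : ∀ {k} → Vec ℕ k → Row k → Set
  Holds xs r = 0ℤ ℤ.≤ eval r xs

  holds-difference : ∀ {k} (e f : Expr k) {xs} → ⟦ e ⟧ xs ≤ ⟦ f ⟧ xs → Holds xs (difference e f)
  holds-difference e f {xs} e≤f
    rewrite eval-⊕ (linear f) (scale ℤ.-1ℤ (linear e)) xs
          | eval-scale ℤ.-1ℤ (linear e) xs
          | eval-linear e xs | eval-linear f xs | ℤ.-1*i≡-i (+ ⟦ e ⟧ xs) = ℤ.i≤j⇒0≤j-i (ℤ.+≤+ e≤f)

  nonNegative : ∀ {k} → Row k → Bool
  nonNegative {zero}  (+ _)       = true
  nonNegative {zero}  -[1+ _ ]    = false
  nonNegative {suc k} (+ _ , r)   = nonNegative r
  nonNegative {suc k} (-[1+ _ ] , r) = false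

  -- A row without negative entries holds for all natural numbers, so dropping it loses nothing and
  -- keeps the elimination small.
  useful : ∀ {k} → Row k → List (Row k)
  useful r = if nonNegative r then [] else r ∷ []

  keep : ∀ {k} → Row (suc k) → List (Row k)
  keep (+ zero , r) = r ∷ []
  keep _            = []

  combine : ∀ {k} → Row (suc k) → Row (suc k) → List (Row k)
  combine (+ suc p , r) (-[1+ q ] , s) = useful (scale (+ suc q) r ⊕ scale (+ suc p) s)
  combine _             _              = []

  -- The extra row `(1ℤ , const k 0ℤ)` says that the eliminated variable, a natural number, is
  -- non-negative. It occurs only on the left because `combine` expects the positive leading
  -- coefficient first.
  eliminate : ∀ {k} → List (Row (suc k)) → List (Row k)
  eliminate {k} rs = concatMap keep rs ++
    concatMap (λ r → concatMap (combine r) rs) ((1ℤ , const k 0ℤ) ∷ rs)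

  negative : List (Row 0) → Bool
  negative []              = false
  negative (+ _      ∷ rs) = negative rs
  negative (-[1+ _ ] ∷ rs) = true

  -- The row is multiplied by the square `p * p`, so that an inequality keeps its direction whatever
  -- the sign of the pivot `p`.
  substitute : ∀ {k} → Row (suc k) → Row (suc k) → Row k
  substitute (p , s) (c , r) = scale (p ℤ.* p) r ⊕ scale (ℤ.- (p ℤ.* c)) s

  pivot : ∀ {k} → List (Row (suc k)) → Maybe (Row (suc k))
  pivot []                  = nothing
  pivot ((+ zero , _) ∷ rs) = pivot rs
  pivot (r            ∷ rs) = just r

  -- The first list of rows holds equations, eliminated by substitution.
  refuted : ∀ {k} → List (Row k) → List (Row k) → Bool
  refuted {zero}  (+ zero   ∷ es) rs = refuted es rs
  refuted {zero}  (+ suc _  ∷ es) rs = true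
  refuted {zero}  (-[1+ _ ] ∷ es) rs = true
  refuted {zero}  []              rs = negative rs
  refuted {suc k} es rs with pivot es
  ... | just e  = refuted (map (substitute e) es) (concatMap (useful ∘ substitute e) ((1ℤ , const k 0ℤ) ∷ rs))
  ... | nothing = refuted (concatMap keep es) (eliminate rs)

  all-useful : ∀ {k} {P : Row k → Set} r → P r → All P (useful r)
  all-useful r p with nonNegative r
  ... | true  = []
  ... | false = p ∷ []

  all-concatMap : ∀ {A B : Set} {P : A → Set} {Q : B → Set} {f : A → List B} →
    (∀ x → P x → All Q (f x)) → ∀ {xs} → All P xs → All Q (concatMap f xs)
  all-concatMap g []       = []
  all-concatMap g (p ∷ ps) = All.++⁺ (g _ p) (all-concatMap g ps)

  nonNeg-* : ∀ m {i} → 0ℤ ℤ.≤ i → 0ℤ ℤ.≤ + m ℤ.* i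
  nonNeg-* m {+ n} _ = subst (0ℤ ℤ.≤_) (ℤ.pos-* m n) (ℤ.+≤+ z≤n)

  module _ {k} {x : ℕ} {xs : Vec ℕ k} where

    holds-keep : ∀ r → Holds (x ∷ xs) r → All (Holds xs) (keep r)
    holds-keep (+ zero  , r) h = subst (0ℤ ℤ.≤_) (ℤ.+-identityˡ _) h ∷ []
    holds-keep (+ suc _ , r) h = []
    holds-keep (-[1+ _ ] , r) h = []

    holds-combine : ∀ r s → Holds (x ∷ xs) r → Holds (x ∷ xs) s → All (Holds xs) (combine r s)
    holds-combine (+ zero , r)      s                h h′ = []
    holds-combine (-[1+ _ ] , r)   s                h h′ = []
    holds-combine (+ suc p , r) (+ _ , s)    h h′ = []
    holds-combine (+ suc p , r) (-[1+ q ] , s) h h′ = all-useful _ (subst (0ℤ ℤ.≤_) eq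
      (ℤ.+-mono-≤ (nonNeg-* (suc q) h) (nonNeg-* (suc p) h′)))
      where
      rearrange : ∀ p q x y z →
        q ℤ.* (p ℤ.* x ℤ.+ y) ℤ.+ p ℤ.* (ℤ.- q ℤ.* x ℤ.+ z) ≡ q ℤ.* y ℤ.+ p ℤ.* z
      rearrange = ℤ-solve-∀
      eq = trans (rearrange (+ suc p) (+ suc q) (+ x) (eval r xs) (eval s xs)) (sym
        (trans (eval-⊕ (scale (+ suc q) r) _ xs)
          (cong₂ ℤ._+_ (eval-scale (+ suc q) r xs) (eval-scale (+ suc p) s xs))))

    nonNeg : Holds (x ∷ xs) (1ℤ , const k 0ℤ)
    nonNeg rewrite eval-const {k} 0ℤ xs | ℤ.+-identityʳ (1ℤ ℤ.* + x) | ℤ.*-identityˡ (+ x) = ℤ.+≤+ z≤n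

    holds-eliminate : ∀ {rs} → All (Holds (x ∷ xs)) rs → All (Holds xs) (eliminate rs)
    holds-eliminate hs = All.++⁺ (all-concatMap holds-keep hs)
      (all-concatMap (λ r h → all-concatMap (λ s → holds-combine r s h) hs) (_∷_ {x = 1ℤ , const k 0ℤ} nonNeg hs))

  Zero : ∀ {k} → Vec ℕ k → Row k → Set
  Zero xs r = eval r xs ≡ 0ℤ

  module _ {k} {x : ℕ} {xs : Vec ℕ k} where

    zero-keep : ∀ r → Zero (x ∷ xs) r → All (Zero xs) (keep r)
    zero-keep (+ zero  , r) h = trans (sym (ℤ.+-identityˡ _)) h ∷ []
    zero-keep (+ suc _ , r) h = []
    zero-keep (-[1+ _ ] , r) h = []

    eval-substitute : ∀ e r → Zero (x ∷ xs) e →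
      eval (substitute e r) xs ≡ (proj₁ e ℤ.* proj₁ e) ℤ.* eval r (x ∷ xs)
    eval-substitute (p , s) (c , r) h = trans (eval-⊕ (scale (p ℤ.* p) r) _ xs)
      (trans (cong₂ ℤ._+_ (eval-scale (p ℤ.* p) r xs) (eval-scale (ℤ.- (p ℤ.* c)) s xs))
      (trans (rearrange p c (+ x) (eval r xs) (eval s xs))
      (trans (cong (λ i → (p ℤ.* p) ℤ.* (c ℤ.* + x ℤ.+ eval r xs) ℤ.+ ℤ.- (p ℤ.* c) ℤ.* i) h)
        (vanish (p ℤ.* p ℤ.* (c ℤ.* + x ℤ.+ eval r xs)) (p ℤ.* c)))))
      where
      rearrange : ∀ p c x r s → p ℤ.* p ℤ.* r ℤ.+ ℤ.- (p ℤ.* c) ℤ.* s ≡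
        p ℤ.* p ℤ.* (c ℤ.* x ℤ.+ r) ℤ.+ ℤ.- (p ℤ.* c) ℤ.* (p ℤ.* x ℤ.+ s)
      rearrange = ℤ-solve-∀
      vanish : ∀ i m → i ℤ.+ ℤ.- m ℤ.* 0ℤ ≡ i
      vanish = ℤ-solve-∀

    zero-substitute : ∀ e {es} → Zero (x ∷ xs) e → All (Zero (x ∷ xs)) es → All (Zero xs) (map (substitute e) es)
    zero-substitute e z []                 = []
    zero-substitute e {r ∷ _} z (h ∷ hs) = trans (eval-substitute e r z)
      (trans (cong (proj₁ e ℤ.* proj₁ e ℤ.*_) h) (ℤ.*-zeroʳ (proj₁ e ℤ.* proj₁ e))) ∷ zero-substitute e z hs

    holds-substitute : ∀ e r → Zero (x ∷ xs) e → Holds (x ∷ xs) r → Holds xs (substitute e r)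
    holds-substitute e r z h = subst (0ℤ ℤ.≤_) (sym (eval-substitute e r z)) (square (proj₁ e) h)
      where
      square : ∀ p {i} → 0ℤ ℤ.≤ i → 0ℤ ℤ.≤ p ℤ.* p ℤ.* i
      square (+ m)    h = subst (λ j → 0ℤ ℤ.≤ j ℤ.* _) (ℤ.pos-* m m) (nonNeg-* (m * m) h)
      square -[1+ m ] h = nonNeg-* (suc m * suc m) h

    pivot-zero : ∀ {es e} → All (Zero (x ∷ xs)) es → pivot es ≡ just e → Zero (x ∷ xs) e
    pivot-zero {(+ zero  , _) ∷ es} (h ∷ hs) eq   = pivot-zero hs eq
    pivot-zero {(+ suc _ , _) ∷ es} (h ∷ hs) refl = h
    pivot-zero {(-[1+ _ ] , _) ∷ es} (h ∷ hs) refl = h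

  refute : ∀ {k} (es rs : List (Row k)) → T (refuted es rs) → ∀ {xs} →
    All (Zero {k} xs) es → All (Holds {k} xs) rs → ⊥
  refute {zero}  (+ zero   ∷ es) rs  t {[]} (_ ∷ zs) hs = refute es rs t {[]} zs hs
  refute {zero}  (+ suc _  ∷ es) rs  t {[]} (() ∷ zs) hs
  refute {zero}  (-[1+ _ ] ∷ es) rs  t {[]} (() ∷ zs) hs
  refute {zero}  [] (+ _ ∷ rs)       t {[]} zs (_ ∷ hs) = refute [] rs t {[]} zs hs
  refute {zero}  [] (-[1+ _ ] ∷ rs)  t {[]} zs (() ∷ hs)
  refute {suc k} es rs t {x ∷ xs} zs hs with pivot es in eq
  ... | just e  = refute _ _ t (zero-substitute e z zs)
      (all-concatMap (λ r h → all-useful _ (holds-substitute e r z h))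
          (_∷_ {x = 1ℤ , const k 0ℤ} (nonNeg {x = x} {xs = xs}) hs))
    where z = pivot-zero zs eq
  ... | nothing = refute _ _ t (all-concatMap zero-keep zs) (holds-eliminate hs)

  valid : ∀ {k} → List (Row k) → List (Row k) → Seq k → Bool
  valid es rs (e :≤ f ⇒ s) = valid es (difference e f ∷ rs) s
  valid es rs (e :≡ f ⇒ s) = valid (difference e f ∷ es) rs s
  valid es rs (absurdity ⇒ s) = true
  valid es rs (⊢ e :≤ f)   = refuted es (difference (con 1 :+ f) e ∷ rs)
  valid es rs (⊢ e :≡ f)   = refuted es (difference (con 1 :+ f) e ∷ rs) ∧ refuted es (difference (con 1 :+ e) f ∷ rs)
  valid es rs (⊢ absurdity) = refuted es rs

  T-∧ : ∀ {a b} → T (a ∧ b) → T a × T b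
  T-∧ {true} t = tt , t

  absurd : ∀ {k} (s : Seq k) {xs} → ⊥ → ⟦ s ⟧ˢ xs
  absurd (_ ⇒ s) b = λ _ → absurd s b
  absurd (⊢ g)   b = ⊥-elim b

  zero-difference : ∀ {k} (e f : Expr k) {xs} → ⟦ e ⟧ xs ≡ ⟦ f ⟧ xs → Zero xs (difference e f)
  zero-difference e f {xs} e≡f
    rewrite eval-⊕ (linear f) (scale ℤ.-1ℤ (linear e)) xs
          | eval-scale ℤ.-1ℤ (linear e) xs
          | eval-linear e xs | eval-linear f xs | e≡f | ℤ.-1*i≡-i (+ ⟦ f ⟧ xs) = ℤ.+-inverseʳ (+ ⟦ f ⟧ xs)

  prove-≤ : ∀ {k} (e f : Expr k) {es rs xs} → T (refuted es (difference (con 1 :+ f) e ∷ rs)) →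
    All (Zero xs) es → All (Holds xs) rs → ⟦ e ⟧ xs ≤ ⟦ f ⟧ xs
  prove-≤ e f t zs hs = ≮⇒≥ λ f<e → refute _ _ t zs (holds-difference (con 1 :+ f) e f<e ∷ hs)

  prove : ∀ {k} es rs (s : Seq k) {xs} → T (valid es rs s) → All (Zero xs) es → All (Holds xs) rs → ⟦ s ⟧ˢ xs
  prove es rs (e :≤ f ⇒ s) t zs hs = λ h → prove _ _ s t zs (holds-difference e f h ∷ hs)
  prove es rs (e :≡ f ⇒ s) t zs hs = λ h → prove _ _ s t (zero-difference e f h ∷ zs) hs
  prove es rs (absurdity ⇒ s) t zs hs = absurd s
  prove es rs (⊢ e :≤ f) t zs hs = prove-≤ e f t zs hs
  prove es rs (⊢ e :≡ f) t zs hs = let t₁ , t₂ = T-∧ t in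
    ≤-antisym (prove-≤ e f t₁ zs hs) (prove-≤ f e t₂ zs hs)
  prove es rs (⊢ absurdity) t zs hs = refute _ _ t zs hs

  ∀ᵛ : ∀ k → (Vec ℕ k → Set) → Set
  ∀ᵛ zero    P = P []
  ∀ᵛ (suc k) P = ∀ x → ∀ᵛ k (P ∘ (x ∷_))

  curryᵛ : ∀ k {P : Vec ℕ k → Set} → (∀ xs → P xs) → ∀ᵛ k P
  curryᵛ zero    f = f []
  curryᵛ (suc k) f = λ x → curryᵛ k (f ∘ (x ∷_))

  opaque
    -- The implicit evidence reduces to the unit type when the decision procedure succeeds, so
    -- evaluation fills it in; opacity keeps the resulting proofs from being unfolded.
    lin : ∀ k (s : N-ary k (Expr k) (Seq k)) → {_ : T (valid [] [] (s $ⁿ Vec.map var (Vec.allFin k)))} →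
      ∀ᵛ k ⟦ s $ⁿ Vec.map var (Vec.allFin k) ⟧ˢ
    lin k s {t} = curryᵛ k λ xs → prove [] [] (s $ⁿ Vec.map var (Vec.allFin k)) t [] []

open Linear public using (_:+_; _:*_; _:≤_; _:<_; _:≡_; _⇒_; ⊢_; con; absurdity; lin)


-- Sums over lists

total : ∀ {A : Set} → (A → ℕ) → List A → ℕ
total f []       = 0
total f (x ∷ xs) = f x + total f xs

module _ {A : Set} where

  total-++ : ∀ (f : A → ℕ) xs ys → total f (xs ++ ys) ≡ total f xs + total f ys
  total-++ f []       ys = refl
  total-++ f (x ∷ xs) ys = trans (cong (_ +_) (total-++ f xs ys)) (sym (+-assoc (f x) _ _))

  total-cong : ∀ {f g : A → ℕ} → (∀ x → f x ≡ g x) → ∀ xs → total f xs ≡ total g xs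
  total-cong eq []       = refl
  total-cong eq (x ∷ xs) = cong₂ _+_ (eq x) (total-cong eq xs)

  total-+ : ∀ (f g : A → ℕ) xs → total (λ x → f x + g x) xs ≡ total f xs + total g xs
  total-+ f g []       = refl
  total-+ f g (x ∷ xs) rewrite total-+ f g xs =
    lin 4 (λ a b c d → ⊢ a :+ b :+ (c :+ d) :≡ a :+ c :+ (b :+ d)) (f x) _ _ _

  total-*ʳ : ∀ (f : A → ℕ) c xs → total f xs * c ≡ total (λ x → f x * c) xs
  total-*ʳ f c []       = refl
  total-*ʳ f c (x ∷ xs) = trans (*-distribʳ-+ c (f x) _) (cong (_ +_) (total-*ʳ f c xs))

  total-*ˡ : ∀ (f : A → ℕ) c xs → c * total f xs ≡ total (λ x → c * f x) xs
  total-*ˡ f c xs = trans (*-comm c _) (trans (total-*ʳ f c xs) (total-cong (λ x → *-comm (f x) c) xs))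

  total-zero : ∀ (xs : List A) → total (λ _ → 0) xs ≡ 0
  total-zero []       = refl
  total-zero (x ∷ xs) = total-zero xs

  total-const : ∀ c (xs : List A) → total (λ _ → c) xs ≡ length xs * c
  total-const c []       = refl
  total-const c (x ∷ xs) = cong (c +_) (total-const c xs)

  total-mono : ∀ {f g : A → ℕ} xs → All (λ x → f x ≤ g x) xs → total f xs ≤ total g xs
  total-mono []       []       = z≤n
  total-mono (x ∷ xs) (p ∷ ps) = +-mono-≤ p (total-mono xs ps)

  total-swap : ∀ {B : Set} (f : A → B → ℕ) xs ys →
    total (λ x → total (f x) ys) xs ≡ total (λ y → total (λ x → f x y) xs) ys
  total-swap f []       ys = sym (zeros ys)
    where
    zeros : ∀ {B : Set} (ys : List B) → total (λ _ → 0) ys ≡ 0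
    zeros []       = refl
    zeros (y ∷ ys) = zeros ys
  total-swap f (x ∷ xs) ys = trans (cong (_ +_) (total-swap f xs ys)) (sym (distrib ys))
    where
    distrib : ∀ ys → total (λ y → f x y + total (λ x′ → f x′ y) xs) ys ≡
      total (f x) ys + total (λ y → total (λ x′ → f x′ y) xs) ys
    distrib []       = refl
    distrib (y ∷ ys) rewrite distrib ys =
      lin 4 (λ a b c d → ⊢ a :+ b :+ (c :+ d) :≡ a :+ c :+ (b :+ d)) (f x y) _ _ _

  -- Uniqueness of `xs` allows a separate occurrence in `ys` to be removed for each of its entries;
  -- `ys` itself may repeat entries.
  total-⊆ : ∀ (f : A → ℕ) {xs ys} → Unique xs → (∀ {x} → x ∈ xs → x ∈ ys) → total f xs ≤ total f ys
  total-⊆ f {[]}     _        _     = z≤n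
  total-⊆ f {x ∷ xs} (x∉ ∷ u) xs⊆ys with as , bs , refl ← ∈-∃++ (xs⊆ys (here refl)) =
    ≤-trans (+-monoʳ-≤ (f x) (total-⊆ f u smaller)) (≤-reflexive (sym (begin
      total f (as ++ x ∷ bs)             ≡⟨ total-++ f as (x ∷ bs) ⟩
      total f as + (f x + total f bs)    ≡⟨ lin 3 (λ a b c →
          ⊢ a :+ (b :+ c) :≡ b :+ (a :+ c)) (total f as) (f x) (total f bs) ⟩
      f x + (total f as + total f bs)    ≡⟨ cong (f x +_) (total-++ f as bs) ⟨
      f x + total f (as ++ bs)           ∎)))
    where
    open ≡-Reasoning
    smaller : ∀ {y} → y ∈ xs → y ∈ as ++ bs
    smaller y∈ with ∈-++⁻ as (xs⊆ys (there y∈))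
    ... | inj₁ y∈as          = ∈-++⁺ˡ y∈as
    ... | inj₂ (here refl)   = contradiction refl (All.lookup x∉ y∈)
    ... | inj₂ (there y∈bs)  = ∈-++⁺ʳ as y∈bs

  length-⊆ : ∀ {xs ys : List A} → Unique xs → (∀ {x} → x ∈ xs → x ∈ ys) → length xs ≤ length ys
  length-⊆ {xs} {ys} u xs⊆ys = subst₂ _≤_ (trans (total-const 1 xs) (*-identityʳ _))
    (trans (total-const 1 ys) (*-identityʳ _)) (total-⊆ (λ _ → 1) u xs⊆ys)

total-map : ∀ {A B : Set} (f : B → ℕ) (g : A → B) xs → total f (map g xs) ≡ total (f ∘ g) xs
total-map f g []       = refl
total-map f g (x ∷ xs) = cong (_ +_) (total-map f g xs)

total-cartesianProduct : ∀ {A B : Set} (f : A × B → ℕ) xs ys →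
  total f (cartesianProduct xs ys) ≡ total (λ x → total (λ y → f (x , y)) ys) xs
total-cartesianProduct f []       ys = refl
total-cartesianProduct f (x ∷ xs) ys = trans (total-++ f (map (x ,_) ys) _)
  (cong₂ _+_ (total-map f (x ,_) ys) (total-cartesianProduct f xs ys))

sum≡total : ∀ {n} (f : Fin n → ℕ) → sum f ≡ total f (allFin n)
sum≡total {n} f = go n f id
  where
  go : ∀ k {A : Set} (f : A → ℕ) (g : Fin k → A) → sum (f ∘ g) ≡ total f (tabulate g)
  go zero    f g = refl
  go (suc k) f g = cong (_ +_) (go k f (g ∘ suc))

indicator : ∀ {P : Set} → Dec P → ℕ
indicator P? = if does P? then 1 else 0

indicator-yes : ∀ {P : Set} (P? : Dec P) → P → indicator P? ≡ 1
indicator-yes P? p rewrite dec-true P? p = refl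

indicator-⇔ : ∀ {P Q : Set} (P? : Dec P) (Q? : Dec Q) → (P → Q) → (Q → P) → indicator P? ≡ indicator Q?
indicator-⇔ (yes p) Q? f g = sym (indicator-yes Q? (f p))
indicator-⇔ (no ¬p) Q? f g rewrite dec-false Q? (¬p ∘ g) = refl

-- Distances and good edges

reverse-walk : ∀ {n} (G : Graph n) {k u v} → Walk G k u v → Walk G k v u
reverse-walk G {u = u} {v} p = subst (λ k → Walk G k v u) (+-identityʳ _) (go p [])
  where
  go : ∀ {j k u v w} → Walk G j u v → Walk G k u w → Walk G (j + k) v w
  go []      q = q
  go {suc j} {k} {v = v} {w} (e ∷ p) q = subst (λ k → Walk G k v w) (+-suc j k) (go p (Graph.~-sym G e ∷ q))

module Distances {n : ℕ} (G : Graph n) (conn : Connected G) where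

  open Graph G public

  V : Set
  V = Fin n

  vertices : List V
  vertices = allFin n

  opaque
    -- Opaque because `dist` computes by searching through walks; the geometry below rests only on
    -- the existence of a shortest walk and its minimality.
    d : V → V → ℕ
    d = dist G

    d≡dist : ∀ u v → d u v ≡ dist G u v
    d≡dist u v = refl

    d-minimal : ∀ {k u v} → Walk G k u v → d u v ≤ k
    d-minimal = dist-minimal G

    d-walk : ∀ u v → Walk G (d u v) u v
    d-walk = dist-walk G conn

  d-refl : ∀ u → d u u ≡ 0
  d-refl u = n≤0⇒n≡0 (d-minimal {u = u} [])

  d-sym : ∀ u v → d u v ≡ d v u
  d-sym u v = ≤-antisym (d-minimal (reverse-walk G (d-walk v u)))
                        (d-minimal (reverse-walk G (d-walk u v)))

  d-tri : ∀ u v w → d u w ≤ d u v + d v w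
  d-tri u v w = d-minimal (_+++_ G (d-walk u v) (d-walk v w))

  d≡0 : ∀ {u v} → d u v ≡ 0 → u ≡ v
  d≡0 {u} {v} eq with d u v | d-walk u v
  d≡0 refl | 0 | [] = refl

  d-pos : ∀ {u v} → u ≢ v → 1 ≤ d u v
  d-pos {u} {v} u≢v with d u v in eq
  ... | zero  = contradiction (d≡0 eq) u≢v
  ... | suc _ = s≤s z≤n

  step : ∀ {k u v} → d u v ≡ suc k → ∃ λ w → u ~ w × d w v ≡ k
  step {k} {u} {v} eq = go (subst (λ j → Walk G j u v) eq (d-walk u v))
    where
    go : Walk G (suc k) u v → ∃ λ w → u ~ w × d w v ≡ k
    go (_∷_ {v = w} u~w p) = w , u~w , ≤-antisym (d-minimal p)
      (≤-pred (subst (_≤ suc (d w v)) eq (d-minimal (u~w ∷ d-walk w v))))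

  ~⇒≢ : ∀ {u v} → u ~ v → u ≢ v
  ~⇒≢ u~v refl = ~-irrefl u~v

  ~⇒d≡1 : ∀ {u v} → u ~ v → d u v ≡ 1
  ~⇒d≡1 u~v = ≤-antisym (d-minimal (u~v ∷ [])) (d-pos (~⇒≢ u~v))

  d≡1⇒~ : ∀ {u v} → d u v ≡ 1 → u ~ v
  d≡1⇒~ eq with w , u~w , eq′ ← step eq = subst (_ ~_) (d≡0 eq′) u~w

  d-stepʳ : ∀ x {u v} → u ~ v → d x v ≤ suc (d x u)
  d-stepʳ x {u} {v} u~v = lin 3 (λ a b c → a :≤ b :+ c ⇒ c :≡ con 1 ⇒ ⊢ a :≤ con 1 :+ b)
    (d x v) (d x u) (d u v) (d-tri x u v) (~⇒d≡1 u~v)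

  d-stepˡ : ∀ {u v} x → u ~ v → d u x ≤ suc (d v x)
  d-stepˡ {u} {v} x u~v = lin 3 (λ a b c → a :≤ c :+ b ⇒ c :≡ con 1 ⇒ ⊢ a :≤ con 1 :+ b)
    (d u x) (d v x) (d u v) (d-tri u v x) (~⇒d≡1 u~v)

  Far : V → V → Set
  Far u v = 2 ≤ d u v

  far-sym : ∀ {u v} → Far u v → Far v u
  far-sym {u} {v} = subst (2 ≤_) (d-sym u v)

  far⇒≢ : ∀ {u v} → Far u v → u ≢ v
  far⇒≢ {u} f refl rewrite d-refl u = contradiction f λ ()

  far⇒≁ : ∀ {u v} → Far u v → ¬ u ~ v
  far⇒≁ f u~v rewrite ~⇒d≡1 u~v = contradiction f λ { (s≤s ()) }

  far : ∀ {u v} → u ≢ v → ¬ u ~ v → Far u v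
  far {u} {v} u≢v u≁v with d u v in eq
  ... | 0           = contradiction (d≡0 eq) u≢v
  ... | 1           = contradiction (d≡1⇒~ eq) u≁v
  ... | suc (suc _) = s≤s (s≤s z≤n)

  d≡2 : ∀ {u v w} → Far u w → u ~ v → v ~ w → d u w ≡ 2
  d≡2 f u~v v~w = ≤-antisym (d-minimal (u~v ∷ v~w ∷ [])) f

  d≢3 : ∀ {u v w} → Far u w → u ~ v → v ~ w → d u w ≢ 3
  d≢3 f u~v v~w d≡3 = contradiction (trans (sym (d≡2 f u~v v~w)) d≡3) λ ()

  record Good (x y : V) (ab : V × V) : Set where
    constructor good
    field
      edge  : proj₁ ab ~ proj₂ ab
      near  : d x (proj₁ ab) < d x (proj₂ ab)
      near′ : d y (proj₂ ab) < d y (proj₁ ab)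

  good? : ∀ x y ab → Dec (Good x y ab)
  good? x y (a , b) = map′ (λ (p , q , r) → good p q r) (λ (good p q r) → p , q , r)
    ((a ~? b) ×-dec ((d x a <? d x b) ×-dec (d y b <? d y a)))

  good-sym : ∀ {x y a b} → Good x y (a , b) → Good y x (b , a)
  good-sym (good p q r) = good (~-sym p) r q

  -- Running over ordered pairs counts each undirected edge at most once, since the inequalities of
  -- `Good` fix its orientation.
  crossings : V → V → ℕ
  crossings x y = total (λ a → total (λ b → indicator (good? x y (a , b))) vertices) vertices

  length≤crossings : ∀ {x y xs} → Unique xs → All (Good x y) xs → length xs ≤ crossings x y
  length≤crossings {x} {y} {xs} u gs = begin
    length xs                       ≡⟨ trans (total-const 1 xs) (*-identityʳ _) ⟨
    total (λ _ → 1) xs              ≤⟨ total-mono xs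
        (All.map (λ g → ≤-reflexive (sym (indicator-yes (good? x y _) g))) gs) ⟩
    total f xs                      ≤⟨ total-⊆ f u (λ _ → ∈-cartesianProduct⁺ (∈-allFin _) (∈-allFin _)) ⟩
    total f (cartesianProduct vertices vertices) ≡⟨ total-cartesianProduct f vertices vertices ⟩
    crossings x y                   ∎
    where
    open ≤-Reasoning
    f = λ ab → indicator (good? x y ab)

  crossings-sym : ∀ x y → crossings x y ≡ crossings y x
  crossings-sym x y = trans (total-swap _ vertices vertices)
    (total-cong (λ b → total-cong (λ a → indicator-⇔ (good? x y (a , b)) (good? y x (b , a))
      good-sym good-sym) vertices) vertices)

  record On (x y : V) (ab : V × V) : Set where
    constructor on
    field
      edge : proj₁ ab ~ proj₂ ab
      sum≡ : d x (proj₁ ab) + suc (d (proj₂ ab) y) ≡ d x y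

  on⇒good : ∀ {x y ab} → On x y ab → Good x y ab
  on⇒good {x} {y} {a , b} (on a~b eq) = good a~b
    (lin 4 (λ xy xa xb by → xa :+ (con 1 :+ by) :≡ xy ⇒ xy :≤ xb :+ by ⇒ ⊢ xa :< xb)
      (d x y) _ _ (d b y) eq (d-tri x b y))
    (lin 6 (λ xy xa by yb ya ay → xa :+ (con 1 :+ by) :≡ xy ⇒ xy :≤ xa :+ ay ⇒ yb :≡ by ⇒ ya :≡ ay ⇒ ⊢ yb :< ya)
      (d x y) (d x a) (d b y) (d y b) (d y a) (d a y) eq (d-tri x a y) (d-sym y b) (d-sym y a))

  on-lift : ∀ {x u y ab} → x ~ u → d x y ≡ suc (d u y) → On u y ab → On x y ab
  on-lift {x} {u} {y} {a , b} x~u eq (on a~b s) = on a~b (lin 7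
    (λ xy uy xa ua by ay ab → xy :≡ con 1 :+ uy ⇒ ua :+ (con 1 :+ by) :≡ uy ⇒ xa :≤ con 1 :+ ua ⇒
      xy :≤ xa :+ ay ⇒ ay :≤ ab :+ by ⇒ ab :≡ con 1 ⇒ ⊢ xa :+ (con 1 :+ by) :≡ xy)
    (d x y) (d u y) (d x a) (d u a) (d b y) (d a y) (d a b)
    eq s (d-stepˡ a x~u) (d-tri x a y) (d-tri a b y) (~⇒d≡1 a~b))

  -- An edge leaving `x` on a geodesic from `u` would put `y` within `d u y` of `x`. This keeps the
  -- edge list built in `geodesic` free of repetitions.
  head-not-on : ∀ {x u y b} → d x y ≡ suc (d u y) → ¬ On u y (x , b)
  head-not-on {x} {u} {y} {b} eq (on x~b s) = lin 5
    (λ xy uy ux by xb → xy :≡ con 1 :+ uy ⇒ ux :+ (con 1 :+ by) :≡ uy ⇒ xy :≤ con 1 :+ by ⇒ ⊢ absurdity)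
    (d x y) (d u y) (d u x) (d b y) (d x b) eq s (d-stepˡ y x~b)

  geodesic : ∀ k x y → d x y ≡ k → ∃ λ es → length es ≡ k × Unique es × All (On x y) es
  geodesic zero    x y eq = [] , refl , [] , []
  geodesic (suc k) x y eq with u , x~u , eq′ ← step eq with es , len , uniq , ons ← geodesic k u y eq′ =
    (x , u) ∷ es , cong suc len ,
    All.map (λ { o refl → head-not-on down o }) ons ∷ uniq ,
    on x~u (trans (cong (_+ suc (d u y)) (d-refl x)) (sym down)) ∷ All.map (on-lift x~u down) ons
    where down = trans eq (cong suc (sym eq′))

  d≤crossings : ∀ x y → d x y ≤ crossings x y
  d≤crossings x y with es , len , uniq , ons ← geodesic _ x y refl =
    subst (_≤ _) len (length≤crossings uniq (All.map on⇒good ons))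

  opaque
    -- The subtraction never truncates: by `d≤crossings` a geodesic already supplies `d x y` good
    -- edges.
    e : V → V → ℕ
    e x y = crossings x y ∸ d x y

    crossings≡ : ∀ x y → crossings x y ≡ d x y + e x y
    crossings≡ x y = sym (m+[n∸m]≡n (d≤crossings x y))

    e-sym : ∀ x y → e x y ≡ e y x
    e-sym x y = cong₂ _∸_ (crossings-sym x y) (d-sym x y)

  extras : ∀ {x y} xs ys → Unique xs → All (Good x y) xs → Unique ys → All (Good x y) ys →
    (∀ {p} → p ∈ xs → p ∉ ys) → length ys ≡ d x y → length xs ≤ e x y
  extras {x} {y} xs ys ux gx uy gy disjoint len = lin 5
    (λ m xs ys dd ee → xs :+ ys :≤ m ⇒ ys :≡ dd ⇒ m :≡ dd :+ ee ⇒ ⊢ xs :≤ ee)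
    (crossings x y) (length xs) (length ys) (d x y) (e x y)
    (subst (_≤ crossings x y) (List.length-++ xs)
      (length≤crossings (Unique.++⁺ ux uy (λ (p , q) → disjoint p q)) (All.++⁺ gx gy)))
    len (crossings≡ x y)

  offGeodesics : ∀ {x y xs} → Unique xs → All (Good x y) xs →
    All (λ (a , b) → d x a + suc (d b y) ≢ d x y) xs → length xs ≤ e x y
  offGeodesics {x} {y} {xs} u gs off with es , len , uniq , ons ← geodesic _ x y refl =
    extras xs es u gs uniq (All.map on⇒good ons)
      (λ p∈xs p∈es → All.lookup off p∈xs (On.sum≡ (All.lookup ons p∈es))) len

  -- Here the comparison is with one geodesic whose first edge is `(x , u)`, not with all geodesics,
  -- so the edges of a second geodesic can count as excess.
  offGeodesic : ∀ {x y u xs} → x ~ u → d x y ≡ suc (d u y) → Unique xs → All (Good x y) xs →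
    All (λ p → p ≢ (x , u) × ¬ On u y p) xs → length xs ≤ e x y
  offGeodesic {x} {y} {u} {xs} x~u eq uniq gs off with es , len , uniq′ , ons ← geodesic _ u y refl =
    extras xs ((x , u) ∷ es) uniq gs
      (All.map (λ { o refl → head-not-on eq o }) ons ∷ uniq′)
      (All.map on⇒good (on x~u (trans (cong (_+ suc (d u y)) (d-refl x)) (sym eq)) ∷ All.map (on-lift x~u eq) ons))
      (λ { p∈xs (here refl) → proj₁ (All.lookup off p∈xs) refl
         ; p∈xs (there p∈es) → proj₂ (All.lookup off p∈xs) (All.lookup ons p∈es) })
      (trans (cong suc len) (sym eq))

-- Lower bounds for the excess of a single pair

module Excess {n : ℕ} (G : Graph n) (conn : Connected G) where

  open Distances G conn public

  -- Each common neighbour `c` yields the two good edges `x c` and `c y`, and the distance 2 uses up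
  -- two of them all. The 2 stands on the right to avoid subtraction.
  commons : ∀ {x y cs} → Far x y → Unique cs → All (λ c → x ~ c × c ~ y) cs →
    2 * length cs ≤ e x y + 2
  commons {x} {y} {[]}     f u ps = z≤n
  commons {x} {y} {c ∷ cs} f u ps@((x~c , c~y) ∷ _) = lin 4
    (λ l m ee dd → 2 :* l :≤ m ⇒ m :≡ dd :+ ee ⇒ dd :≡ con 2 ⇒ ⊢ 2 :* l :≤ ee :+ con 2)
    (length (c ∷ cs)) (crossings x y) (e x y) (d x y)
    (subst (_≤ crossings x y) len (length≤crossings
      (Unique.++⁺ (Unique.map⁺ (λ { refl → refl }) u) (Unique.map⁺ (λ { refl → refl }) u) disjoint)
      (All.++⁺ (All.map⁺ (All.map first ps)) (All.map⁺ (All.map second ps)))))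
    (crossings≡ x y) (d≡2 f x~c c~y)
    where
    len : length (map (x ,_) (c ∷ cs) ++ map (_, y) (c ∷ cs)) ≡ 2 * length (c ∷ cs)
    len rewrite List.length-++ (map (x ,_) (c ∷ cs)) {map (_, y) (c ∷ cs)}
              | List.length-map (x ,_) cs | List.length-map (_, y) cs | +-identityʳ (length cs) = refl
    first : ∀ {c} → x ~ c × c ~ y → Good x y (x , c)
    first (x~c , c~y) = good x~c
      (subst₂ _<_ (sym (d-refl x)) (sym (~⇒d≡1 x~c)) (s≤s z≤n))
      (subst₂ _<_ (sym (~⇒d≡1 (~-sym c~y))) (d-sym x y) f)
    second : ∀ {c} → x ~ c × c ~ y → Good x y (c , y)
    second (x~c , c~y) = good c~y
      (subst (_< d x y) (sym (~⇒d≡1 x~c)) f)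
      (subst₂ _<_ (sym (d-refl y)) (sym (~⇒d≡1 (~-sym c~y))) (s≤s z≤n))
    disjoint : ∀ {p} → ¬ (p ∈ map (x ,_) (c ∷ cs) × p ∈ map (_, y) (c ∷ cs))
    disjoint (p∈ , p∈′) with _ , _ , refl ← ∈-map⁻ (x ,_) p∈ with c′ , c′∈ , refl ← ∈-map⁻ (_, y) p∈′ =
      ~-irrefl (proj₁ (All.lookup ps c′∈))

  commons₂ : ∀ {x y c c′} → Far x y → c ≢ c′ → x ~ c → c ~ y → x ~ c′ → c′ ~ y → 2 ≤ e x y
  commons₂ f c≢c′ xc cy xc′ c′y = +-cancelʳ-≤ 2 _ _
    (commons f ((c≢c′ ∷ []) ∷ [] ∷ []) ((xc , cy) ∷ (xc′ , c′y) ∷ []))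

  commons₃ : ∀ {x y a b c} → Far x y → a ≢ b → a ≢ c → b ≢ c →
    x ~ a → a ~ y → x ~ b → b ~ y → x ~ c → c ~ y → 4 ≤ e x y
  commons₃ f ab ac bc xa ay xb by xc cy = +-cancelʳ-≤ 2 _ _
    (commons f ((ab ∷ ac ∷ []) ∷ (bc ∷ []) ∷ [] ∷ []) ((xa , ay) ∷ (xb , by) ∷ (xc , cy) ∷ []))

  -- A walk of length three from `x` to `y` whose middle edge is good for `(x , y)` even when the
  -- distance is smaller. Only at distance 3 is the walk a geodesic, so that the middle edge need
  -- not be extra.
  record Cross (x y a b : V) : Set where
    constructor cross
    field
      xa   : x ~ a
      ab   : a ~ b
      by   : b ~ y
      a-y  : Far a y
      x-b  : Far x b

  module _ {x y a b} (c : Cross x y a b) where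
    open Cross c

    d-x-b : d x b ≡ 2
    d-x-b = d≡2 x-b xa ab

    d-a-y : d a y ≡ 2
    d-a-y = d≡2 a-y ab by

    cross-good : Good x y (a , b)
    cross-good = good ab (subst (_< d x b) (sym (~⇒d≡1 xa)) x-b)
      (subst₂ _<_ (sym (~⇒d≡1 (~-sym by))) (d-sym a y) a-y)

    cross-off : d x y ≢ 3 → d x a + suc (d b y) ≢ d x y
    cross-off d≢3 eq = d≢3 (trans (sym eq) (cong₂ (λ i j → i + suc j) (~⇒d≡1 xa) (~⇒d≡1 by)))

    cross₁ : d x y ≢ 3 → 1 ≤ e x y
    cross₁ d≢3 = offGeodesics ([] ∷ []) (cross-good ∷ []) (cross-off d≢3 ∷ [])

    start-good : d x y ≡ 3 → Good x y (x , a)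
    start-good d≡3 = good xa (subst₂ _<_ (sym (d-refl x)) (sym (~⇒d≡1 xa)) (s≤s z≤n))
      (subst₂ _<_ (trans (sym d-a-y) (d-sym a y)) (trans (sym d≡3) (d-sym x y)) ≤-refl)

    end-good : d x y ≡ 3 → Good x y (b , y)
    end-good d≡3 = good by (subst₂ _<_ (sym d-x-b) (sym d≡3) ≤-refl)
      (subst₂ _<_ (sym (d-refl y)) (sym (~⇒d≡1 (~-sym by))) (s≤s z≤n))

  apart : ∀ {A : Set} {xs ys : List A} → All (λ x → All (x ≢_) ys) xs → ∀ {x} → x ∈ xs → x ∉ ys
  apart a x∈ x∈′ = All.lookup (All.lookup a x∈) x∈′ refl

  module _ {A B : Set} {a a′ : A} {b b′ : B} where
    ≢ˡ : a ≢ a′ → (a , b) ≢ (a′ , b′)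
    ≢ˡ a≢a′ refl = a≢a′ refl
    ≢ʳ : b ≢ b′ → (a , b) ≢ (a′ , b′)
    ≢ʳ b≢b′ refl = b≢b′ refl

  module _ {x y a b a′ b′} (c : Cross x y a b) (c′ : Cross x y a′ b′) where
    private
      module C = Cross c
      module C′ = Cross c′

    path-good : d x y ≡ 3 → All (Good x y) ((x , a) ∷ (a , b) ∷ (b , y) ∷ [])
    path-good d≡3 = start-good c d≡3 ∷ cross-good c ∷ end-good c d≡3 ∷ []

    path-unique : Unique ((x , a) ∷ (a , b) ∷ (b , y) ∷ [])
    path-unique = (≢ˡ (~⇒≢ C.xa) ∷ ≢ˡ (far⇒≢ C.x-b) ∷ []) ∷ (≢ˡ (~⇒≢ C.ab) ∷ []) ∷ [] ∷ []

    cross₃ : a ≢ a′ → b ≢ b′ → d x y ≡ 3 → 3 ≤ e x y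
    cross₃ a≢a′ b≢b′ d≡3 = extras ((x , a′) ∷ (a′ , b′) ∷ (b′ , y) ∷ []) _
      ((≢ˡ (~⇒≢ C′.xa) ∷ ≢ˡ (far⇒≢ C′.x-b) ∷ []) ∷ (≢ˡ (~⇒≢ C′.ab) ∷ []) ∷ [] ∷ [])
      (start-good c′ d≡3 ∷ cross-good c′ ∷ end-good c′ d≡3 ∷ [])
      path-unique (path-good d≡3)
      (apart ((≢ʳ (a≢a′ ∘ sym) ∷ ≢ˡ (~⇒≢ C.xa) ∷ ≢ˡ (far⇒≢ C.x-b) ∷ []) ∷
              (≢ˡ (~⇒≢ (~-sym C′.xa)) ∷ ≢ˡ (a≢a′ ∘ sym) ∷ ≢ʳ (~⇒≢ C′.by) ∷ []) ∷
              (≢ˡ (far⇒≢ (far-sym C′.x-b)) ∷ ≢ʳ (~⇒≢ (~-sym C.by)) ∷ ≢ˡ (b≢b′ ∘ sym) ∷ []) ∷ []))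
      (sym d≡3)

    -- At a distance other than 3 both middle edges lie off all geodesics. At distance 3 both walks
    -- are geodesics, and two different ones differ in at least two edges, even if they share `a` or
    -- `b`.
    cross₂ : (a , b) ≢ (a′ , b′) → 2 ≤ e x y
    cross₂ ab≢ with d x y ≟ℕ 3
    ... | no  d≢3 = offGeodesics ((ab≢ ∷ []) ∷ [] ∷ []) (cross-good c ∷ cross-good c′ ∷ [])
      (cross-off c d≢3 ∷ cross-off c′ d≢3 ∷ [])
    ... | yes d≡3 with a Fin.≟ a′ | b Fin.≟ b′
    ... | yes refl | yes refl = contradiction refl ab≢
    ... | no a≢a′  | no b≢b′  = ≤-trans (s≤s (s≤s z≤n)) (cross₃ a≢a′ b≢b′ d≡3)
    ... | no a≢a′  | yes refl = extras ((x , a′) ∷ (a′ , b) ∷ []) _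
      ((≢ˡ (~⇒≢ C′.xa) ∷ []) ∷ [] ∷ []) (start-good c′ d≡3 ∷ cross-good c′ ∷ [])
      path-unique (path-good d≡3)
      (apart ((≢ʳ (a≢a′ ∘ sym) ∷ ≢ˡ (~⇒≢ C.xa) ∷ ≢ˡ (far⇒≢ C.x-b) ∷ []) ∷
              (≢ˡ (~⇒≢ (~-sym C′.xa)) ∷ ≢ˡ (a≢a′ ∘ sym) ∷ ≢ʳ (~⇒≢ C′.by) ∷ []) ∷ []))
      (sym d≡3)
    ... | yes refl | no b≢b′  = extras ((a , b′) ∷ (b′ , y) ∷ []) _
      ((≢ˡ (~⇒≢ C′.ab) ∷ []) ∷ [] ∷ []) (cross-good c′ ∷ end-good c′ d≡3 ∷ [])
      path-unique (path-good d≡3)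
      (apart ((≢ˡ (~⇒≢ (~-sym C.xa)) ∷ ≢ʳ (b≢b′ ∘ sym) ∷ ≢ʳ (~⇒≢ C′.by) ∷ []) ∷
              (≢ˡ (far⇒≢ (far-sym C′.x-b)) ∷ ≢ʳ (~⇒≢ (~-sym C.by)) ∷ ≢ˡ (b≢b′ ∘ sym) ∷ []) ∷ []))
      (sym d≡3)

  R : V → List V → ℕ
  R w S = total (e w) S

  E : List V → ℕ
  E S = total (λ u → R u S) S

  R-lower : ∀ w {zs S} → Unique zs → All (_∈ S) zs → total (e w) zs ≤ R w S
  R-lower w u zs∈ = total-⊆ (e w) u (All.lookup zs∈)

  R≥₁ : ∀ {w z S} → z ∈ S → e w z ≤ R w S
  R≥₁ {w} {S = S} z∈ = subst (_≤ R w S) (+-identityʳ _) (R-lower w ([] ∷ []) (z∈ ∷ []))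

  R≥₂ : ∀ {w z z′ S} → z ∈ S → z′ ∈ S → z ≢ z′ → e w z + e w z′ ≤ R w S
  R≥₂ {w} {z} {z′} {S} z∈ z′∈ z≢z′ = subst (_≤ R w S) (cong (e w z +_) (+-identityʳ _))
    (R-lower w ((z≢z′ ∷ []) ∷ [] ∷ []) (z∈ ∷ z′∈ ∷ []))

  R≥₃ : ∀ {w a b c S} → a ∈ S → b ∈ S → c ∈ S → a ≢ b → a ≢ c → b ≢ c →
    e w a + e w b + e w c ≤ R w S
  R≥₃ {w} {a} {b} {c} a∈ b∈ c∈ ab ac bc = ≤-trans
    (lin 3 (λ a b c → ⊢ a :+ b :+ c :≤ a :+ (b :+ (c :+ con 0))) (e w a) (e w b) (e w c))
    (R-lower w ((ab ∷ ac ∷ []) ∷ (bc ∷ []) ∷ [] ∷ []) (a∈ ∷ b∈ ∷ c∈ ∷ []))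

  E-∷ : ∀ w S → E S + 2 * R w S ≤ E (w ∷ S)
  E-∷ w S = lin 5
    (λ es r ew m t → t :≡ m :+ es ⇒ m :≡ r ⇒ ⊢ es :+ 2 :* r :≤ ew :+ r :+ t)
    (E S) (R w S) (e w w) (total (λ u → e u w) S) (total (λ u → R u (w ∷ S)) S)
    (total-+ (λ u → e u w) (λ u → R u S) S) (total-cong (λ u → e-sym u w) S)

  -- Only the full rows of the new vertices are kept, and what they add to the rows of `S` is
  -- dropped. A long cycle can afford this because its rows are at least 6 where 4 per vertex is
  -- required.
  E-++ : ∀ A S → total (λ u → R u (A ++ S)) A + E S ≤ E (A ++ S)
  E-++ A S = ≤-trans (+-monoʳ-≤ (total (λ u → R u (A ++ S)) A) (total-mono S (All.tabulate λ {u} _ →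
      ≤-trans (m≤n+m _ (R u A)) (≤-reflexive (sym (total-++ (e u) A S))))))
    (≤-reflexive (sym (total-++ (λ u → R u (A ++ S)) A S)))

  E-all : ∀ {S} → Unique S → E S ≤ total (λ x → total (e x) vertices) vertices
  E-all {S} u = ≤-trans (total-mono S (All.tabulate λ {x} _ → total-⊆ (e x) u (λ _ → ∈-allFin _)))
    (total-⊆ _ u (λ _ → ∈-allFin _))

-- A vertex with two neighbours in a 2-connected set

module Detours {n : ℕ} (G : Graph n) (conn : Connected G) where

  open Excess G conn public
  open import Data.List.Membership.DecPropositional (Fin._≟_ {n}) using (_∈?_) public

  infixr 5 _∷⟨_⟩_
  data Chain (P : V → Set) : V → V → Set where
    [_]     : ∀ {u} → P u → Chain P u u
    _∷⟨_⟩_ : ∀ {u v w} → P u → u ~ v → Chain P v w → Chain P u w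

  module _ {P : V → Set} where

    first : ∀ {u v} → Chain P u v → P u
    first [ p ]          = p
    first (p ∷⟨ _ ⟩ _) = p

    last : ∀ {u v} → Chain P u v → P v
    last [ p ]          = p
    last (_ ∷⟨ _ ⟩ c) = last c

    _◅◅_ : ∀ {u v w} → Chain P u v → Chain P v w → Chain P u w
    [ _ ]          ◅◅ c′ = c′
    (p ∷⟨ e ⟩ c) ◅◅ c′ = p ∷⟨ e ⟩ (c ◅◅ c′)

    backwards : ∀ {u v} → Chain P u v → Chain P v u
    backwards [ p ]          = [ p ]
    backwards (p ∷⟨ e ⟩ c) = backwards c ◅◅ (first c ∷⟨ ~-sym e ⟩ [ p ])

    weaken : ∀ {Q : V → Set} → (∀ {v} → P v → Q v) → ∀ {u v} → Chain P u v → Chain Q u v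
    weaken f [ p ]          = [ f p ]
    weaken f (p ∷⟨ e ⟩ c) = f p ∷⟨ e ⟩ weaken f c

    exit : ∀ {F : V → Set} (F? : ∀ v → Dec (F v)) {u v} → Chain P u v → F u → ¬ F v →
      ∃₂ λ z z′ → Chain (λ x → P x × F x) u z × z ~ z′ × P z′ × ¬ F z′
    exit F? [ p ] fu ¬fv = contradiction fu ¬fv
    exit F? (_∷⟨_⟩_ {v = w} p e c) fu ¬fv with F? w
    ... | no ¬fw = _ , w , [ p , fu ] , e , first c , ¬fw
    ... | yes fw with z , z′ , c′ , z~z′ , rest ← exit F? c fw ¬fv =
      z , z′ , (p , fu) ∷⟨ e ⟩ c′ , z~z′ , rest

  -- The 2-connectivity of the subgraph induced by `S`. A vertex `r` outside `S` is allowed as well,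
  -- which covers plain connectivity. Distances continue to be those of `G`.
  Linked : List V → Set
  Linked S = ∀ r {p q} → p ∈ S → q ∈ S → p ≢ r → q ≢ r → Chain (λ v → v ∈ S × v ≢ r) p q

  extend-linked : ∀ {S S′} → Linked S → (∀ {v} → v ∈ S → v ∈ S′) →
    (∀ r {u} → u ∈ S′ → u ≢ r → ∃ λ s → s ∈ S × Chain (λ v → v ∈ S′ × v ≢ r) u s) → Linked S′
  extend-linked linked S⊆S′ link r p∈ q∈ p≢r q≢r
    with s , s∈ , c ← link r p∈ p≢r with s′ , s′∈ , c′ ← link r q∈ q≢r =
    c ◅◅ (weaken (λ (v∈ , v≢r) → S⊆S′ v∈ , v≢r) (linked r s∈ s′∈ (proj₂ (last c)) (proj₂ (last c′)))
      ◅◅ backwards c′)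

  linked-∷ : ∀ {S w t t′} → Linked S → t ∈ S → t′ ∈ S → t ≢ t′ → w ~ t → w ~ t′ → Linked (w ∷ S)
  linked-∷ {S} {w} {t} {t′} linked t∈ t′∈ t≢t′ w~t w~t′ = extend-linked linked there link
    where
    link : ∀ r {u} → u ∈ w ∷ S → u ≢ r → ∃ λ s → s ∈ S × Chain (λ v → v ∈ w ∷ S × v ≢ r) u s
    link r (there u∈) u≢r = _ , u∈ , [ there u∈ , u≢r ]
    link r (here refl) w≢r with t Fin.≟ r
    ... | no t≢r   = t , t∈ , (here refl , w≢r) ∷⟨ w~t ⟩ [ there t∈ , t≢r ]
    ... | yes refl = t′ , t′∈ , (here refl , w≢r) ∷⟨ w~t′ ⟩ [ there t′∈ , t≢t′ ∘ sym ]

  -- The field `undominated` excludes outside vertices adjacent to all of `S`, whose row may be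
  -- zero; `third` says in the form needed that `S` has at least three vertices. Both survive
  -- enlarging `S`, so they need checking only for starting sets.
  record Nice (S : List V) : Set where
    field
      unique      : Unique S
      linked      : Linked S
      undominated : ∀ {w} → w ∉ S → ∃ λ s → s ∈ S × ¬ w ~ s
      third       : ∀ p q → ∃ λ z → z ∈ S × z ≢ p × z ≢ q

  nice-⊆ : ∀ {S S′} → Nice S → (∀ {v} → v ∈ S → v ∈ S′) → Unique S′ → Linked S′ → Nice S′
  nice-⊆ nice S⊆S′ u l = record
    { unique      = u
    ; linked      = l
    ; undominated = λ w∉ → let s , s∈ , w≁s = undominated (w∉ ∘ S⊆S′) in s , S⊆S′ s∈ , w≁s
    ; third       = λ p q → let z , z∈ , rest = third p q in z , S⊆S′ z∈ , rest
    }
    where open Nice nice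

  unique-∷ : ∀ {w : V} {S} → w ∉ S → Unique S → Unique (w ∷ S)
  unique-∷ w∉ u = All.tabulate (λ { v∈ refl → w∉ v∈ }) ∷ u

  nice-∷ : ∀ {S w t t′} → Nice S → w ∉ S → t ∈ S → t′ ∈ S → t ≢ t′ → w ~ t → w ~ t′ → Nice (w ∷ S)
  nice-∷ nice w∉ t∈ t′∈ t≢t′ w~t w~t′ = nice-⊆ nice there (unique-∷ w∉ unique)
    (linked-∷ linked t∈ t′∈ t≢t′ w~t w~t′)
    where open Nice nice

  module _ {S : List V} {w : V} (w∉S : w ∉ S) where
    private
      Q : V → Set
      Q v = v ∈ S × ¬ w ~ v

      farQ : ∀ {v} → Q v → Far w v
      farQ (v∈ , w≁v) = far (λ { refl → w∉S v∈ }) w≁v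

      Through : V → V → Set
      Through t z = d w z ≡ suc (d t z)

      -- The edge from `t` to `next` is good for `(w , z)`, yet lies on no geodesic because `t` is
      -- as far from `z` as `w` is. A deviation is thus worth one unit of excess.
      record Deviation (t : V) : Set where
        field
          z      : V
          z∈     : Q z
          next   : V
          t~next : t ~ next
          dw-next : d w next ≡ 2
          dnext  : suc (d next z) ≡ d w z
          dt     : d t z ≡ d w z

      open Deviation

      -- Let z be the last vertex on a chain with a geodesic from w through t,
      -- and z′ its successor.  If z′ is closer to w than z then a second
      -- geodesic from w to z passes through z′; otherwise z′ is as far from t
      -- as from w, and the first edge of a geodesic from t to z is good for
      -- (w , z′) although it lies on no geodesic from w to z′.
      module _ {t z z′ k} (w~t : w ~ t) (z~z′ : z ~ z′) (w≢z′ : w ≢ z′)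
        (through : d w z ≡ suc (d t z)) (¬through : d w z′ ≢ suc (d t z′))
        (dtz : d t z ≡ suc k) where

        dwz′≤dtz′ : d w z′ ≤ d t z′
        dwz′≤dtz′ = ≤-pred (≤∧≢⇒< (d-stepˡ z′ w~t) ¬through)

        -- The two extra edges are the first and the last edge of that second geodesic; neither lies
        -- on the one through `t` because `z′` is no nearer to `t` than to `w`.
        closer-case : d w z′ < suc (d t z) → 2 ≤ e w z
        closer-case dwz′<1+dtz = go _ refl
         where
         go : ∀ j → d w z′ ≡ j → 2 ≤ e w z
         go zero    dwz′ = contradiction (d≡0 dwz′) w≢z′
         go (suc j) dwz′ with u , w~u , duz′ ← step dwz′ =
          offGeodesic w~t through
            ((≢ˡ w≢z′ ∷ []) ∷ [] ∷ [])
            (good w~u (subst₂ _<_ (sym (d-refl w)) (sym (~⇒d≡1 w~u)) (s≤s z≤n))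
              (subst₂ _<_ (trans (sym duz) (d-sym u z))
                  (trans (cong suc (sym dtz)) (trans (sym through) (d-sym w z))) ≤-refl) ∷
             good (~-sym z~z′) (subst₂ _<_ (sym dwz′) (sym (trans through (cong suc dtz)))
                 (s≤s (s≤s (≤-reflexive j≡k))))
               (subst₂ _<_ (sym (d-refl z)) (sym (~⇒d≡1 z~z′)) (s≤s z≤n)) ∷ [])
            ((≢ʳ (λ { refl → ¬through (trans dwz′ (cong suc (sym duz′))) }) , off₁) ∷
             (≢ˡ (w≢z′ ∘ sym) , off₂) ∷ [])
          where
          j≡k : j ≡ k
          j≡k = ≤-antisym
            (lin 4 (λ j k tz wz′ → wz′ :≡ con 1 :+ j ⇒ wz′ :< con 1 :+ tz ⇒ tz :≡ con 1 :+ k ⇒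
                ⊢ j :≤ k) j k (d t z) (d w z′) dwz′ dwz′<1+dtz dtz)
            (lin 5 (λ wz wz′ tz j k → wz :≤ con 1 :+ wz′ ⇒ wz′ :≡ con 1 :+ j ⇒ wz :≡ con 1 :+ tz ⇒
                tz :≡ con 1 :+ k ⇒ ⊢ k :≤ j)
              (d w z) (d w z′) (d t z) j k (d-stepʳ w (~-sym z~z′)) dwz′ through dtz)
          duz : d u z ≡ suc k
          duz = lin 6 (λ uz uz′ wz tz j k → uz :≤ con 1 :+ uz′ ⇒ uz′ :≡ j ⇒ j :≡ k ⇒ wz :≡ con 1 :+ tz ⇒
              tz :≡ con 1 :+ k ⇒ wz :≤ con 1 :+ uz ⇒ ⊢ uz :≡ con 1 :+ k)
            (d u z) (d u z′) (d w z) (d t z) j k (d-stepʳ u (~-sym z~z′)) duz′ j≡k through dtz (d-stepˡ z w~u)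
          off₁ : ¬ On t z (w , u)
          off₁ (on _ eq) = lin 4 (λ tw uz tz k → tw :+ (con 1 :+ uz) :≡ tz ⇒ tz :≡ con 1 :+ k ⇒
              uz :≡ con 1 :+ k ⇒ ⊢ absurdity)
            (d t w) (d u z) (d t z) k eq dtz duz
          off₂ : ¬ On t z (z′ , z)
          off₂ (on _ eq) = lin 6 (λ tz′ zz tz wz′ j k → tz′ :+ (con 1 :+ zz) :≡ tz ⇒ tz :≡ con 1 :+ k ⇒
              wz′ :≤ tz′ ⇒ wz′ :≡ con 1 :+ j ⇒ j :≡ k ⇒ ⊢ absurdity)
            (d t z′) (d z z) (d t z) (d w z′) j k eq dtz dwz′≤dtz′ dwz′ j≡k

        level-case : Q z′ → d w z′ ≡ suc (d t z) → Deviation t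
        level-case z′∈ dwz′≡ with q , t~q , dqz ← step dtz = record
          { z = z′ ; z∈ = z′∈ ; next = q ; t~next = t~q
          ; dw-next = lin 5 (λ wq qz wz tz k → wq :≤ con 2 ⇒ wz :≤ wq :+ qz ⇒ qz :≡ k ⇒
              wz :≡ con 1 :+ tz ⇒ tz :≡ con 1 :+ k ⇒ ⊢ wq :≡ con 2)
              (d w q) (d q z) (d w z) (d t z) k (d-minimal (w~t ∷ t~q ∷ [])) (d-tri w q z) dqz through dtz
          ; dnext = lin 6 (λ qz qz′ wz′ tz tz′ k → qz′ :≤ con 1 :+ qz ⇒ qz :≡ k ⇒ wz′ :≡ con 1 :+ tz ⇒
              tz :≡ con 1 :+ k ⇒ wz′ :≤ tz′ ⇒ tz′ :≤ con 1 :+ qz′ ⇒ ⊢ con 1 :+ qz′ :≡ wz′)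
              (d q z) (d q z′) (d w z′) (d t z) (d t z′) k
              (d-stepʳ q z~z′) dqz dwz′≡ dtz dwz′≤dtz′ (d-stepˡ z′ t~q)
          ; dt = ≤-antisym (subst (d t z′ ≤_) (sym dwz′≡) (d-stepʳ t z~z′)) dwz′≤dtz′
          }

      deviate : ∀ {t s₁ s₂} → w ~ t → t ~ s₁ → Chain Q s₁ s₂ → ¬ Through t s₂ →
        (∃ λ z → Q z × 2 ≤ e w z) ⊎ Deviation t
      deviate {t} {s₁} {s₂} w~t t~s₁ c ¬thr
        with z , z′ , c′ , z~z′ , z′∈ , ¬through ← exit (λ v → d w v ≟ℕ suc (d t v)) c
               (trans (d≡2 (farQ (first c)) w~t t~s₁) (cong suc (sym (~⇒d≡1 t~s₁)))) ¬thr =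
        decide (≤-pred (≤-trans (farQ zQ) (≤-reflexive thr)))
        where
        zQ = proj₁ (last c′)
        thr = proj₂ (last c′)
        w≢z′ = far⇒≢ (farQ z′∈)
        dwz′≤ : d w z′ ≤ suc (d t z)
        dwz′≤ = ≤-trans (≤-pred (≤∧≢⇒< (d-stepˡ z′ w~t) ¬through)) (d-stepʳ t z~z′)
        decide : 1 ≤ d t z → (∃ λ z → Q z × 2 ≤ e w z) ⊎ Deviation t
        decide pos with d t z in dtz
        decide () | zero
        decide _  | suc k with d w z′ ≟ℕ suc (d t z)
        ... | yes eq = inj₂ (level-case w~t z~z′ w≢z′ thr ¬through dtz z′∈ eq)
        ... | no neq = inj₁ (z , zQ , closer-case w~t z~z′ w≢z′ thr ¬through dtz (≤∧≢⇒< dwz′≤ neq))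

      dev-good : ∀ {t} → w ~ t → (D : Deviation t) → Good w (z D) (t , next D)
      dev-good {t} w~t D = good (t~next D) (subst₂ _<_ (sym (~⇒d≡1 w~t)) (sym (dw-next D)) ≤-refl)
        (subst₂ _<_ (d-sym (next D) (z D)) (trans (dnext D) (trans (sym (dt D)) (d-sym t (z D)))) ≤-refl)

      dev-off : ∀ {t} → w ~ t → (D : Deviation t) → d w t + suc (d (next D) (z D)) ≢ d w (z D)
      dev-off {t} w~t D eq = lin 3 (λ wt nz wz → wt :+ (con 1 :+ nz) :≡ wz ⇒ wt :≡ con 1 ⇒ con 1 :+ nz :≡ wz ⇒
          ⊢ absurdity)
        (d w t) (d (next D) (z D)) (d w (z D)) eq (~⇒d≡1 w~t) (dnext D)

      -- If `t` is adjacent to `s₂`, or `t′` to `s₁`, two common neighbours suffice. Otherwise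
      -- `deviate` runs along the chain once from each end. Two deviations add up in either case:
      -- for different targets as entries of the row, for the same target because their edges start
      -- at `t` and `t′`.
      both : ∀ {t t′ s₁ s₂} → t ≢ t′ → w ~ t → w ~ t′ → t ~ s₁ → t′ ~ s₂ → Chain Q s₁ s₂ → 2 ≤ R w S
      both {t} {t′} {s₁} {s₂} t≢t′ w~t w~t′ t~s₁ t′~s₂ c with t ~? s₂ | t′ ~? s₁
      ... | yes t~s₂ | _ = ≤-trans (commons₂ (farQ (last c)) t≢t′ w~t t~s₂ w~t′ t′~s₂) (R≥₁ (proj₁ (last c)))
      ... | no _ | yes t′~s₁ = ≤-trans (commons₂ (farQ (first c)) t≢t′ w~t t~s₁ w~t′ t′~s₁) (R≥₁ (proj₁ (first c)))
      ... | no t≁s₂ | no t′≁s₁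
        with deviate w~t t~s₁ c (λ eq → t≁s₂ (d≡1⇒~
            (suc-injective (trans (sym eq) (d≡2 (farQ (last c)) w~t′ t′~s₂)))))
           | deviate w~t′ t′~s₂ (backwards c) (λ eq →
               t′≁s₁ (d≡1⇒~ (suc-injective (trans (sym eq) (d≡2 (farQ (first c)) w~t t~s₁)))))
      ... | inj₁ (_ , z∈ , 2≤) | _ = ≤-trans 2≤ (R≥₁ (proj₁ z∈))
      ... | inj₂ _ | inj₁ (_ , z∈ , 2≤) = ≤-trans 2≤ (R≥₁ (proj₁ z∈))
      ... | inj₂ D | inj₂ D′ with z D Fin.≟ z D′
      ... | no z≢z′ = ≤-trans (+-mono-≤
          (offGeodesics ([] ∷ []) (dev-good w~t D ∷ []) (dev-off w~t D ∷ []))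
          (offGeodesics ([] ∷ []) (dev-good w~t′ D′ ∷ []) (dev-off w~t′ D′ ∷ [])))
        (R≥₂ (proj₁ (z∈ D)) (proj₁ (z∈ D′)) z≢z′)
      ... | yes eq = ≤-trans
        (offGeodesics ((≢ˡ t≢t′ ∷ []) ∷ [] ∷ [])
          (dev-good w~t D ∷ subst (λ x → Good w x (t′ , next D′)) (sym eq) (dev-good w~t′ D′) ∷ [])
          (dev-off w~t D ∷ subst (λ x → d w t′ + suc (d (next D′) x) ≢ d w x) (sym eq) (dev-off w~t′ D′) ∷ []))
        (R≥₁ (proj₁ (z∈ D)))

    -- A chain in `S` from a non-neighbour `s₀` of `w` first meets a neighbour of `w` at some `t₁`.
    -- Since `S` without `t₁` is still connected, a second chain from `s₀` meets another neighbour
    -- first. The initial parts of both chains join at `s₀` to the chain of non-neighbours that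
    -- `both` wants.
    detour : Nice S → ∀ {t t′} → t ∈ S → t′ ∈ S → t ≢ t′ → w ~ t → w ~ t′ → 2 ≤ R w S
    detour nice {t} {t′} t∈ t′∈ t≢t′ w~t w~t′
      with s₀ , s₀∈ , w≁s₀ ← Nice.undominated nice w∉S
      -- No particular deletion is wanted here; `r` only has to differ from both ends for `linked`
      -- to give a chain.
      with r , _ , r≢s₀ , r≢t ← Nice.third nice s₀ t
      with s₁ , t₁ , c₁ , s₁~t₁ , (t₁∈ , _) , ¬¬w~t₁ ← exit (λ v →
          ¬? (w ~? v)) (Nice.linked nice r s₀∈ t∈ (r≢s₀ ∘ sym) (r≢t ∘ sym)) w≁s₀ (λ w≁t → w≁t w~t)
      with w ~? t₁
    ... | no w≁t₁ = contradiction w≁t₁ ¬¬w~t₁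
    ... | yes w~t₁ = second-exit
      where
      open Nice nice
      to : ∀ {t₂} → t₂ ∈ S → t₁ ≢ t₂ → w ~ t₂ → 2 ≤ R w S
      to {t₂} t₂∈ t₁≢t₂ w~t₂
        with s₂ , t₃ , c₂ , s₂~t₃ , (t₃∈ , t₃≢t₁) , ¬¬w~t₃ ← exit (λ v → ¬? (w ~? v))
          (linked t₁ s₀∈ t₂∈ (λ { refl → w≁s₀ w~t₁ }) (t₁≢t₂ ∘ sym)) w≁s₀ (λ w≁t → w≁t w~t₂)
        with w ~? t₃
      ... | no w≁t₃ = contradiction w≁t₃ ¬¬w~t₃
      ... | yes w~t₃ = both (t₃≢t₁ ∘ sym) w~t₁ w~t₃ (~-sym s₁~t₁) (~-sym s₂~t₃)
        (backwards (weaken (λ ((v∈ , _) , w≁v) → v∈ , w≁v) c₁) ◅◅ weaken (λ ((v∈ , _) , w≁v) → v∈ , w≁v) c₂)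
      second-exit : 2 ≤ R w S
      second-exit with t₁ Fin.≟ t
      ... | yes refl = to t′∈ t≢t′ w~t′
      ... | no t₁≢t  = to t∈ t₁≢t w~t

-- Isometric cycles

-- Replaces `G - t` without renumbering: the vertex stays but loses its edges, so walks in `G` and
-- walks avoiding `t` share their vertices.
isolate : ∀ {n} → Graph n → Fin n → Graph n
isolate G t = record
  { _~_      = λ u v → Graph._~_ G u v × u ≢ t × v ≢ t
  ; ~-sym    = λ (u~v , u≢t , v≢t) → Graph.~-sym G u~v , v≢t , u≢t
  ; ~-irrefl = λ (u~u , _) → Graph.~-irrefl G u~u
  ; _~?_     = λ u v → Graph._~?_ G u v ×-dec (¬? (u Fin.≟ t) ×-dec ¬? (v Fin.≟ t))
  }

StaysConnected : ∀ {n} → Graph n → Set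
StaysConnected G = ∀ t {u v} → u ≢ t → v ≢ t → ∃ λ k → Walk (isolate G t) k u v

minimum : ∀ {P : ℕ → Set} → (∀ k → Dec (P k)) → ∀ {k} → P k → ∃ λ m → P m × (∀ j → P j → m ≤ j)
minimum {P} P? = <-rec (λ k → P k → ∃ λ m → P m × (∀ j → P j → m ≤ j)) go _
  where
  go : ∀ k → (∀ {j} → j < k → P j → ∃ λ m → P m × (∀ j → P j → m ≤ j)) →
    P k → ∃ λ m → P m × (∀ j → P j → m ≤ j)
  go k rec p with anyUpTo? P? k
  ... | yes (j , j<k , q) = rec j<k q
  ... | no none = k , p , λ j q → ≮⇒≥ λ j<k → none (j , j<k , q)

halve : ∀ m → ∃ λ h → m ≡ 2 * h ⊎ m ≡ 1 + 2 * h
halve zero    = 0 , inj₁ refl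
halve (suc m) with halve m
... | h , inj₁ eq = h , inj₂ (cong suc eq)
... | h , inj₂ eq = suc h , inj₁ (lin 2 (λ m h → m :≡ con 1 :+ 2 :* h ⇒ ⊢ con 1 :+ m :≡ 2 :* (con 1 :+ h)) m h eq)

module Cycles {n : ℕ} (G : Graph n) (conn : Connected G) (conn₂ : StaysConnected G) where

  open Detours G conn public

  -- Indexing by all of ℕ with a period makes rotation a shift of the argument and keeps modular
  -- arithmetic out of the applications.
  record IsoCycle (f : ℕ → V) (L : ℕ) : Set where
    field
      periodic : ∀ i → f (i + L) ≡ f i
      short    : ∀ i g → 2 * g ≤ L → d (f i) (f (i + g)) ≡ g

    long : ∀ i g h → g + h ≡ L → L ≤ 2 * g → d (f i) (f (i + g)) ≡ h
    long i g h eq L≤ = trans (d-sym (f i) _) (trans (cong (d (f (i + g))) (sym around))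
      (short (i + g) h (lin 3 (λ g h l → g :+ h :≡ l ⇒ l :≤ 2 :* g ⇒ ⊢ 2 :* h :≤ l) g h L eq L≤)))
      where
      around : f (i + g + h) ≡ f i
      around = trans (cong f (trans (+-assoc i g h) (cong (i +_) eq))) (periodic i)

    rotate : ∀ i → IsoCycle (λ j → f (i + j)) L
    rotate i = record
      { periodic = λ j → trans (cong f (sym (+-assoc i j L))) (periodic (i + j))
      ; short    = λ j g le → trans (cong (λ k → d (f (i + j)) (f k)) (sym (+-assoc i j g))) (short (i + j) g le)
      }

    adjacent : 2 ≤ L → ∀ i → f i ~ f (suc i)
    adjacent 2≤L i = d≡1⇒~ (trans (cong (λ k → d (f i) (f k)) (+-comm 1 i)) (short i 1 2≤L))

    far₂ : 4 ≤ L → ∀ i → Far (f i) (f (2 + i))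
    far₂ 4≤L i = ≤-reflexive (sym (trans (cong (λ k → d (f i) (f k)) (+-comm 2 i)) (short i 2 4≤L)))

    distinct : ∀ i g → 1 ≤ g → g < L → f i ≢ f (i + g)
    distinct i g 1≤g g<L eq with ≤-total (2 * g) L
    ... | inj₁ le = contradiction (trans (sym (short i g le)) (trans (cong (d (f i)) (sym eq)) (d-refl (f i))))
      λ { refl → contradiction 1≤g λ () }
    ... | inj₂ ge = contradiction (trans (sym (long i g (L ∸ g) (m+[n∸m]≡n (<⇒≤ g<L)) ge))
        (trans (cong (d (f i)) (sym eq)) (d-refl (f i))))
      (m>n⇒m∸n≢0 g<L)

    -- The edge f (g + b + 1) f (g + b) on the arc opposite to f 0 … f g.
    module _ (g b a : ℕ) (sum : suc (g + b) + a ≡ L) (2g<L : 2 * g < L)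
             (L≤ : L ≤ 2 * (g + b)) (≤L : 2 * suc b ≤ L) where
      private
        top : d (f 0) (f (suc (g + b))) ≡ a
        top = long 0 (suc (g + b)) a sum (lin 3 (λ g b l → l :≤ 2 :* (g :+ b) ⇒
            ⊢ l :≤ 2 :* (con 1 :+ (g :+ b))) g b L L≤)
        bottom : d (f 0) (f (g + b)) ≡ suc a
        bottom = long 0 (g + b) (suc a) (trans (+-suc (g + b) a) sum) L≤
        bottom′ : d (f g) (f (g + b)) ≡ b
        bottom′ = short g b (lin 2 (λ b l → 2 :* (con 1 :+ b) :≤ l ⇒ ⊢ 2 :* b :≤ l) b L ≤L)
        top′ : d (f g) (f (suc (g + b))) ≡ suc b
        top′ = trans (cong (λ k → d (f g) (f k)) (sym (+-suc g b))) (short g (suc b) ≤L)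

      opposite-good : Good (f 0) (f g) (f (suc (g + b)) , f (g + b))
      opposite-good = good
        (~-sym (adjacent (lin 2 (λ b l → 2 :* (con 1 :+ b) :≤ l ⇒ ⊢ con 2 :≤ l) b L ≤L) (g + b)))
        (subst₂ _<_ (sym top) (sym bottom) ≤-refl)
        (subst₂ _<_ (sym bottom′) (sym top′) ≤-refl)

      -- The route from `f 0` to `f g` over the opposite edge goes round the other side of the cycle
      -- and has length L - g, which exceeds g.
      opposite-off : d (f 0) (f (suc (g + b))) + suc (d (f (g + b)) (f g)) ≢ d (f 0) (f g)
      opposite-off eq = lin 7
        (λ x y z g b a l → x :+ (con 1 :+ y) :≡ z ⇒ x :≡ a ⇒ y :≡ b ⇒ z :≡ g ⇒
          con 1 :+ (g :+ b) :+ a :≡ l ⇒ 2 :* g :< l ⇒ ⊢ absurdity)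
        (d (f 0) (f (suc (g + b)))) (d (f (g + b)) (f g)) (d (f 0) (f g)) g b a L
        eq top (trans (d-sym _ (f g)) bottom′) (short 0 g (<⇒≤ 2g<L)) sum 2g<L

    opposite₁ : ∀ g b a → suc (g + b) + a ≡ L → 2 * g < L → L ≤ 2 * (g + b) → 2 * suc b ≤ L →
      1 ≤ e (f 0) (f g)
    opposite₁ g b a p q r s = offGeodesics ([] ∷ []) (opposite-good g b a p q r s ∷ [])
        (opposite-off g b a p q r s ∷ [])

    opposite₂ : ∀ g b a → suc (g + b) + suc a ≡ L → 2 * g < L → L ≤ 2 * (g + b) → 2 * suc (suc b) ≤ L →
      2 ≤ e (f 0) (f g)
    opposite₂ g b a p q r s = offGeodesics ((≢ʳ
        (subst (λ k → f (g + b) ≢ f k) (+-comm (g + b) 1) (distinct (g + b) 1 ≤-refl 1<L)) ∷ []) ∷ [] ∷ [])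
      (opposite-good g b (suc a) p q r s′ ∷ subst (λ k →
          Good (f 0) (f g) (f (suc k) , f k)) (+-suc g b) (opposite-good g (suc b) a p′ q r′ s) ∷ [])
      (opposite-off g b (suc a) p q r s′ ∷ subst (λ k →
          d (f 0) (f (suc k)) + suc (d (f k) (f g)) ≢ d (f 0) (f g)) (+-suc g b)
          (opposite-off g (suc b) a p′ q r′ s) ∷ [])
      where
      1<L = lin 2 (λ b l → 2 :* (con 2 :+ b) :≤ l ⇒ ⊢ con 1 :< l) b L s
      s′ = lin 2 (λ b l → 2 :* (con 2 :+ b) :≤ l ⇒ ⊢ 2 :* (con 1 :+ b) :≤ l) b L s
      p′ : suc (g + suc b) + a ≡ L
      p′ = lin 4 (λ g b a l → con 1 :+ (g :+ b) :+ (con 1 :+ a) :≡ l ⇒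
          ⊢ con 1 :+ (g :+ (con 1 :+ b)) :+ a :≡ l) g b a L p
      r′ : L ≤ 2 * (g + suc b)
      r′ = lin 3 (λ g b l → l :≤ 2 :* (g :+ b) ⇒ ⊢ l :≤ 2 :* (g :+ (con 1 :+ b))) g b L r

  open IsoCycle

  R≥₄ : ∀ {w a b c z S} → a ∈ S → b ∈ S → c ∈ S → z ∈ S → a ≢ b → a ≢ c → a ≢ z → b ≢ c → b ≢ z → c ≢ z →
    e w a + e w b + (e w c + e w z) ≤ R w S
  R≥₄ {w} {a} {b} {c} {z} a∈ b∈ c∈ z∈ ab ac az bc bz cz = ≤-trans
    (lin 4 (λ a b c z → ⊢ a :+ b :+ (c :+ z) :≤ a :+ (b :+ (c :+ (z :+ con 0)))) (e w a) (e w b) (e w c) (e w z))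
    (R-lower w ((ab ∷ ac ∷ az ∷ []) ∷ (bc ∷ bz ∷ []) ∷ (cz ∷ []) ∷ [] ∷ []) (a∈ ∷ b∈ ∷ c∈ ∷ z∈ ∷ []))

  module _ {f L X} (iso : IsoCycle f L) (f∈X : ∀ j → f j ∈ X) where

    both-sides : ∀ {g m} → g ≤ L → (∀ {f} → IsoCycle f L → m ≤ e (f 0) (f g)) →
      m ≤ e (f 0) (f g) × m ≤ e (f 0) (f (L ∸ g))
    both-sides {g} {m} g≤L lower = lower iso , subst (m ≤_) (trans (e-sym _ _) (cong₂ e
        (trans (cong f (m∸n+n≡m g≤L)) (periodic iso 0))
        (cong f (+-identityʳ _))))
      (lower (rotate iso (L ∸ g)))

    four-partners : ∀ g g′ {m m′} → 1 ≤ g′ → g′ < g → 2 * g < L →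
      (∀ {f} → IsoCycle f L → m ≤ e (f 0) (f g)) → (∀ {f} → IsoCycle f L → m′ ≤ e (f 0) (f g′)) →
      2 * (m + m′) ≤ R (f 0) X
    four-partners g g′ {m} {m′} 1≤g′ g′<g 2g<L lower lower′ = ≤-trans
      (lin 6 (λ m m′ a b c z → m :≤ a ⇒ m :≤ b ⇒ m′ :≤ c ⇒ m′ :≤ z ⇒ ⊢ 2 :* (m :+ m′) :≤ a :+ b :+ (c :+ z))
        m m′ _ _ _ _ (proj₁ p) (proj₂ p) (proj₁ p′) (proj₂ p′))
      (R≥₄ (f∈X _) (f∈X _) (f∈X _) (f∈X _)
        (differ (lin 3 (λ g h l → g :+ h :≡ l ⇒ 2 :* g :< l ⇒ ⊢ g :< h) g (L ∸ g) L hg 2g<L) (h<L g 1≤g hg))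
        (differ g′<g g<L ∘ sym)
        (differ (lin 5 (λ g g′ h h′ l → g :+ h :≡ l ⇒ g′ :+ h′ :≡ l ⇒ g′ :< g ⇒ 2 :* g :< l ⇒
            ⊢ g :< h′) g g′ (L ∸ g) (L ∸ g′) L hg hg′ g′<g 2g<L) (h<L g′ 1≤g′ hg′))
        (differ (lin 4 (λ g g′ h l → g :+ h :≡ l ⇒ g′ :< g ⇒ 2 :* g :< l ⇒
            ⊢ g′ :< h) g g′ (L ∸ g) L hg g′<g 2g<L) (h<L g 1≤g hg) ∘ sym)
        (differ (lin 5 (λ g g′ h h′ l → g :+ h :≡ l ⇒ g′ :+ h′ :≡ l ⇒ g′ :< g ⇒
            ⊢ h :< h′) g g′ (L ∸ g) (L ∸ g′) L hg hg′ g′<g) (h<L g′ 1≤g′ hg′))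
        (differ (lin 4 (λ g g′ h′ l → g′ :+ h′ :≡ l ⇒ g′ :< g ⇒ 2 :* g :< l ⇒
            ⊢ g′ :< h′) g g′ (L ∸ g′) L hg′ g′<g 2g<L) (h<L g′ 1≤g′ hg′)))
      where
      g<L = lin 2 (λ g l → 2 :* g :< l ⇒ ⊢ g :< l) g L 2g<L
      1≤g = ≤-trans 1≤g′ (<⇒≤ g′<g)
      hg = m+[n∸m]≡n (<⇒≤ g<L)
      hg′ = m+[n∸m]≡n (<⇒≤ (<-trans g′<g g<L))
      p = both-sides (<⇒≤ g<L) lower
      p′ = both-sides (<⇒≤ (<-trans g′<g g<L)) lower′
      h<L : ∀ g → 1 ≤ g → g + (L ∸ g) ≡ L → L ∸ g < L
      h<L g 1≤g eq = lin 3 (λ g h l → con 1 :≤ g ⇒ g :+ h :≡ l ⇒ ⊢ h :< l) g (L ∸ g) L 1≤g eq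
      differ : ∀ {i j} → i < j → j < L → f i ≢ f j
      differ {i} {j} i<j j<L eq = distinct iso i (j ∸ i) (m<n⇒0<n∸m i<j)
        (≤-<-trans (m∸n≤m j i) j<L) (trans eq (cong f (sym (m+[n∸m]≡n (<⇒≤ i<j)))))

    -- Partners are taken on both sides of `f 0`: for even L at distances L/2 - 1 and 1, for L = 2h
    -- + 1 at distances h and h - 1. The farther ones have excess at least 2 and the nearer ones at
    -- least 1, in total 2 (2 + 1). The antipode of an even cycle is left out, since its two sides
    -- coincide.
    long-row₀ : 6 ≤ L → 6 ≤ R (f 0) X
    long-row₀ 6≤L with halve L
    ... | zero , inj₁ refl = contradiction 6≤L λ ()
    ... | zero , inj₂ refl = contradiction 6≤L λ { (s≤s ()) }
    ... | 1 , inj₁ refl = contradiction 6≤L λ { (s≤s (s≤s ())) }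
    ... | 1 , inj₂ refl = contradiction 6≤L λ { (s≤s (s≤s (s≤s ()))) }
    ... | 2 , inj₁ refl = contradiction 6≤L λ { (s≤s (s≤s (s≤s (s≤s ())))) }
    ... | 2 , inj₂ refl = contradiction 6≤L λ { (s≤s (s≤s (s≤s (s≤s (s≤s ()))))) }
    ... | suc (suc (suc k)) , inj₁ refl = four-partners (2 + k) 1 ≤-refl (s≤s (s≤s z≤n))
      (lin 1 (λ k → ⊢ 2 :* (con 2 :+ k) :< 2 :* (con 3 :+ k)) k)
      (λ iso → opposite₂ iso (2 + k) 1 (suc k)
        (lin 1 (λ k → ⊢ con 1 :+ (con 2 :+ k :+ con 1) :+ (con 1 :+ (con 1 :+ k)) :≡ 2 :* (con 3 :+ k)) k)
        (lin 1 (λ k → ⊢ 2 :* (con 2 :+ k) :< 2 :* (con 3 :+ k)) k)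
        (lin 1 (λ k → ⊢ 2 :* (con 3 :+ k) :≤ 2 :* (con 2 :+ k :+ con 1)) k)
        (lin 1 (λ k → ⊢ con 6 :≤ 2 :* (con 3 :+ k)) k))
      (λ iso → opposite₁ iso 1 (2 + k) (2 + k)
        (lin 1 (λ k → ⊢ con 1 :+ (con 1 :+ (con 2 :+ k)) :+ (con 2 :+ k) :≡ 2 :* (con 3 :+ k)) k)
        (lin 1 (λ k → ⊢ con 2 :< 2 :* (con 3 :+ k)) k)
        (lin 1 (λ k → ⊢ 2 :* (con 3 :+ k) :≤ 2 :* (con 1 :+ (con 2 :+ k))) k)
        (lin 1 (λ k → ⊢ 2 :* (con 3 :+ k) :≤ 2 :* (con 3 :+ k)) k))
    ... | suc (suc (suc k)) , inj₂ refl = four-partners (3 + k) (2 + k) (s≤s z≤n) ≤-refl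
      (lin 1 (λ k → ⊢ 2 :* (con 3 :+ k) :< con 1 :+ 2 :* (con 3 :+ k)) k)
      (λ iso → opposite₂ iso (3 + k) 1 (suc k)
        (lin 1 (λ k → ⊢ con 1 :+ (con 3 :+ k :+ con 1) :+ (con 1 :+ (con 1 :+ k)) :≡ con 1 :+ 2 :* (con 3 :+ k)) k)
        (lin 1 (λ k → ⊢ 2 :* (con 3 :+ k) :< con 1 :+ 2 :* (con 3 :+ k)) k)
        (lin 1 (λ k → ⊢ con 1 :+ 2 :* (con 3 :+ k) :≤ 2 :* (con 3 :+ k :+ con 1)) k)
        (lin 1 (λ k → ⊢ con 6 :≤ con 1 :+ 2 :* (con 3 :+ k)) k))
      (λ iso → opposite₁ iso (2 + k) 2 (2 + k)
        (lin 1 (λ k → ⊢ con 1 :+ (con 2 :+ k :+ con 2) :+ (con 2 :+ k) :≡ con 1 :+ 2 :* (con 3 :+ k)) k)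
        (lin 1 (λ k → ⊢ 2 :* (con 2 :+ k) :< con 1 :+ 2 :* (con 3 :+ k)) k)
        (lin 1 (λ k → ⊢ con 1 :+ 2 :* (con 3 :+ k) :≤ 2 :* (con 2 :+ k :+ con 2)) k)
        (lin 1 (λ k → ⊢ con 6 :≤ con 1 :+ 2 :* (con 3 :+ k)) k))

  long-row : ∀ {f L X} → IsoCycle f L → 6 ≤ L → (∀ j → f j ∈ X) → ∀ i → 6 ≤ R (f i) X
  long-row {f} {X = X} iso 6≤L f∈X i = subst (λ k → 6 ≤ R (f k) X) (+-identityʳ i)
    (long-row₀ (rotate iso i) (λ j → f∈X (i + j)) 6≤L)

-- Isometric cycles through the boundary of a set

module MixedCycles {n : ℕ} (G : Graph n) (conn : Connected G) (conn₂ : StaysConnected G) where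

  open Cycles G conn conn₂ public

  -- The edge in `S` and the edge leaving `S` are consecutive, with common end `f 0`; `1≤k` excludes
  -- a closed walk of length two.
  record MixedCycle (S : List V) : Set where
    field
      f   : ℕ → V
      k   : ℕ
      iso : IsoCycle f (2 + k)
      f₀∈ : f 0 ∈ S
      f₁∉ : f 1 ∉ S
      fₗ∈ : f (1 + k) ∈ S
      1≤k : 1 ≤ k

  Avoiding : V → ℕ → V → V → Set
  Avoiding t = Walk (isolate G t)

  end-avoids : ∀ {t k u v} → u ≢ t → Avoiding t k u v → v ≢ t
  end-avoids u≢t []                  = u≢t
  end-avoids _   ((_ , _ , x≢t) ∷ p) = end-avoids x≢t p

  avoid : ∀ {t k u v} → u ≢ t → v ≢ t → Walk G k u v →
    Avoiding t k u v ⊎ ∃₂ λ i j → i + j ≡ k × Walk G i u t × Walk G j t v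
  avoid u≢t v≢t [] = inj₁ []
  avoid {t} u≢t v≢t (_∷_ {v = x} e p) with x Fin.≟ t
  ... | yes refl = inj₂ (1 , _ , refl , e ∷ [] , p)
  ... | no x≢t with avoid x≢t v≢t p
  ... | inj₁ q                     = inj₁ ((e , u≢t , x≢t) ∷ q)
  ... | inj₂ (i , j , eq , q , q′) = inj₂ (suc i , j , cong suc eq , e ∷ q , q′)

  module _ {H : Graph n} where

    position : ∀ {k u v} → Walk H k u v → ℕ → V
    position {u = u} _       zero    = u
    position         (_ ∷ p) (suc i) = position p i
    -- Past its end the walk rests at its last vertex; only positions up to the length are used.
    position {u = u} []      (suc _) = u

    split : ∀ {k u v} (p : Walk H k u v) i j → k ≡ i + j →
      Walk H i u (position p i) × Walk H j (position p i) v
    split p       zero    j refl = [] , p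
    split (e ∷ p) (suc i) j eq with q , q′ ← split p i j (suc-injective eq) = e ∷ q , q′

    position-end : ∀ {k u v} (p : Walk H k u v) → position p k ≡ v
    position-end []      = refl
    position-end (_ ∷ p) = position-end p

    position-step : ∀ {k u v} (p : Walk H k u v) i → i < k → Graph._~_ H (position p i) (position p (suc i))
    position-step (e ∷ _) zero    _         = e
    position-step (_ ∷ p) (suc i) (s≤s i<k) = position-step p i i<k

  Detour : List V → ℕ → Set
  Detour S k = ∃ λ t → ∃ λ s → ∃ λ w → (t ∈ S × s ∈ S × w ∉ S) × (t ~ s × t ~ w) × Avoiding t k w s

  detour? : ∀ S k → Dec (Detour S k)
  detour? S k = Fin.any? λ t → Fin.any? λ s → Fin.any? λ w →
    ((t ∈? S) ×-dec ((s ∈? S) ×-dec ¬? (w ∈? S))) ×-dec (((t ~? s) ×-dec (t ~? w)) ×-dec walk? (isolate G t) k w s)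

  -- A shortest detour closes up, through t, to an isometric cycle: a shortcut
  -- would use another edge at t, which either lies in S or leaves S, and in
  -- both cases yields a shorter detour.
  module Shortest {S : List V} {k : ℕ} {t s w : V} (t∈ : t ∈ S) (s∈ : s ∈ S) (w∉ : w ∉ S)
    (t~s : t ~ s) (t~w : t ~ w) (p : Avoiding t k w s) (shortest : ∀ j → Detour S j → k ≤ j) where

    private
      v : ℕ → V
      v = position p

      v≢t : ∀ i j → k ≡ i + j → v i ≢ t
      v≢t i j eq = end-avoids (~⇒≢ (~-sym t~w)) (proj₁ (split p i j eq))

      from-t : ∀ i j → k ≡ i + j → suc i ≤ d t (v i) ⊎ suc j ≤ d t (v i)
      from-t i j eq = go (d t (v i)) refl
        where
        before = proj₁ (split p i j eq)
        after  = proj₂ (split p i j eq)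
        go : ∀ l → d t (v i) ≡ l → suc i ≤ l ⊎ suc j ≤ l
        go zero    eq′ = contradiction (sym (d≡0 eq′)) (v≢t i j eq)
        go (suc l) eq′ with u , t~u , dul ← step eq′
          with avoid (~⇒≢ (~-sym t~u)) (v≢t i j eq) (subst (λ l → Walk G l u (v i)) dul (d-walk u (v i)))
        ... | inj₂ (a , b , a+b≡l , _ , q) = contradiction (d-minimal q)
          (<⇒≱ (lin 4 (λ a b l x → a :+ b :≡ l ⇒ x :≡ con 1 :+ l ⇒ ⊢ b :< x) a b l (d t (v i)) a+b≡l eq′))
        ... | inj₁ q with u ∈? S
        ... | yes u∈ = inj₂ (lin 4 (λ i j k l → k :≤ i :+ l ⇒ k :≡ i :+ j ⇒ ⊢ con 1 :+ j :≤ con 1 :+ l) i j k l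
          (shortest _ (t , u , w , (t∈ , u∈ , w∉) , (t~u , t~w) ,
            _+++_ (isolate G t) before (reverse-walk (isolate G t) q))) eq)
        ... | no u∉ = inj₁ (lin 4 (λ i j k l → k :≤ l :+ j ⇒ k :≡ i :+ j ⇒ ⊢ con 1 :+ i :≤ con 1 :+ l) i j k l
          (shortest _ (t , s , u , (t∈ , s∈ , u∉) , (t~s , t~u) , _+++_ (isolate G t) q after)) eq)

      -- A shorter connection avoiding `t` would shorten the detour. One through `t` splits into two
      -- pieces bounded by `from-t`, so it is at least as long as one of the two arcs; the arc
      -- through `t` has length `suc i + suc j`.
      between : ∀ i g j → k ≡ i + g + j → g ≤ d (v i) (v (i + g)) ⊎ suc i + suc j ≤ d (v i) (v (i + g))
      between i g j eq with avoid (v≢t i (g + j) eq′) (v≢t (i + g) j eq) (d-walk (v i) (v (i + g)))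
        where eq′ = trans eq (+-assoc i g j)
      ... | inj₁ q = inj₁ (lin 5 (λ i g j k l → k :≤ i :+ (l :+ j) ⇒ k :≡ i :+ g :+ j ⇒ ⊢ g :≤ l) i g j k _
        (shortest _ (t , s , w , (t∈ , s∈ , w∉) , (t~s , t~w) ,
          _+++_ (isolate G t) (proj₁ (split p i (g + j) (trans eq (+-assoc i g j))))
            (_+++_ (isolate G t) q (proj₂ (split p (i + g) j eq))))) eq)
      ... | inj₂ (a , b , a+b≡ , q , q′)
        with from-t i (g + j) (trans eq (+-assoc i g j)) | from-t (i + g) j eq
           | ≤-trans (≤-reflexive (d-sym t (v i))) (d-minimal q) | d-minimal q′
      ... | inj₁ x | inj₁ y | da | db = inj₁ (lin 6 (λ i g a b l m → con 1 :+ (i :+ g) :≤ m ⇒ m :≤ b ⇒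
          a :+ b :≡ l ⇒ ⊢ g :≤ l)
            i g a b _ _ y db a+b≡)
      ... | inj₁ x | inj₂ y | da | db = inj₂ (lin 7 (λ i j a b l m m′ → con 1 :+ i :≤ m ⇒ m :≤ a ⇒
          con 1 :+ j :≤ m′ ⇒ m′ :≤ b ⇒ a :+ b :≡ l ⇒
            ⊢ con 1 :+ i :+ (con 1 :+ j) :≤ l) i j a b _ _ _ x da y db a+b≡)
      ... | inj₂ x | _ | da | db = inj₁ (lin 6 (λ g j a b l m → con 1 :+ (g :+ j) :≤ m ⇒ m :≤ a ⇒ a :+ b :≡ l ⇒
          ⊢ g :≤ l)
            g j a b _ _ x da a+b≡)

      F : ℕ → V
      F zero    = t
      F (suc i) = v i

      apart-F : ∀ a g b → a + g + b ≡ suc k → g ≤ d (F a) (F (a + g)) ⊎ suc (a + b) ≤ d (F a) (F (a + g))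
      apart-F zero    zero    b eq = inj₁ z≤n
      apart-F zero    (suc i) b eq = from-t i b (sym (suc-injective eq))
      apart-F (suc i) g       b eq with between i g b (sym (suc-injective eq))
      ... | inj₁ x = inj₁ x
      ... | inj₂ x = inj₂ (subst (_≤ d (v i) (v (i + g))) (cong suc (+-suc i b)) x)

      L : ℕ
      L = 2 + k

      opaque
        f : ℕ → V
        f i = F (i % L)

        f-reduce : ∀ {c} q → c < L → f (c + q * L) ≡ F c
        f-reduce {c} q c<L = cong F (trans ([m+kn]%n≡m%n c q L) (m<n⇒m%n≡m c<L))

        f-periodic : ∀ i → f (i + L) ≡ f i
        f-periodic i = cong F (trans (cong (λ m → (i + m) % L) (sym (*-identityˡ L))) ([m+kn]%n≡m%n i 1 L))

      F-step : ∀ a → a < suc k → F a ~ F (suc a)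
      F-step zero    _         = t~w
      F-step (suc i) (s≤s i<k) = proj₁ (position-step p i i<k)

      f-step : ∀ i → f i ~ f (suc i)
      f-step i = subst (λ i → f i ~ f (suc i)) (sym (m≡m%n+[m/n]*n i L)) (go (i % L) (i / L) (m%n<n i L))
        where
        go : ∀ a q → a < L → f (a + q * L) ~ f (suc a + q * L)
        go a q a<L with m≤n⇒m<n∨m≡n (≤-pred a<L)
        ... | inj₁ a<k = subst₂ _~_ (sym (f-reduce q a<L)) (sym (f-reduce q (s≤s a<k))) (F-step a a<k)
        ... | inj₂ refl = subst₂ _~_ (sym (trans (f-reduce q a<L) (position-end p)))
          (sym (f-reduce {0} (suc q) (s≤s z≤n))) (~-sym t~s)

      f-upper : ∀ i g → d (f i) (f (i + g)) ≤ g
      f-upper i zero    = ≤-reflexive (trans (cong (λ j → d (f i) (f j)) (+-identityʳ i)) (d-refl (f i)))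
      f-upper i (suc g) = ≤-trans (≤-reflexive (cong (λ j → d (f i) (f j)) (+-suc i g)))
        (≤-trans (d-stepʳ (f i) (f-step (i + g))) (s≤s (f-upper i g)))

      f-lower : ∀ a q g → a < L → 2 * g ≤ L → g ≤ d (f (a + q * L)) (f (a + q * L + g))
      f-lower a q g a<L 2g≤L with a + g <? L
      ... | yes a+g<L = subst₂ (λ x y → g ≤ d x y) (sym (f-reduce q a<L))
          (trans (sym (f-reduce q a+g<L)) (cong f (lin 3 (λ a g m → ⊢ a :+ g :+ m :≡ a :+ m :+ g) a g (q * L)))) lower
        where
        b = L ∸ suc (a + g)
        ab : a + g + b ≡ suc k
        ab = suc-injective (m+[n∸m]≡n a+g<L)
        lower : g ≤ d (F a) (F (a + g))
        lower with apart-F a g b ab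
        ... | inj₁ x = x
        ... | inj₂ x = lin 5 (λ a g b k x → con 1 :+ (a :+ b) :≤ x ⇒ a :+ g :+ b :≡ con 1 :+ k ⇒
            2 :* g :≤ con 2 :+ k ⇒ ⊢ g :≤ x) a g b k _ x ab 2g≤L
      -- The target wraps past the start to position `c`. Seen from there, `a` lies `h` = L - g
      -- steps ahead, which is at least `g`, and the complementary arc has length `g`.
      ... | no a+g≮L = subst₂ (λ x y → g ≤ d x y) (sym (f-reduce q a<L))
          (trans (sym (f-reduce (suc q) c<L)) (cong f
              (lin 5 (λ a g c l m → l :+ c :≡ a :+ g ⇒ ⊢ c :+ (l :+ m) :≡ a :+ m :+ g) a g c L (q * L) Lc)))
          (≤-trans lower (≤-reflexive (d-sym (F c) (F a))))
        where
        c = a + g ∸ L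
        Lc : L + c ≡ a + g
        Lc = m+[n∸m]≡n (≮⇒≥ a+g≮L)
        c<L : c < L
        c<L = lin 4 (λ a g c l → l :+ c :≡ a :+ g ⇒ a :< l ⇒ 2 :* g :≤ l ⇒ ⊢ c :< l) a g c L Lc a<L 2g≤L
        h = L ∸ g
        gh : g + h ≡ L
        gh = m+[n∸m]≡n (lin 2 (λ g l → 2 :* g :≤ l ⇒ ⊢ g :≤ l) g L 2g≤L)
        ch : c + h ≡ a
        ch = lin 5 (λ a g c h l → l :+ c :≡ a :+ g ⇒ g :+ h :≡ l ⇒ ⊢ c :+ h :≡ a) a g c h L Lc gh
        b = L ∸ suc a
        ab : suc a + b ≡ L
        ab = m+[n∸m]≡n a<L
        lower : g ≤ d (F c) (F a)
        lower = pick (subst (λ y → h ≤ d (F c) (F y) ⊎ suc (c + b) ≤ d (F c) (F y)) ch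
          (apart-F c h b (lin 5 (λ a b c h k → con 1 :+ a :+ b :≡ con 2 :+ k ⇒ c :+ h :≡ a ⇒
              ⊢ c :+ h :+ b :≡ con 1 :+ k) a b c h k ab ch)))
          where
          pick : h ≤ d (F c) (F a) ⊎ suc (c + b) ≤ d (F c) (F a) → g ≤ d (F c) (F a)
          pick (inj₁ x) = lin 4 (λ g h l x → h :≤ x ⇒ g :+ h :≡ l ⇒ 2 :* g :≤ l ⇒ ⊢ g :≤ x) g h L _ x gh 2g≤L
          pick (inj₂ x) = lin 7 (λ a g b c h l x → con 1 :+ (c :+ b) :≤ x ⇒ con 1 :+ a :+ b :≡ l ⇒
              c :+ h :≡ a ⇒ g :+ h :≡ l ⇒ ⊢ g :≤ x)
            a g b c h L _ x ab ch gh

    mixed : MixedCycle S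
    mixed = record
      { f = f ; k = k
      ; iso = record
        { periodic = f-periodic
        ; short = λ i g le → ≤-antisym (f-upper i g)
            (subst (λ i → g ≤ d (f i) (f (i + g))) (sym (m≡m%n+[m/n]*n i L))
                (f-lower (i % L) (i / L) g (m%n<n i L) le))
        }
      ; f₀∈ = subst (_∈ S) (sym (f-reduce {0} 0 (s≤s z≤n))) t∈
      ; f₁∉ = subst (_∉ S) (sym (f-reduce {1} 0 (s≤s (s≤s z≤n)))) w∉
      ; fₗ∈ = subst (_∈ S) (sym (trans (cong f (sym (+-identityʳ (1 + k))))
          (trans (f-reduce 0 ≤-refl) (position-end p)))) s∈
      ; 1≤k = positive p
      }
      where
      positive : ∀ {k} → Avoiding t k w s → 1 ≤ k
      positive []      = contradiction s∈ w∉
      positive (_ ∷ _) = s≤s z≤n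

  mixedCycle : ∀ {S t s w} → t ∈ S → s ∈ S → w ∉ S → t ~ s → t ~ w → MixedCycle S
  mixedCycle {S} {t} {s} {w} t∈ s∈ w∉ t~s t~w = build (minimum (detour? S) start)
    where
    start = t , s , w , (t∈ , s∈ , w∉) , (t~s , t~w) , proj₂ (conn₂ t (~⇒≢ (~-sym t~w)) (~⇒≢ (~-sym t~s)))
    build : (∃ λ m → Detour S m × (∀ j → Detour S j → m ≤ j)) → MixedCycle S
    build (_ , (_ , _ , _ , (t∈ , s∈ , w∉) , (t~s , t~w) , p) , shortest) =
      Shortest.mixed t∈ s∈ w∉ t~s t~w p shortest

-- Attaching ears

module Ears {n : ℕ} (G : Graph n) (conn : Connected G) (conn₂ : StaysConnected G) where

  open MixedCycles G conn conn₂ public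

  Thin : List V → Set
  Thin S = ∀ {w t t′} → w ∉ S → t ∈ S → t′ ∈ S → w ~ t → w ~ t′ → t ≡ t′

  Diameter₂ : List V → Set
  Diameter₂ S = ∀ {u v} → u ∈ S → v ∈ S → d u v ≤ 2

  -- Serves a pentagon ear with three new vertices over the edge `p q`: the triangle with apex `z`
  -- and the further neighbour `z′` raise its gain by the last unit needed for deficit 4.
  Rich : List V → Set
  Rich S = ∀ {p q} → p ∈ S → q ∈ S → p ~ q → ∃ λ z → ∃ λ z′ →
    (z ∈ S × z ~ p × z ~ q) × (z′ ∈ S × z′ ≢ p × z′ ≢ q × (z′ ~ p ⊎ z′ ~ q)) × z ≢ z′

  -- The target grows by 4 per vertex in doubled terms; `δ` is the doubled deficit of `S` that the
  -- extension makes good on top of this.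
  record Extension (S : List V) (δ : ℕ) : Set where
    field
      new      : List V
      nonempty : 1 ≤ length new
      nice     : Nice (new ++ S)
      gain     : E S + 4 * length new + δ ≤ E (new ++ S)

  neighbour : ∀ {S t b r} → Linked S → t ∈ S → b ∈ S → t ≢ b → t ≢ r → b ≢ r →
    ∃ λ z → z ∈ S × t ~ z × z ≢ r
  neighbour {r = r} linked t∈ b∈ t≢b t≢r b≢r with linked r t∈ b∈ t≢r b≢r
  ... | [ _ ]          = contradiction refl t≢b
  ... | _ ∷⟨ e ⟩ c = _ , proj₁ (first c) , e , proj₂ (first c)

  E-∷∷ : ∀ w x S → E S + 2 * (R w S + R x S) ≤ E (w ∷ x ∷ S)
  E-∷∷ w x S = lin 7 (λ es rw rx ex e es′ rw′ → es :+ 2 :* rx :≤ es′ ⇒ es′ :+ 2 :* rw′ :≤ ex ⇒ rw′ :≡ e :+ rw ⇒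
      ⊢ es :+ 2 :* (rw :+ rx) :≤ ex)
    (E S) (R w S) (R x S) (E (w ∷ x ∷ S)) (e w x) (E (x ∷ S)) (R w (x ∷ S)) (E-∷ x S) (E-∷ w (x ∷ S)) refl

  -- Of the pairs among the new vertices only `w`, `y` is kept. In the application they are
  -- consecutive on a pentagon, so this is the pair at distance two.
  E-∷∷∷ : ∀ w x y S → E S + 2 * (e w y + (R w S + R x S + R y S)) ≤ E (w ∷ x ∷ y ∷ S)
  E-∷∷∷ w x y S = lin 12 (λ es rw rx ry e₁ e₂ e₃ ex rx′ ey rw′ ew →
      es :+ 2 :* ry :≤ ey ⇒ ey :+ 2 :* rx′ :≤ ex ⇒ ex :+ 2 :* rw′ :≤ ew ⇒ rx′ :≡ e₁ :+ rx ⇒ rw′ :≡ e₂ :+ (e₃ :+ rw) ⇒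
      ⊢ es :+ 2 :* (e₃ :+ (rw :+ rx :+ ry)) :≤ ew)
    (E S) (R w S) (R x S) (R y S) (e x y) (e w x) (e w y) (E (x ∷ y ∷ S)) (R x (y ∷ S)) (E (y ∷ S)) (R w (x ∷ y ∷ S))
    (E (w ∷ x ∷ y ∷ S)) (E-∷ y S) (E-∷ x (y ∷ S)) (E-∷ w (x ∷ y ∷ S)) refl refl

  -- The shortcut through b gives a second geodesic if d o z ≡ 3.
  cross-shortcut : ∀ {o z w t b} → Cross o z w t → o ~ b → b ≢ w → d b z ≤ 2 → 1 ≤ e o z
  cross-shortcut {o} {z} {w} {t} {b} c o~b b≢w dbz≤2 with d o z ≟ℕ 3
  ... | no  d≢3 = cross₁ c d≢3
  ... | yes d≡3 = offGeodesic (Cross.xa c) geo ([] ∷ [])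
    (good o~b (subst₂ _<_ (sym (d-refl o)) (sym (~⇒d≡1 o~b)) (s≤s z≤n))
      (subst₂ _<_ (d-sym b z) (trans (sym d≡3) (d-sym o z)) (s≤s dbz≤2)) ∷ [])
    ((≢ʳ b≢w , head-not-on geo) ∷ [])
    where geo = trans d≡3 (cong suc (sym (d-a-y c)))

  record Pentagon (a b c x y : V) : Set where
    field
      ab : a ~ b
      bc : b ~ c
      cx : c ~ x
      xy : x ~ y
      ya : y ~ a
      a-c : Far a c
      b-x : Far b x
      c-y : Far c y
      x-a : Far x a
      y-b : Far y b

  turn : ∀ {a b c x y} → Pentagon a b c x y → Pentagon b c x y a
  turn P = record { ab = bc ; bc = cx ; cx = xy ; xy = ya ; ya = ab
                  ; a-c = b-x ; b-x = c-y ; c-y = x-a ; x-a = y-b ; y-b = a-c }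
    where open Pentagon P

  flip-pentagon : ∀ {a b c x y} → Pentagon a b c x y → Pentagon y x c b a
  flip-pentagon P = record { ab = ~-sym xy ; bc = ~-sym cx ; cx = ~-sym bc ; xy = ~-sym ab ; ya = ~-sym ya
    ; a-c = far-sym c-y ; b-x = far-sym b-x ; c-y = far-sym a-c ; x-a = far-sym y-b ; y-b = far-sym x-a }
    where open Pentagon P

  pentagon-e : ∀ {a b c x y} → Pentagon a b c x y → 1 ≤ e a c
  pentagon-e P = cross₁ (cross (~-sym ya) (~-sym xy) (~-sym cx) (far-sym c-y) (far-sym x-a))
    (d≢3 a-c ab bc)
    where open Pentagon P

  module _ {t w o b s} (P : Pentagon t w o b s) where
    open Pentagon P

    e-wb = pentagon-e (turn P)
    e-os = pentagon-e (turn (turn P))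
    e-bt = pentagon-e (turn (turn (turn P)))
    e-ot = subst (1 ≤_) (e-sym t o) (pentagon-e P)
    e-ws = subst (1 ≤_) (e-sym s w) (pentagon-e (turn (turn (turn (turn P)))))

    private
      h : V → ℕ
      h z = e w z + e o z + e b z

    -- The walks from `o` over `w`, `t` and from `b` over `s`, `t` to `z` are crosses, and either
    -- gives a unit unless its ends are at distance 3. If both are, the edge `b s` is good for
    -- `(o , z)`, and a route over it would have length 4.
    corner : ∀ {z} → z ~ t → Far w z → Far s z → 1 ≤ h z
    corner {z} z~t w-z s-z with d o z ≟ℕ 3
    ... | no d≢3 = ≤-trans (cross₁ (cross (~-sym bc) (~-sym ab) (~-sym z~t) w-z (far-sym a-c)) d≢3)
      (≤-trans (m≤n+m _ (e w z)) (m≤m+n _ _))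
    ... | yes doz≡3 with d b z ≟ℕ 3
    ... | no d≢3 = ≤-trans (cross₁ (cross xy ya (~-sym z~t) s-z x-a) d≢3) (m≤n+m _ _)
    ... | yes dbz≡3 = ≤-trans (offGeodesics ([] ∷ []) (good xy
          (subst (_< d o s) (sym (~⇒d≡1 cx)) c-y)
          (subst₂ _<_ (sym dzs) (trans (sym dbz≡3) (d-sym b z)) ≤-refl) ∷ [])
          ((λ eq → lin 3 (λ x y z → x :+ (con 1 :+ y) :≡ z ⇒ x :≡ con 1 ⇒ y :≡ con 2 ⇒ z :≡ con 3 ⇒ ⊢ absurdity)
            (d o b) (d s z) (d o z) eq (~⇒d≡1 cx) (trans (d-sym s z) dzs) doz≡3) ∷ []))
        (≤-trans (m≤n+m _ (e w z)) (m≤m+n _ _))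
      where dzs = d≡2 (far-sym s-z) z~t (~-sym ya)

    apex : ∀ {z} → z ~ t → z ~ s → Far w z → Far b z → 2 ≤ h z
    apex {z} z~t z~s w-z b-z = ≤-trans
      (cross₂ (cross (~-sym bc) (~-sym ab) (~-sym z~t) w-z (far-sym a-c)) (cross cx xy (~-sym z~s) b-z c-y)
        (≢ˡ (far⇒≢ b-x)))
      (≤-trans (m≤n+m _ (e w z)) (m≤m+n _ _))

    module _ {S : List V} (t∈ : t ∈ S) (s∈ : s ∈ S) where

      private
        sum-h : total h S ≡ R w S + R o S + R b S
        sum-h = trans (total-+ (λ z → e w z + e o z) (e b) S) (cong (_+ R b S) (total-+ (e w) (e o) S))

        corners : 4 ≤ h t + h s
        corners = lin 6 (λ a b c x y z → con 1 :≤ b ⇒ con 1 :≤ c ⇒ con 1 :≤ x ⇒ con 1 :≤ y ⇒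
            ⊢ con 4 :≤ a :+ b :+ c :+ (x :+ y :+ z))
          (e w t) (e o t) (e b t) (e w s) (e o s) (e b s) e-ot e-bt e-ws e-os

      rows₁ : ∀ {z m} → z ∈ S → z ≢ t → z ≢ s → m ≤ h z → 4 + m ≤ R w S + R o S + R b S
      rows₁ {z} {m} z∈ z≢t z≢s m≤ = ≤-trans
        (lin 4 (λ a b h m → con 4 :≤ a :+ b ⇒ m :≤ h ⇒ ⊢ con 4 :+ m :≤ a :+ (b :+ (h :+ con 0)))
          (h t) (h s) (h z) m corners m≤)
        (≤-trans (total-⊆ h ((~⇒≢ (~-sym ya) ∷ (z≢t ∘ sym) ∷ []) ∷ ((z≢s ∘ sym) ∷ []) ∷ [] ∷ [])
          (All.lookup (t∈ ∷ s∈ ∷ z∈ ∷ [])))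
        (≤-reflexive sum-h))

      rows₂ : ∀ {z z′ m} → z ∈ S → z′ ∈ S → z ≢ t → z ≢ s → z′ ≢ t → z′ ≢ s → z ≢ z′ →
        m ≤ h z + h z′ → 4 + m ≤ R w S + R o S + R b S
      rows₂ {z} {z′} {m} z∈ z′∈ z≢t z≢s z′≢t z′≢s z≢z′ m≤ = ≤-trans
        (lin 5 (λ a b h h′ m → con 4 :≤ a :+ b ⇒ m :≤ h :+ h′ ⇒ ⊢ con 4 :+ m :≤ a :+ (b :+ (h :+ (h′ :+ con 0))))
          (h t) (h s) (h z) (h z′) m corners m≤)
        (≤-trans (total-⊆ h ((~⇒≢ (~-sym ya) ∷ (z≢t ∘ sym) ∷ (z′≢t ∘ sym) ∷ []) ∷
            ((z≢s ∘ sym) ∷ (z′≢s ∘ sym) ∷ []) ∷ (z≢z′ ∷ []) ∷ [] ∷ [])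
          (All.lookup (t∈ ∷ s∈ ∷ z∈ ∷ z′∈ ∷ [])))
        (≤-reflexive sum-h))

  module Around {f : ℕ → V} {k : ℕ} (iso : IsoCycle f (2 + k)) where

    open IsoCycle iso

    L : ℕ
    L = 2 + k

    ≢-f : ∀ i j → i < j → j < L → f i ≢ f j
    ≢-f i j i<j j<L eq = distinct i (j ∸ i) (m<n⇒0<n∸m i<j) (≤-<-trans (m∸n≤m j i) j<L)
      (trans eq (cong f (sym (m+[n∸m]≡n (<⇒≤ i<j)))))

    f-adj : ∀ i → f i ~ f (suc i)
    f-adj = adjacent (s≤s (s≤s z≤n))

    -- A deleted vertex lies on at most one side of `f i` along the cycle, so one can walk to `S`
    -- either down to `f 0` or up to `f (suc k)`.
    cycle-linked : ∀ {S S′} → Linked S → f 0 ∈ S → f (suc k) ∈ S → (∀ {v} → v ∈ S → v ∈ S′) →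
        (∀ i → i < L → f i ∈ S′) →
      (∀ {u} → u ∈ S′ → u ∈ S ⊎ ∃ λ i → i < L × u ≡ f i) → Linked S′
    cycle-linked {S} {S′} linked f₀∈ fₗ∈ S⊆ f∈ cover = extend-linked linked S⊆ link
      where
      down : ∀ r i → i < L → (∀ j → j ≤ i → f j ≢ r) → Chain (λ v → v ∈ S′ × v ≢ r) (f i) (f 0)
      down r zero    i<L free = [ f∈ 0 i<L , free 0 z≤n ]
      down r (suc i) i<L free = (f∈ _ i<L , free _ ≤-refl) ∷⟨ ~-sym (f-adj i) ⟩
        down r i (<⇒≤ i<L) (λ j j≤i → free j (m≤n⇒m≤1+n j≤i))
      up : ∀ r m i → m + i ≡ suc k → (∀ j → i ≤ j → j < L → f j ≢ r) → Chain (λ v → v ∈ S′ × v ≢ r) (f i) (f (suc k))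
      up r zero    i refl free = [ f∈ _ ≤-refl , free _ ≤-refl ≤-refl ]
      up r (suc m) i eq free = (f∈ _ i<L , free _ ≤-refl i<L) ∷⟨ f-adj i ⟩
        up r m (suc i) (trans (+-suc m i) eq) (λ j i<j → free j (<⇒≤ i<j))
        where i<L = lin 3 (λ m i k → con 1 :+ m :+ i :≡ con 1 :+ k ⇒ ⊢ i :< con 2 :+ k) m i k eq
      link : ∀ r {u} → u ∈ S′ → u ≢ r → ∃ λ s → s ∈ S × Chain (λ v → v ∈ S′ × v ≢ r) u s
      link r u∈ u≢r with cover u∈
      ... | inj₁ u∈S = _ , u∈S , [ u∈ , u≢r ]
      ... | inj₂ (i , i<L , refl) with anyUpTo? (λ j → f j Fin.≟ r) i
      ... | no none = _ , f₀∈ , down r i i<L free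
        where
        free : ∀ j → j ≤ i → f j ≢ r
        free j j≤i with m≤n⇒m<n∨m≡n j≤i
        ... | inj₁ j<i  = λ eq → none (j , j<i , eq)
        ... | inj₂ refl = u≢r
      ... | yes (j , j<i , fj≡r) = _ , fₗ∈ , up r (suc k ∸ i) i (m∸n+n≡m (≤-pred i<L))
        λ j′ i≤j′ j′<L eq → ≢-f j j′ (<-≤-trans j<i i≤j′) j′<L (trans fj≡r (sym eq))

    vertexCycle : List V
    vertexCycle = tabulate {n = L} (f ∘ toℕ)

    cycle⁻ : ∀ {u} → u ∈ vertexCycle → ∃ λ (i : Fin L) → u ≡ f (toℕ i)
    cycle⁻ = ∈-tabulate⁻ {f = f ∘ toℕ}

    cycle⁺ : ∀ i → f i ∈ vertexCycle
    cycle⁺ = <-rec (λ i → f i ∈ vertexCycle) go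
      where
      go : ∀ i → (∀ {j} → j < i → f j ∈ vertexCycle) → f i ∈ vertexCycle
      go i rec with i <? L
      ... | yes i<L = subst (_∈ vertexCycle) (cong f (Fin.toℕ-fromℕ< i<L))
          (∈-tabulate⁺ {f = f ∘ toℕ} (Fin.fromℕ< i<L))
      ... | no i≮L = subst (_∈ vertexCycle) (trans (sym (periodic (i ∸ L))) (cong f (m∸n+n≡m (≮⇒≥ i≮L))))
        (rec (∸-monoʳ-< (s≤s z≤n) (≮⇒≥ i≮L)))

    cycle-unique : Unique vertexCycle
    cycle-unique = Unique.tabulate⁺ injective
      where
      injective : ∀ {i j : Fin L} → f (toℕ i) ≡ f (toℕ j) → i ≡ j
      injective {i} {j} eq with <-cmp (toℕ i) (toℕ j)
      ... | tri< i<j _ _ = contradiction eq (≢-f _ _ i<j (Fin.toℕ<n j))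
      ... | tri≈ _ i≡j _ = Fin.toℕ-injective i≡j
      ... | tri> _ _ j<i = contradiction (sym eq) (≢-f _ _ j<i (Fin.toℕ<n i))

  pentagon-of : ∀ {f} → IsoCycle f 5 → Pentagon (f 0) (f 1) (f 2) (f 3) (f 4)
  pentagon-of {f} iso = record
    { ab = f-adj 0 ; bc = f-adj 1 ; cx = f-adj 2 ; xy = f-adj 3 ; ya = subst (f 4 ~_) (periodic 0) (f-adj 4)
    ; a-c = far₂ 4≤5 0 ; b-x = far₂ 4≤5 1 ; c-y = far₂ 4≤5 2
    ; x-a = subst (Far (f 3)) (periodic 0) (far₂ 4≤5 3) ; y-b = subst (Far (f 4)) (periodic 1) (far₂ 4≤5 4) }
    where
    open Around iso
    open IsoCycle iso
    4≤5 : 4 ≤ 5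
    4≤5 = n≤1+n 4

  module Ear {S : List V} (nice : Nice S) (thin : Thin S) (C : MixedCycle S)
    {δ : ℕ} (δ≤4 : δ ≤ 4) (small : δ ≡ 0 ⊎ Diameter₂ S) (rich : δ ≤ 2 ⊎ Rich S) where

    open Nice nice
    open MixedCycle C
    open IsoCycle iso

    open Around iso hiding (L; cycle-linked)

    private
      L : ℕ
      L = 2 + k

      cycle-linked : ∀ {S′} → (∀ {v} → v ∈ S → v ∈ S′) → (∀ i → i < L → f i ∈ S′) →
        (∀ {u} → u ∈ S′ → u ∈ S ⊎ ∃ λ i → i < L × u ≡ f i) → Linked S′
      cycle-linked = Around.cycle-linked iso linked f₀∈ fₗ∈

      f₂∉ : 2 ≤ k → f 2 ∉ S
      f₂∉ 2≤k f₂∈ = ≢-f 0 2 (s≤s z≤n) (s≤s (s≤s (≤-trans (s≤s z≤n) 2≤k)))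
        (thin f₁∉ f₀∈ f₂∈ (~-sym (f-adj 0)) (f-adj 1))

      thin-far : ∀ {w t z} → w ∉ S → t ∈ S → w ~ t → z ∈ S → z ≢ t → Far w z
      thin-far w∉ t∈ w~t z∈ z≢t = far (λ { refl → w∉ z∈ }) (λ w~z → z≢t (thin w∉ z∈ t∈ w~z w~t))

    -- Each new vertex has a row of at least 6, a surplus of 2 over the required 4, and there are at
    -- least two new vertices, `f 1` and `f 2`; hence a surplus of 4. The cycle may meet `S`
    -- repeatedly, so the new vertices are filtered out.
    long-ear : 4 ≤ k → Extension S δ
    long-ear 4≤k = record
      { new = A ; nonempty = ≤-trans (s≤s z≤n) two
      ; nice = nice-⊆ nice (∈-++⁺ʳ A) unique′ (cycle-linked (∈-++⁺ʳ A) (λ i _ → f∈X i) cover)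
      ; gain = lin 5 (λ es m δ t x → 6 :* m :≤ t ⇒ t :+ es :≤ x ⇒ con 2 :≤ m ⇒ δ :≤ con 4 ⇒ ⊢ es :+ 4 :* m :+ δ :≤ x)
          (E S) (length A) δ (total (λ u → R u (A ++ S)) A) (E (A ++ S)) rowsum (E-++ A S) two δ≤4
      }
      where
      A : List V
      A = filter (λ v → ¬? (v ∈? S)) vertexCycle
      A⁻ : ∀ {v} → v ∈ A → v ∈ vertexCycle × v ∉ S
      A⁻ = ∈-filter⁻ (λ v → ¬? (v ∈? S))
      f∈X : ∀ i → f i ∈ A ++ S
      f∈X i with f i ∈? S
      ... | yes fi∈ = ∈-++⁺ʳ A fi∈
      ... | no  fi∉ = ∈-++⁺ˡ (∈-filter⁺ (λ v → ¬? (v ∈? S)) (cycle⁺ i) fi∉)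
      cover : ∀ {u} → u ∈ A ++ S → u ∈ S ⊎ ∃ λ i → i < L × u ≡ f i
      cover u∈ with ∈-++⁻ A u∈
      ... | inj₂ u∈S = inj₁ u∈S
      ... | inj₁ u∈A with i , refl ← cycle⁻ (proj₁ (A⁻ u∈A)) = inj₂ (toℕ i , Fin.toℕ<n i , refl)
      unique′ : Unique (A ++ S)
      unique′ = Unique.++⁺ (Unique.filter⁺ (λ v → ¬? (v ∈? S)) cycle-unique) unique λ (v∈A , v∈S) → proj₂ (A⁻ v∈A) v∈S
      in-A : ∀ i → f i ∉ S → f i ∈ A
      in-A i fi∉ = ∈-filter⁺ (λ v → ¬? (v ∈? S)) (cycle⁺ i) fi∉
      2<L : 2 < L
      2<L = s≤s (s≤s 1≤k)
      two : 2 ≤ length A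
      two = length-⊆ {xs = f 1 ∷ f 2 ∷ []} ((≢-f 1 2 ≤-refl 2<L ∷ []) ∷ [] ∷ [])
        (All.lookup (in-A 1 f₁∉ ∷ in-A 2 (f₂∉ (≤-trans (s≤s (s≤s z≤n)) 4≤k)) ∷ []))
      rowsum : 6 * length A ≤ total (λ u → R u (A ++ S)) A
      rowsum = ≤-trans (≤-reflexive (trans (*-comm 6 (length A)) (sym (total-const 6 A))))
          (total-mono A (All.tabulate row))
        where
        row : ∀ {u} → u ∈ A → 6 ≤ R u (A ++ S)
        row u∈ with i , refl ← cycle⁻ (proj₁ (A⁻ u∈)) = long-row iso (s≤s (s≤s 4≤k)) f∈X (toℕ i)

    private
      ∉-∷ : ∀ {v w} {xs : List V} → v ≢ w → v ∉ xs → v ∉ w ∷ xs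
      ∉-∷ v≢w v∉ (here eq)  = v≢w eq
      ∉-∷ v≢w v∉ (there v∈) = v∉ v∈

    -- Each new vertex has excess 2 with the opposite vertex of the square and 1 with its neighbour
    -- in `S`. Doubling gives 2 (3 + 3) = 8 + 4.
    square-ear : k ≡ 2 → Extension S δ
    square-ear eq = record
      { new = w ∷ x ∷ [] ; nonempty = s≤s z≤n
      ; nice = nice-⊆ nice S⊆
          (unique-∷ (∉-∷ (~⇒≢ w~x) f₁∉) (unique-∷ x∉ unique))
          (cycle-linked S⊆ inside cover)
      ; gain = lin 5 (λ es rw rx ex δ → es :+ 2 :* (rw :+ rx) :≤ ex ⇒ con 3 :≤ rw ⇒ con 3 :≤ rx ⇒ δ :≤ con 4 ⇒
          ⊢ es :+ con 8 :+ δ :≤ ex)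
          (E S) (R w S) (R x S) (E (w ∷ x ∷ S)) δ (E-∷∷ w x S) row-w row-x δ≤4
      }
      where
      t = f 0
      w = f 1
      x = f 2
      s = f 3
      t∈ = f₀∈
      s∈ : s ∈ S
      s∈ = subst (λ k → f (suc k) ∈ S) eq fₗ∈
      x∉ = f₂∉ (≤-reflexive (sym eq))
      t~w = f-adj 0
      w~x = f-adj 1
      x~s = f-adj 2
      f₄≡t : f 4 ≡ t
      f₄≡t = subst (λ k → f (2 + k) ≡ t) eq (periodic 0)
      s~t : s ~ t
      s~t = subst (s ~_) f₄≡t (f-adj 3)
      4≤L : 4 ≤ L
      4≤L = s≤s (s≤s (≤-reflexive (sym eq)))
      w-s = far₂ 4≤L 1
      x-t : Far x t
      x-t = subst (Far x) f₄≡t (far₂ 4≤L 2)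
      edge≢3 : ∀ {u v} → u ~ v → d u v ≢ 3
      edge≢3 u~v eq = contradiction (trans (sym (~⇒d≡1 u~v)) eq) λ ()
      row-w : 3 ≤ R w S
      row-w = ≤-trans (+-mono-≤ (commons₂ w-s (far⇒≢ (far-sym x-t)) (~-sym t~w) (~-sym s~t) w~x x~s)
          (cross₁ (cross w~x x~s s~t x-t w-s) (edge≢3 (~-sym t~w))))
        (R≥₂ s∈ t∈ (~⇒≢ s~t))
      row-x : 3 ≤ R x S
      row-x = ≤-trans (+-mono-≤ (commons₂ x-t (far⇒≢ w-s) (~-sym w~x) (~-sym t~w) x~s s~t)
          (cross₁ (cross (~-sym w~x) (~-sym t~w) (~-sym s~t) w-s x-t) (edge≢3 x~s)))
        (R≥₂ t∈ s∈ (~⇒≢ (~-sym s~t)))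
      S⊆ : ∀ {v} → v ∈ S → v ∈ w ∷ x ∷ S
      S⊆ = there ∘ there
      inside : ∀ i → i < L → f i ∈ w ∷ x ∷ S
      inside 0 _ = S⊆ t∈
      inside 1 _ = here refl
      inside 2 _ = there (here refl)
      inside 3 _ = S⊆ s∈
      inside (suc (suc (suc (suc i)))) i<L = ⊥-elim
        (lin 2 (λ i k → con 4 :+ i :< con 2 :+ k ⇒ k :≡ con 2 ⇒ ⊢ absurdity) i k i<L eq)
      cover : ∀ {u} → u ∈ w ∷ x ∷ S → u ∈ S ⊎ ∃ λ i → i < L × u ≡ f i
      cover (here refl)         = inj₂ (1 , ≤-trans (s≤s (s≤s z≤n)) 4≤L , refl)
      cover (there (here refl)) = inj₂ (2 , ≤-trans (s≤s (s≤s (s≤s z≤n))) 4≤L , refl)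
      cover (there (there u∈))  = inj₁ u∈

    pentagon-ear : k ≡ 3 → Extension S δ
    pentagon-ear eq = go (f 3 ∈? S)
      where
      t = f 0
      w = f 1
      o = f 2
      b = f 3
      s = f 4
      5≤L : 5 ≤ L
      5≤L = s≤s (s≤s (≤-reflexive (sym eq)))
      4≤L = ≤-trans (s≤s (s≤s (s≤s (s≤s z≤n)))) 5≤L
      t∈ = f₀∈
      s∈ : s ∈ S
      s∈ = subst (λ k → f (suc k) ∈ S) eq fₗ∈
      o∉ = f₂∉ (subst (2 ≤_) (sym eq) (s≤s (s≤s z≤n)))
      P = pentagon-of (subst (λ k → IsoCycle f (2 + k)) eq iso)
      open Pentagon P renaming (ab to t~w; bc to w~o; cx to o~b; xy to b~s; ya to s~t;
        a-c to t-o; b-x to w-b; c-y to o-s; x-a to b-t; y-b to s-w)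
      too-far : ∀ {A : Set} i → suc (suc (suc (suc (suc i)))) < L → A
      too-far i i<L = ⊥-elim (lin 2 (λ i k → con 5 :+ i :< con 2 :+ k ⇒ k :≡ con 3 ⇒ ⊢ absurdity) i k i<L eq)

      two-new : b ∈ S → Extension S δ
      two-new b∈ = record
        { new = w ∷ o ∷ [] ; nonempty = s≤s z≤n
        ; nice = nice-⊆ nice S⊆ (unique-∷ (∉-∷ (~⇒≢ w~o) f₁∉) (unique-∷ o∉ unique))
            (cycle-linked S⊆ inside cover)
        ; gain = gain small
        }
        where
        S⊆ : ∀ {v} → v ∈ S → v ∈ w ∷ o ∷ S
        S⊆ = there ∘ there
        inside : ∀ i → i < L → f i ∈ w ∷ o ∷ S
        inside 0 _ = S⊆ t∈
        inside 1 _ = here refl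
        inside 2 _ = there (here refl)
        inside 3 _ = S⊆ b∈
        inside 4 _ = S⊆ s∈
        inside (suc (suc (suc (suc (suc i))))) i<L = too-far i i<L
        cover : ∀ {u} → u ∈ w ∷ o ∷ S → u ∈ S ⊎ ∃ λ i → i < L × u ≡ f i
        cover (here refl)         = inj₂ (1 , ≤-trans (s≤s (s≤s z≤n)) 4≤L , refl)
        cover (there (here refl)) = inj₂ (2 , ≤-trans (s≤s (s≤s (s≤s z≤n))) 4≤L , refl)
        cover (there (there u∈))  = inj₁ u∈
        -- The pentagon alone gives rows of 2, a doubled gain of 8. With diameter two, further
        -- neighbours of `b` and of `t` in `S` add 1 to the rows of `w` and `o` by `cross-shortcut`,
        -- hence 12.
        gain : δ ≡ 0 ⊎ Diameter₂ S → E S + 8 + δ ≤ E (w ∷ o ∷ S)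
        gain (inj₁ δ≡0) = lin 5 (λ es rw rx ex δ → es :+ 2 :* (rw :+ rx) :≤ ex ⇒ con 2 :≤ rw ⇒ con 2 :≤ rx ⇒
            δ :≡ con 0 ⇒
            ⊢ es :+ con 8 :+ δ :≤ ex)
          (E S) (R w S) (R o S) (E (w ∷ o ∷ S)) δ (E-∷∷ w o S)
          (≤-trans (+-mono-≤ (e-wb P) (e-ws P)) (R≥₂ b∈ s∈ (~⇒≢ b~s)))
          (≤-trans (+-mono-≤ (e-ot P) (e-os P)) (R≥₂ t∈ s∈ (~⇒≢ (~-sym s~t)))) δ≡0
        gain (inj₂ diameter)
          with z , z∈ , t~z , z≢s ← neighbour linked t∈ b∈ (far⇒≢ (far-sym b-t)) (~⇒≢ (~-sym s~t)) (~⇒≢ b~s)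
             | z′ , z′∈ , b~z′ , z′≢s ← neighbour linked b∈ t∈ (far⇒≢ b-t) (~⇒≢ b~s) (~⇒≢ (~-sym s~t)) =
          lin 5 (λ es rw rx ex δ → es :+ 2 :* (rw :+ rx) :≤ ex ⇒ con 3 :≤ rw ⇒ con 3 :≤ rx ⇒ δ :≤ con 4 ⇒
            ⊢ es :+ con 8 :+ δ :≤ ex)
          (E S) (R w S) (R o S) (E (w ∷ o ∷ S)) δ (E-∷∷ w o S)
          (≤-trans (+-mono-≤ (+-mono-≤ (e-wb P) (e-ws P)) e-wz′) (R≥₃ b∈ s∈ z′∈ (~⇒≢ b~s) (~⇒≢ b~z′) (z′≢s ∘ sym)))
          (≤-trans (+-mono-≤ (+-mono-≤ (e-ot P) (e-os P)) e-oz)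
              (R≥₃ t∈ s∈ z∈ (~⇒≢ (~-sym s~t)) (~⇒≢ t~z) (z≢s ∘ sym))) δ≤4
          where
          e-oz : 1 ≤ e o z
          e-oz = cross-shortcut (cross (~-sym w~o) (~-sym t~w) t~z
            (thin-far f₁∉ t∈ (~-sym t~w) z∈ (~⇒≢ (~-sym t~z))) (far-sym t-o)) o~b (far⇒≢ (far-sym w-b))
                (diameter b∈ z∈)
          e-wz′ : 1 ≤ e w z′
          e-wz′ = cross-shortcut (cross w~o o~b b~z′
            (thin-far o∉ b∈ o~b z′∈ (~⇒≢ (~-sym b~z′))) w-b) (~-sym t~w) (far⇒≢ t-o) (diameter t∈ z′∈)

      three-new : b ∉ S → Extension S δ
      three-new b∉ = record
        { new = w ∷ o ∷ b ∷ [] ; nonempty = s≤s z≤n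
        ; nice = nice-⊆ nice S⊆
            (unique-∷ (∉-∷ (~⇒≢ w~o) (∉-∷ (far⇒≢ w-b) f₁∉)) (unique-∷ (∉-∷ (~⇒≢ o~b) o∉) (unique-∷ b∉ unique)))
            (cycle-linked S⊆ inside cover)
        ; gain = gain rich
        }
        where
        S⊆ : ∀ {v} → v ∈ S → v ∈ w ∷ o ∷ b ∷ S
        S⊆ = there ∘ there ∘ there
        inside : ∀ i → i < L → f i ∈ w ∷ o ∷ b ∷ S
        inside 0 _ = S⊆ t∈
        inside 1 _ = here refl
        inside 2 _ = there (here refl)
        inside 3 _ = there (there (here refl))
        inside 4 _ = S⊆ s∈
        inside (suc (suc (suc (suc (suc i))))) i<L = too-far i i<L
        cover : ∀ {u} → u ∈ w ∷ o ∷ b ∷ S → u ∈ S ⊎ ∃ λ i → i < L × u ≡ f i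
        cover (here refl)                 = inj₂ (1 , ≤-trans (s≤s (s≤s z≤n)) 4≤L , refl)
        cover (there (here refl))         = inj₂ (2 , ≤-trans (s≤s (s≤s (s≤s z≤n))) 4≤L , refl)
        cover (there (there (here refl))) = inj₂ (3 , 4≤L , refl)
        cover (there (there (there u∈)))  = inj₁ u∈

        h : V → ℕ
        h z = e w z + e o z + e b z
        w-far : ∀ {z} → z ∈ S → z ≢ t → Far w z
        w-far = thin-far f₁∉ t∈ (~-sym t~w)
        b-far : ∀ {z} → z ∈ S → z ≢ s → Far b z
        b-far = thin-far b∉ s∈ b~s
        peak : ∀ {z} → z ∈ S → z ~ t → z ~ s → 2 ≤ h z
        peak z∈ z~t z~s = apex P z~t z~s (w-far z∈ (~⇒≢ z~t)) (b-far z∈ (~⇒≢ z~s))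
        side : ∀ {z} → z ∈ S → z ≢ t → z ≢ s → z ~ t ⊎ z ~ s → 1 ≤ h z
        side {z} z∈ z≢t z≢s near with z ~? t | z ~? s
        ... | yes z~t | yes z~s = ≤-trans (s≤s z≤n) (peak z∈ z~t z~s)
        ... | yes z~t | no z≁s = corner P z~t (w-far z∈ z≢t) (far (z≢s ∘ sym) (z≁s ∘ ~-sym))
        ... | no z≁t | yes z~s = ≤-trans (corner (flip-pentagon P) z~s (b-far z∈ z≢s) (far (z≢t ∘ sym) (z≁t ∘ ~-sym)))
          (≤-reflexive (lin 3 (λ x y z → ⊢ z :+ y :+ x :≡ x :+ y :+ z) (e w z) (e o z) (e b z)))
        ... | no z≁t | no z≁s with near
        ... | inj₁ z~t = contradiction z~t z≁t
        ... | inj₂ z~s = contradiction z~s z≁s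

        -- The vertices `t` and `s` contribute 4 together. A further neighbour of `t` and one of `s`
        -- in `S` contribute 1 each, or 2 at once if they coincide.
        six : 6 ≤ R w S + R o S + R b S
        six with y , y∈ , y≢t , y≢s ← third t s
            with z , z∈ , t~z , z≢s ← neighbour linked t∈ y∈ (y≢t ∘ sym) (~⇒≢ (~-sym s~t)) y≢s
               | z′ , z′∈ , s~z′ , z′≢t ← neighbour linked s∈ y∈ (y≢s ∘ sym) (~⇒≢ s~t) y≢t
            with z Fin.≟ z′
        ... | yes refl = rows₁ P t∈ s∈ z∈ (~⇒≢ (~-sym t~z)) z≢s (peak z∈ (~-sym t~z) (~-sym s~z′))
        ... | no z≢z′ = rows₂ P t∈ s∈ z∈ z′∈ (~⇒≢ (~-sym t~z)) z≢s z′≢t (~⇒≢ (~-sym s~z′)) z≢z′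
          (+-mono-≤ (side z∈ (~⇒≢ (~-sym t~z)) z≢s (inj₁ (~-sym t~z)))
                    (side z′∈ z′≢t (~⇒≢ (~-sym s~z′)) (inj₂ (~-sym s~z′))))

        finish : ∀ m → m ≤ R w S + R o S + R b S → 12 + δ ≤ 2 + 2 * m → E S + 12 + δ ≤ E (w ∷ o ∷ b ∷ S)
        finish m m≤ δ≤ = lin 6 (λ es ewb rs m δ ex → es :+ 2 :* (ewb :+ rs) :≤ ex ⇒ m :≤ rs ⇒
            con 12 :+ δ :≤ con 2 :+ 2 :* m ⇒ con 1 :≤ ewb ⇒
            ⊢ es :+ con 12 :+ δ :≤ ex)
          (E S) (e w b) (R w S + R o S + R b S) m δ (E (w ∷ o ∷ b ∷ S)) (E-∷∷∷ w o b S) m≤ δ≤ (e-wb P)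

        -- The pair `w`, `b` adds 1, so row sum 6 gives 2 (1 + 6) = 12 + 2. A surplus of 4 needs row
        -- sum 7, which a rich set supplies as 4 from `t` and `s`, 2 from the apex and 1 from the
        -- further neighbour.
        gain : δ ≤ 2 ⊎ Rich S → E S + 12 + δ ≤ E (w ∷ o ∷ b ∷ S)
        gain (inj₁ δ≤2) = finish 6 six (+-monoʳ-≤ 12 δ≤2)
        gain (inj₂ rich)
          with z , z′ , (z∈ , z~t , z~s) , (z′∈ , z′≢t , z′≢s , near) , z≢z′ ← rich t∈ s∈ (~-sym s~t) =
          finish 7 (rows₂ P t∈ s∈ z∈ z′∈ (~⇒≢ z~t) (~⇒≢ z~s) z′≢t z′≢s z≢z′
            (+-mono-≤ (peak z∈ z~t z~s) (side z′∈ z′≢t z′≢s near))) (+-monoʳ-≤ 12 δ≤4)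

      go : Dec (b ∈ S) → Extension S δ
      go (yes b∈) = two-new b∈
      go (no b∉)  = three-new b∉

    ear : Extension S δ
    ear = by-length k refl
      where
      by-length : ∀ j → k ≡ j → Extension S δ
      by-length 0 eq = contradiction (subst (1 ≤_) eq 1≤k) λ ()
      by-length 1 eq = contradiction
        (thin f₁∉ f₀∈ (subst (λ k → f (suc k) ∈ S) eq fₗ∈) (~-sym (f-adj 0)) (f-adj 1))
        (≢-f 0 2 (s≤s z≤n) (subst (λ k → 2 < 2 + k) (sym eq) ≤-refl))
      by-length 2 eq = square-ear eq
      by-length 3 eq = pentagon-ear eq
      by-length (suc (suc (suc (suc j)))) eq = long-ear (subst (4 ≤_) (sym eq) (s≤s (s≤s (s≤s (s≤s z≤n)))))

-- Growing a vertex set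

module Growth {n : ℕ} (G : Graph n) (conn : Connected G) (conn₂ : StaysConnected G) where

  open Ears G conn conn₂ public

  totalExcess : ℕ
  totalExcess = total (λ x → total (e x) vertices) vertices

  Goal : Set
  Goal = 4 * n ≤ totalExcess + 8

  leave : ∀ {S k u v} → Walk G k u v → u ∈ S → v ∉ S → ∃₂ λ t w → t ∈ S × w ∉ S × t ~ w
  leave []      u∈ v∉ = contradiction u∈ v∉
  leave {S} (_∷_ {v = x} e p) u∈ v∉ with x ∈? S
  ... | yes x∈ = leave p x∈ v∉
  ... | no  x∉ = _ , x , u∈ , x∉ , e

  Attached : List V → V → Set
  Attached S w = w ∉ S × ∃₂ λ t t′ → (t ∈ S × t′ ∈ S) × t ≢ t′ × (w ~ t × w ~ t′)

  attached? : ∀ S → Dec (∃ (Attached S))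
  attached? S = Fin.any? λ w → ¬? (w ∈? S) ×-dec Fin.any? λ t → Fin.any? λ t′ →
    ((t ∈? S) ×-dec (t′ ∈? S)) ×-dec (¬? (t Fin.≟ t′) ×-dec ((w ~? t) ×-dec (w ~? t′)))

  thin : ∀ {S} → ¬ ∃ (Attached S) → Thin S
  thin none {w} {t} {t′} w∉ t∈ t′∈ w~t w~t′ with t Fin.≟ t′
  ... | yes t≡t′ = t≡t′
  ... | no  t≢t′ = contradiction (w , w∉ , t , t′ , (t∈ , t′∈) , t≢t′ , (w~t , w~t′)) none

  -- Connectivity of `G` gives an edge leaving `S` at some `t`, and 2-connectivity of `S` gives `t`
  -- a neighbour inside: the two edges from which a mixed cycle starts.
  boundary : ∀ {S s x} → Linked S → s ∈ S → x ∈ S → s ≢ x → (∀ p q → ∃ λ r → r ≢ p × r ≢ q) →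
    ∀ {v} → v ∉ S → MixedCycle S
  boundary {S} {s} {x} linked s∈ x∈ s≢x avoid₂ {v} v∉
    with t , w , t∈ , w∉ , t~w ← leave (d-walk s v) s∈ v∉ = second (other (t Fin.≟ s))
    where
    other : Dec (t ≡ s) → ∃ λ y → y ∈ S × t ≢ y
    other (yes refl) = x , x∈ , s≢x
    other (no t≢s)   = s , s∈ , t≢s
    second : (∃ λ y → y ∈ S × t ≢ y) → MixedCycle S
    second (y , y∈ , t≢y) with r , r≢t , r≢y ← avoid₂ t y
      with z , z∈ , t~z , _ ← neighbour linked t∈ y∈ t≢y (r≢t ∘ sym) (r≢y ∘ sym) =
      mixedCycle t∈ z∈ w∉ t~z t~w

  nice-cycle : ∀ {S} → Nice S → ∀ {v} → v ∉ S → MixedCycle S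
  nice-cycle nice {v} v∉
    with s , s∈ , _ ← Nice.third nice v v with x , x∈ , x≢s , _ ← Nice.third nice s s =
    boundary (Nice.linked nice) s∈ x∈ (x≢s ∘ sym) (λ p q → let r , _ , r≢ = Nice.third nice p q in r , r≢) v∉

  outside? : ∀ S → Dec (∃ λ w → w ∉ S)
  outside? S = Fin.any? λ w → ¬? (w ∈? S)

  length≤n : ∀ {S : List V} → Unique S → length S ≤ n
  length≤n {S} u = subst (length S ≤_) (List.length-tabulate id) (length-⊆ u (λ _ → ∈-allFin _))

  covers : ∀ {S : List V} → (∀ v → v ∈ S) → n ≤ length S
  covers {S} all∈ = subst (_≤ length S) (List.length-tabulate id) (length-⊆ (Unique.allFin⁺ n) (λ {v} _ → all∈ v))

  all-inside : ∀ {S} → ¬ (∃ λ w → w ∉ S) → ∀ v → v ∈ S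
  all-inside {S} none v with v ∈? S
  ... | yes v∈ = v∈
  ... | no  v∉ = contradiction (v , v∉) none

  -- The fuel bounds the number of vertices still outside `S`; every step adds at least one.
  grow : ∀ fuel {S} → Nice S → n ≤ fuel + length S → 4 * length S ≤ E S + 8 → Goal
  grow fuel {S} nice enough bound = proceed fuel enough (outside? S)
    where
    attach : ∀ fuel → n ≤ suc fuel + length S → ∃ (Attached S) → Goal
    attach fuel enough (w , w∉ , t , t′ , (t∈ , t′∈) , t≢t′ , (w~t , w~t′)) = grow fuel
      (nice-∷ nice w∉ t∈ t′∈ t≢t′ w~t w~t′) (≤-trans enough (≤-reflexive (sym (+-suc fuel _))))
      (lin 4 (λ l es r es′ → 4 :* l :≤ es :+ con 8 ⇒ es :+ 2 :* r :≤ es′ ⇒ con 2 :≤ r ⇒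
          ⊢ 4 :* (con 1 :+ l) :≤ es′ :+ con 8)
        (length S) (E S) (R w S) (E (w ∷ S)) bound (E-∷ w S) (detour w∉ nice t∈ t′∈ t≢t′ w~t w~t′))

    extend : ∀ fuel → n ≤ suc fuel + length S → Extension S 0 → Goal
    extend fuel enough X = grow fuel nice′
      (subst (λ l → n ≤ fuel + l) (sym (List.length-++ new))
        (lin 4 (λ n f m l → n :≤ con 1 :+ f :+ l ⇒ con 1 :≤ m ⇒
            ⊢ n :≤ f :+ (m :+ l)) n fuel (length new) (length S) enough nonempty))
      (subst (λ l → 4 * l ≤ E (new ++ S) + 8) (sym (List.length-++ new))
        (lin 4 (λ l m es es′ → 4 :* l :≤ es :+ con 8 ⇒ es :+ 4 :* m :+ con 0 :≤ es′ ⇒ ⊢ 4 :* (m :+ l) :≤ es′ :+ con 8)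
          (length S) (length new) (E S) (E (new ++ S)) bound gain))
      where open Extension X renaming (nice to nice′)

    choose : ∀ fuel → n ≤ suc fuel + length S → ∀ {v} → v ∉ S → Dec (∃ (Attached S)) → Goal
    choose fuel enough v∉ (yes a) = attach fuel enough a
    choose fuel enough v∉ (no none) = extend fuel enough
      (Ear.ear nice (thin none) (nice-cycle nice v∉) z≤n (inj₁ refl) (inj₁ z≤n))

    proceed : ∀ fuel → n ≤ fuel + length S → Dec (∃ λ w → w ∉ S) → Goal
    proceed fuel enough (no none) = lin 4 (λ n l es t → n :≤ l ⇒ 4 :* l :≤ es :+ con 8 ⇒ es :≤ t ⇒
        ⊢ 4 :* n :≤ t :+ con 8)
      n (length S) (E S) totalExcess (covers (all-inside none)) bound (E-all (Nice.unique nice))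
    proceed zero enough (yes (w , w∉)) = contradiction
      (≤-trans (length≤n (unique-∷ w∉ (Nice.unique nice))) enough) (<-irrefl refl)
    proceed (suc fuel) enough (yes (v , v∉)) = choose fuel enough v∉ (attached? S)

  grown : ∀ {S} → Nice S → 4 * length S ≤ E S + 8 → Goal
  grown nice = grow n nice (m≤m+n n _)

-- The gap as a sum of excesses

double-pairs : ∀ {n} (f : Fin n → Fin n → ℕ) → (∀ u v → f u v ≡ f v u) → (∀ u → f u u ≡ 0) →
  2 * ∑-pairs f ≡ total (λ u → total (f u) (allFin n)) (allFin n)
double-pairs {n} f f-sym f-diag = trans (cong (2 *_) as-total)
  (trans (lin 2 (λ a b → a :≡ b ⇒ ⊢ 2 :* a :≡ a :+ b) _ _ (total-swap g vs vs))
  (trans (sym (total-+ (λ u → total (g u) vs) (λ u → total (λ v → g v u) vs) vs))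
    (total-cong (λ u → trans (sym (total-+ (g u) (λ v → g v u) vs)) (total-cong (combine u) vs)) vs)))
  where
  vs = allFin n
  g : Fin n → Fin n → ℕ
  g u v = if does (u Fin.<? v) then f u v else 0
  as-total : ∑-pairs f ≡ total (λ u → total (g u) vs) vs
  as-total = trans (sum≡total {n} (λ u → sum (g u))) (total-cong (λ u → sum≡total {n} (g u)) vs)
  combine : ∀ u v → g u v + g v u ≡ f u v
  combine u v with Fin.<-cmp u v
  ... | tri< u<v _ v≮u rewrite dec-true (u Fin.<? v) u<v | dec-false (v Fin.<? u) v≮u = +-identityʳ _
  ... | tri> u≮v _ v<u rewrite dec-false (u Fin.<? v) u≮v | dec-true (v Fin.<? u) v<u = f-sym v u
  ... | tri≈ u≮u refl _ rewrite dec-false (u Fin.<? u) u≮u = sym (f-diag u)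

cardinality : ∀ {n} (b : Fin n → Bool) → ∣ Vec.tabulate b ∣ ≡ sum (λ i → if b i then 1 else 0)
cardinality {zero}  b = refl
cardinality {suc n} b with b zero
... | true  = cong suc (cardinality (b ∘ suc))
... | false = cardinality (b ∘ suc)

module Indices {n : ℕ} (G : Graph n) (conn : Connected G) where

  open Distances G conn

  private
    w⁺ : V → V → V → ℕ
    w⁺ a b x = indicator (dist G x a <? dist G x b)

    closer-total : ∀ a b → ∣ closer G a b ∣ ≡ total (w⁺ a b) vertices
    closer-total a b = trans (cardinality (λ x → does (dist G x a <? dist G x b))) (sum≡total {n} (w⁺ a b))

    term : V → V → ℕ
    term a b = if does (a ~? b) then ∣ closer G a b ∣ * ∣ closer G b a ∣ else 0

    term-sym : ∀ a b → term a b ≡ term b a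
    term-sym a b with a ~? b
    ... | yes a~b rewrite dec-true (b ~? a) (~-sym a~b) = *-comm ∣ closer G a b ∣ _
    ... | no  a≁b rewrite dec-false (b ~? a) (a≁b ∘ ~-sym) = refl

    term-diag : ∀ a → term a a ≡ 0
    term-diag a rewrite dec-false (a ~? a) ~-irrefl = refl

    opaque
      unfolding d

      -- The decision `good?` compares values of `d`, while `closer` compares values of `dist`;
      -- unfolding `d` makes the two agree definitionally, leaving a Boolean identity.
      good-indicator : ∀ a b x y → indicator (good? x y (a , b)) ≡ (if does (a ~? b) then w⁺ a b x * w⁺ b a y else 0)
      good-indicator a b x y = conjunction (does (a ~? b)) (does (dist G x a <? dist G x b))
          (does (dist G y b <? dist G y a))
        where
        conjunction : ∀ p q r → (if p ∧ (q ∧ r) then 1 else 0) ≡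
          (if p then (if q then 1 else 0) * (if r then 1 else 0) else 0)
        conjunction true  true  true  = refl
        conjunction true  true  false = refl
        conjunction true  false _     = refl
        conjunction false _     _     = refl

    term-total : ∀ a b → term a b ≡ total (λ x → total (λ y → indicator (good? x y (a , b))) vertices) vertices
    term-total a b = trans expand (total-cong (λ x →
        total-cong (λ y → sym (good-indicator a b x y)) vertices) vertices)
      where
      expand : term a b ≡ total (λ x → total (λ y → if does (a ~? b) then w⁺ a b x * w⁺ b a y else 0) vertices)
          vertices
      expand with does (a ~? b)
      ... | false = sym (trans (total-cong (λ _ → total-zero vertices) vertices) (total-zero vertices))
      ... | true = trans (cong₂ _*_ (closer-total a b) (closer-total b a))
        (trans (total-*ʳ (w⁺ a b) _ vertices) (total-cong (λ x → total-*ˡ (w⁺ b a) (w⁺ a b x) vertices) vertices))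

  -- Double counting: the product for `a b` counts the pairs `(x , y)` for which the edge is good,
  -- and the exchanges of summation regroup by `x` and `y`.
  double-szeged : 2 * szeged G ≡ total (λ x → total (crossings x) vertices) vertices
  double-szeged = trans (double-pairs term term-sym term-diag)
    (trans (total-cong (λ a → total-cong (term-total a) vertices) vertices)
    (trans (total-cong (λ a → total-swap _ vertices vertices) vertices)
    (trans (total-swap _ vertices vertices)
      (total-cong (λ x → trans (total-cong (λ a → total-swap _ vertices vertices) vertices)
        (total-swap _ vertices vertices)) vertices))))

  double-wiener : 2 * wiener G ≡ total (λ x → total (d x) vertices) vertices
  double-wiener = trans (double-pairs (dist G) (λ u v → subst₂ _≡_ (d≡dist u v) (d≡dist v u) (d-sym u v))
      (λ u → trans (sym (d≡dist u u)) (d-refl u)))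
    (total-cong (λ u → total-cong (λ v → sym (d≡dist u v)) vertices) vertices)

  szeged-wiener : 2 * szeged G ≡ 2 * wiener G + total (λ x → total (e x) vertices) vertices
  szeged-wiener = trans double-szeged (trans
    (total-cong (λ x → trans (total-cong (crossings≡ x) vertices) (total-+ (d x) (e x) vertices)) vertices)
    (trans (total-+ (λ x → total (d x) vertices) (λ x → total (e x) vertices) vertices)
        (cong (_+ total (λ x → total (e x) vertices) vertices) (sym double-wiener))))

  module _ where
    open import Data.Integer.Base using (+_)

    difference-≤ : ∀ a b c m → a + m ≤ c + b → + a ℤ.- + b ℤ.≤ + c ℤ.- + m
    difference-≤ a b c m le = subst₂ ℤ._≤_ (left (+ a) (+ b) (+ m)) (right (+ c) (+ b) (+ m))
      (ℤ.+-monoˡ-≤ (ℤ.- (+ b ℤ.+ + m)) (ℤ.+≤+ le))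
      where
      left : ∀ a b m → a ℤ.+ m ℤ.+ ℤ.- (b ℤ.+ m) ≡ a ℤ.- b
      left = ℤ-solve-∀
      right : ∀ c b m → c ℤ.+ b ℤ.+ ℤ.- (b ℤ.+ m) ≡ c ℤ.- m
      right = ℤ-solve-∀

    gap-bound : 4 * n ≤ total (λ x → total (e x) vertices) vertices + 8 → + (2 * n) ℤ.- + 4 ℤ.≤ η G
    gap-bound bound = difference-≤ (2 * n) 4 (szeged G) (wiener G)
      (lin 4 (λ n s w t → 4 :* n :≤ t :+ con 8 ⇒ 2 :* s :≡ 2 :* w :+ t ⇒ ⊢ 2 :* n :+ w :≤ s :+ con 4)
        n (szeged G) (wiener G) _ bound szeged-wiener)

-- Recognising the exceptional graphs

lookup-injective : ∀ {A : Set} {xs : List A} → Unique xs → ∀ {i j} → List.lookup xs i ≡ List.lookup xs j → i ≡ j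
lookup-injective {xs = x ∷ xs} (x∉ ∷ u) {zero}  {zero}  eq = refl
lookup-injective {xs = x ∷ xs} (x∉ ∷ u) {zero}  {suc j} eq = contradiction eq (All.lookup x∉ (∈-lookup j))
lookup-injective {xs = x ∷ xs} (x∉ ∷ u) {suc i} {zero}  eq = contradiction (sym eq) (All.lookup x∉ (∈-lookup i))
lookup-injective {xs = x ∷ xs} (x∉ ∷ u) {suc i} {suc j} eq = cong suc (lookup-injective u eq)

lookup-++ˡ : ∀ {A : Set} (xs ys : List A) i → toℕ i < length xs → List.lookup (xs ++ ys) i ∈ xs
lookup-++ˡ (x ∷ xs) ys zero    _       = here refl
lookup-++ˡ (x ∷ xs) ys (suc i) (s≤s p) = there (lookup-++ˡ xs ys i p)

lookup-++ʳ : ∀ {A : Set} (xs ys : List A) i → ¬ toℕ i < length xs → List.lookup (xs ++ ys) i ∈ ys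
lookup-++ʳ []       ys i       p = ∈-lookup i
lookup-++ʳ (x ∷ xs) ys zero    p = contradiction (s≤s z≤n) p
lookup-++ʳ (x ∷ xs) ys (suc i) p = lookup-++ʳ xs ys i (p ∘ s≤s)

firstVertices⇔ : ∀ {n t} {i : Fin n} → i Subset.∈ firstVertices t ⇔ toℕ i < t
firstVertices⇔ {t = t} {i} = mk⇔
  (λ i∈ → to (toℕ i <? t) (trans (sym (Vec.lookup∘tabulate _ i)) (Vec.[]=⇒lookup i∈)))
  (λ i<t → Vec.lookup⇒[]= i _ (trans (Vec.lookup∘tabulate _ i) (dec-true (toℕ i <? t) i<t)))
  where
  to : ∀ {P : Set} (P? : Dec P) → does P? ≡ true → P
  to (yes p) _ = p

module _ {m : ℕ} (G : Graph (suc m)) {x : Fin (suc m)} {N Y : List (Fin (suc m))} where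

  open Graph G

  private
    zs = N ++ Y

  -- The clique is listed with the neighbours `N` of `x` first, because the added vertex of `K` is
  -- joined to an initial segment of the indices.
  isomorphic-K : length zs ≡ m → Unique zs → (∀ v → v ≢ x → v ∈ zs) → x ∉ zs →
    All (x ~_) N → All (λ y → ¬ x ~ y) Y → (∀ {u v} → u ∈ zs → v ∈ zs → u ≢ v → u ~ v) → G ≅ K (suc m) (length N)
  isomorphic-K len unique cover x∉ N~ Y≁ clique = permutation to vertex to-vertex vertex-to ,
    λ u v → subst₂ (λ u′ v′ → u′ ~ v′ ⇔ Graph._~_ (K (suc m) (length N)) (to u) (to v)) (vertex-to u) (vertex-to v)
      (adjacency (to u) (to v))
    where
    vertex : Fin (suc m) → Fin (suc m)
    vertex zero    = x
    vertex (suc i) = List.lookup zs (Fin.cast (sym len) i)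

    vertex-injective : ∀ {i j} → vertex i ≡ vertex j → i ≡ j
    vertex-injective {zero}  {zero}  eq = refl
    vertex-injective {zero}  {suc j} eq = contradiction (subst (_∈ zs) (sym eq) (∈-lookup {xs = zs} _)) x∉
    vertex-injective {suc i} {zero}  eq = contradiction (subst (_∈ zs) eq (∈-lookup {xs = zs} _)) x∉
    vertex-injective {suc i} {suc j} eq = cong suc (Fin.toℕ-injective (trans (sym (Fin.toℕ-cast (sym len) i))
      (trans (cong toℕ (lookup-injective unique eq)) (Fin.toℕ-cast (sym len) j))))

    position-of : ∀ v → ∃ λ i → vertex i ≡ v
    position-of v with v Fin.≟ x
    ... | yes refl = zero , refl
    ... | no v≢x = suc (Fin.cast len (Any.index v∈)) , trans
      (cong (List.lookup zs) (Fin.toℕ-injective (trans (Fin.toℕ-cast (sym len) _) (Fin.toℕ-cast len _))))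
      (sym (Any.lookup-index v∈))
      where v∈ = cover v v≢x

    to : Fin (suc m) → Fin (suc m)
    to v = proj₁ (position-of v)

    vertex-to : ∀ v → vertex (to v) ≡ v
    vertex-to v = proj₂ (position-of v)

    to-vertex : ∀ i → to (vertex i) ≡ i
    to-vertex i = vertex-injective (vertex-to (vertex i))

    x-adjacency : ∀ i → x ~ vertex (suc i) ⇔ toℕ i < length N
    x-adjacency i = mk⇔ forth back
      where
      i′ = Fin.cast (sym len) i
      i′≡ = Fin.toℕ-cast (sym len) i
      forth : x ~ vertex (suc i) → toℕ i < length N
      forth x~ with toℕ i′ <? length N
      ... | yes p = subst (_< length N) i′≡ p
      ... | no ¬p = contradiction x~ (All.lookup Y≁ (lookup-++ʳ N Y i′ ¬p))
      back : toℕ i < length N → x ~ vertex (suc i)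
      back p = All.lookup N~ (lookup-++ˡ N Y i′ (subst (_< length N) (sym i′≡) p))

    adjacency : ∀ i j → vertex i ~ vertex j ⇔ Graph._~_ (K (suc m) (length N)) i j
    adjacency zero    zero    = mk⇔ ~-irrefl ⊥-elim
    adjacency zero    (suc j) = mk⇔ (from⁻ firstVertices⇔ ∘ to⁺ (x-adjacency j))
        (from⁻ (x-adjacency j) ∘ to⁺ firstVertices⇔)
      where
      to⁺ = Equivalence.to
      from⁻ = Equivalence.from
    adjacency (suc i) zero    = mk⇔ (from⁻ firstVertices⇔ ∘ to⁺ (x-adjacency i) ∘ ~-sym)
      (~-sym ∘ from⁻ (x-adjacency i) ∘ to⁺ firstVertices⇔)
      where
      to⁺ = Equivalence.to
      from⁻ = Equivalence.from
    adjacency (suc i) (suc j) = mk⇔ (λ { e refl → ~-irrefl e })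
      (λ i≢j → clique (∈-lookup _) (∈-lookup _) (i≢j ∘ suc-injective′ ∘ vertex-injective))
      where
      suc-injective′ : ∀ {k} {i j : Fin k} → Fin.suc i ≡ suc j → i ≡ j
      suc-injective′ refl = refl

isomorphic-complete : ∀ {n} (G : Graph n) → (∀ {u v} → u ≢ v → Graph._~_ G u v) → G ≅ complete n
isomorphic-complete G adj = Permutation.id , λ u v → mk⇔ (λ { e refl → Graph.~-irrefl G e }) adj

-- Seeds

module Seeds {n : ℕ} (G : Graph n) (conn : Connected G) (conn₂ : StaysConnected G) where

  open Growth G conn conn₂ public

  fresh : ∀ {xs : List V} ps → Unique xs → length ps < length xs → ∃ λ z → z ∈ xs × z ∉ ps
  fresh {xs} ps u lt with Fin.any? (λ z → (z ∈? xs) ×-dec ¬? (z ∈? ps))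
  ... | yes found = found
  ... | no none = contradiction (length-⊆ u inside) (<⇒≱ lt)
    where
    inside : ∀ {z} → z ∈ xs → z ∈ ps
    inside {z} z∈ with z ∈? ps
    ... | yes z∈ps = z∈ps
    ... | no z∉ps = contradiction (z , z∈ , z∉ps) none

  fresh₂ : ∀ {xs : List V} → Unique xs → 3 ≤ length xs → ∀ p q → ∃ λ z → z ∈ xs × z ≢ p × z ≢ q
  fresh₂ u lt p q with z , z∈ , z∉ ← fresh (p ∷ q ∷ []) u lt =
    z , z∈ , (λ { refl → z∉ (here refl) }) , (λ { refl → z∉ (there (here refl)) })

  fresh₃ : ∀ {xs : List V} → Unique xs → 4 ≤ length xs → ∀ p q r → ∃ λ z → z ∈ xs × z ≢ p × z ≢ q × z ≢ r
  fresh₃ u lt p q r with z , z∈ , z∉ ← fresh (p ∷ q ∷ r ∷ []) u lt =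
    z , z∈ , (λ { refl → z∉ (here refl) }) , (λ { refl → z∉ (there (here refl)) }) ,
        (λ { refl → z∉ (there (there (here refl))) })

  Clique : List V → Set
  Clique M = ∀ {u v} → u ∈ M → v ∈ M → u ≢ v → u ~ v

  Maximal : List V → Set
  Maximal M = ∀ {w} → w ∉ M → ∃ λ s → s ∈ M × ¬ w ~ s

  clique-linked : ∀ {M} → Clique M → Linked M
  clique-linked clique r {p} {q} p∈ q∈ p≢r q≢r with p Fin.≟ q
  ... | yes refl = [ p∈ , p≢r ]
  ... | no p≢q  = (p∈ , p≢r) ∷⟨ clique p∈ q∈ p≢q ⟩ [ q∈ , q≢r ]

  clique-∷ : ∀ {w M} → Clique M → All (w ~_) M → Clique (w ∷ M)
  clique-∷ clique adj (here refl) (here refl) u≢v = contradiction refl u≢v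
  clique-∷ clique adj (here refl) (there v∈)  u≢v = All.lookup adj v∈
  clique-∷ clique adj (there u∈)  (here refl) u≢v = ~-sym (All.lookup adj u∈)
  clique-∷ clique adj (there u∈)  (there v∈)  u≢v = clique u∈ v∈ u≢v

  record MaximalClique (M₀ : List V) : Set where
    field
      M       : List V
      ⊇       : ∀ {v} → v ∈ M₀ → v ∈ M
      uniqueM : Unique M
      clique  : Clique M
      maximal : Maximal M

  maximise : ∀ {M} → Unique M → Clique M → MaximalClique M
  maximise = go n (m≤m+n n _)
    where
    go : ∀ fuel {M} → n ≤ fuel + length M → Unique M → Clique M → MaximalClique M
    go fuel {M} enough u clique with Fin.any? (λ w → ¬? (w ∈? M) ×-dec All.all? (w ~?_) M)
    ... | no none = record { M = M ; ⊇ = id ; uniqueM = u ; clique = clique ; maximal = maximal }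
      where
      maximal : Maximal M
      maximal {w} w∉ with All.all? (w ~?_) M
      ... | yes adj = contradiction (w , w∉ , adj) none
      ... | no ¬adj = find (All.¬All⇒Any¬ (w ~?_) M ¬adj)
    go zero {M} enough u clique | yes (w , w∉ , adj) = contradiction
      (≤-trans (length≤n (unique-∷ w∉ u)) enough) (<-irrefl refl)
    go (suc fuel) {M} enough u clique | yes (w , w∉ , adj) = drop-w
      (go fuel (≤-trans enough (≤-reflexive (sym (+-suc fuel _)))) (unique-∷ w∉ u) (clique-∷ clique adj))
      where
      drop-w : MaximalClique (w ∷ M) → MaximalClique M
      drop-w C = record { MaximalClique C ; ⊇ = MaximalClique.⊇ C ∘ there }

  record Attachment (S : List V) (w : V) : Set where
    field
      w∉      : w ∉ S
      {t t′}  : V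
      t∈      : t ∈ S
      t′∈     : t′ ∈ S
      t≢t′    : t ≢ t′
      w~t     : w ~ t
      w~t′    : w ~ t′

  not-single : ∀ {S w p} → Attachment S w → ¬ (∀ {u} → u ∈ S → ¬ w ~ u ⊎ u ≡ p)
  not-single {S} {w} {p} a only = t≢t′ (trans (only-p t∈ w~t) (sym (only-p t′∈ w~t′)))
    where
    open Attachment a
    only-p : ∀ {u} → u ∈ S → w ~ u → u ≡ p
    only-p u∈ w~u with only u∈
    ... | inj₁ w≁u = contradiction w~u w≁u
    ... | inj₂ eq  = eq

  nice-attach : ∀ {S w} → Nice S → Attachment S w → Nice (w ∷ S)
  nice-attach nice a = nice-∷ nice w∉ t∈ t′∈ t≢t′ w~t w~t′
    where open Attachment a

  -- One step from a set of doubled deficit `δ`. An ear recovers the deficit by itself; an attached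
  -- vertex is guaranteed only the gain of `detour`, so that case is left to the caller, who knows
  -- the shape of `S`.
  advance : ∀ δ {S} → Nice S → 4 * length S ≤ E S + (8 + δ) → (∃ λ w → w ∉ S) →
    (∀ {w} → Attachment S w → Goal) → δ ≤ 4 → δ ≡ 0 ⊎ Diameter₂ S → δ ≤ 2 ⊎ Rich S → Goal
  advance δ {S} nice bound (v , v∉) attach δ≤4 small rich = go (attached? S)
    where
    extend : Extension S δ → Goal
    extend X = grown nice′ (subst (λ l → 4 * l ≤ E (new ++ S) + 8) (sym (List.length-++ new))
        (lin 5 (λ l m es es′ δ → 4 :* l :≤ es :+ (con 8 :+ δ) ⇒ es :+ 4 :* m :+ δ :≤ es′ ⇒
            ⊢ 4 :* (m :+ l) :≤ es′ :+ con 8)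
          (length S) (length new) (E S) (E (new ++ S)) δ bound gain))
      where open Extension X renaming (nice to nice′)
    go : Dec (∃ (Attached S)) → Goal
    go (yes (w , w∉ , t , t′ , (t∈ , t′∈) , t≢t′ , (w~t , w~t′))) = attach record
      { w∉ = w∉ ; t∈ = t∈ ; t′∈ = t′∈ ; t≢t′ = t≢t′ ; w~t = w~t ; w~t′ = w~t′ }
    go (no none) = extend (Ear.ear nice (thin none) (nice-cycle nice v∉) δ≤4 small rich)

  attach-gain : ∀ δ {S w} → Nice S → 4 * length S ≤ E S + (8 + δ) → Attachment S w → 4 + δ ≤ 2 * R w S → Goal
  attach-gain δ {S} {w} nice bound a gain = grown (nice-attach nice a)
    (lin 5 (λ l es r es′ δ → 4 :* l :≤ es :+ (con 8 :+ δ) ⇒ es :+ 2 :* r :≤ es′ ⇒ con 4 :+ δ :≤ 2 :* r ⇒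
        ⊢ 4 :* (con 1 :+ l) :≤ es′ :+ con 8)
      (length S) (E S) (R w S) (E (w ∷ S)) δ bound (E-∷ w S) gain)

  two+two : ∀ {w y z S} → y ∈ S → z ∈ S → y ≢ z → 2 ≤ e w y → 2 ≤ e w z → 4 ≤ R w S
  two+two y∈ z∈ y≢z p q = ≤-trans (+-mono-≤ p q) (R≥₂ y∈ z∈ y≢z)

  two+one : ∀ {w y z S} → y ∈ S → z ∈ S → y ≢ z → 2 ≤ e w y → 1 ≤ e w z → 3 ≤ R w S
  two+one y∈ z∈ y≢z p q = ≤-trans (+-mono-≤ p q) (R≥₂ y∈ z∈ y≢z)

  module Seed {M : List V} (uniqueM : Unique M) (clique : Clique M) (maximal : Maximal M)
    {x c₁ c₂ y : V} (c₁∈ : c₁ ∈ M) (c₂∈ : c₂ ∈ M) (y∈ : y ∈ M) (c₁≢c₂ : c₁ ≢ c₂)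
    (x~c₁ : x ~ c₁) (x~c₂ : x ~ c₂) (x-y : Far x y) where

    S : List V
    S = x ∷ M

    x∉ : x ∉ M
    x∉ x∈ = far⇒≁ x-y (clique x∈ y∈ (far⇒≢ x-y))

    unique : Unique S
    unique = unique-∷ x∉ uniqueM

    x≢ : ∀ {v} → v ∈ M → x ≢ v
    x≢ v∈ refl = x∉ v∈

    c₁≢y : c₁ ≢ y
    c₁≢y refl = far⇒≁ x-y x~c₁
    c₂≢y : c₂ ≢ y
    c₂≢y refl = far⇒≁ x-y x~c₂

    3≤M : 3 ≤ length M
    3≤M = length-⊆ {xs = c₁ ∷ c₂ ∷ y ∷ []} ((c₁≢c₂ ∷ c₁≢y ∷ []) ∷ (c₂≢y ∷ []) ∷ [] ∷ [])
      (All.lookup (c₁∈ ∷ c₂∈ ∷ y∈ ∷ []))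

    nice : Nice S
    nice = record
      { unique = unique
      ; linked = linked-∷ (clique-linked clique) c₁∈ c₂∈ c₁≢c₂ x~c₁ x~c₂
      ; undominated = λ w∉ → let s , s∈ , w≁s = maximal (w∉ ∘ there) in s , there s∈ , w≁s
      ; third = λ p q → let z , z∈ , rest = fresh₂ uniqueM 3≤M p q in z , there z∈ , rest
      }

    diameter : Diameter₂ S
    diameter (here refl) (here refl) = ≤-trans (≤-reflexive (d-refl x)) z≤n
    diameter (here refl) (there v∈) = from-x v∈
      where
      from-x : ∀ {v} → v ∈ M → d x v ≤ 2
      from-x {v} v∈ with c₁ Fin.≟ v
      ... | yes refl = ≤-trans (≤-reflexive (~⇒d≡1 x~c₁)) (s≤s z≤n)
      ... | no c₁≢v = d-minimal (x~c₁ ∷ clique c₁∈ v∈ c₁≢v ∷ [])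
    diameter {u} (there u∈) (here refl) = ≤-trans (≤-reflexive (d-sym u x)) (diameter (here refl) (there u∈))
    diameter {u} {v} (there u∈) (there v∈) with u Fin.≟ v
    ... | yes refl = ≤-trans (≤-reflexive (d-refl u)) z≤n
    ... | no u≢v = ≤-trans (≤-reflexive (~⇒d≡1 (clique u∈ v∈ u≢v))) (s≤s z≤n)

    other-neighbour : ∀ b → ∃ λ c → c ∈ M × x ~ c × c ≢ b
    other-neighbour b with c₁ Fin.≟ b
    ... | yes refl = c₂ , c₂∈ , x~c₂ , c₁≢c₂ ∘ sym
    ... | no c₁≢b  = c₁ , c₁∈ , x~c₁ , c₁≢b

    beside-x : ∀ {p q} → p ∈ M → q ∈ M → p ~ q → x ~ p ⊎ x ~ q → ∃ λ z → ∃ λ z′ →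
      (z ∈ S × z ~ p × z ~ q) × (z′ ∈ S × z′ ≢ p × z′ ≢ q × (z′ ~ p ⊎ z′ ~ q)) × z ≢ z′
    beside-x {p} {q} p∈ q∈ p~q near with z , z∈ , z≢p , z≢q ← fresh₂ uniqueM 3≤M p q =
      z , x , (there z∈ , clique z∈ p∈ z≢p , clique z∈ q∈ z≢q) , (here refl , x≢ p∈ , x≢ q∈ , near) , (x≢ z∈ ∘ sym)

    -- For an edge at `x` the apex is another neighbour of `x` in the clique and the further vertex
    -- is `y`. An edge inside the clique either misses `c₁` and `c₂`, which then serve, or contains
    -- a neighbour of `x`, and then `x` is the further vertex.
    rich : Rich S
    rich (here refl) (here refl) p~q = contradiction refl (~⇒≢ p~q)
    rich {q = q} (here refl) (there q∈) x~q with c , c∈ , x~c , c≢q ← other-neighbour q =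
      c , y , (there c∈ , ~-sym x~c , clique c∈ q∈ c≢q) ,
      (there y∈ , (λ { refl → x∉ y∈ }) , y≢q , inj₂ (clique y∈ q∈ y≢q)) , (λ { refl → far⇒≁ x-y x~c })
      where
      y≢q : y ≢ q
      y≢q refl = far⇒≁ x-y x~q
    rich {p} (there p∈) (here refl) p~x with c , c∈ , x~c , c≢p ← other-neighbour p =
      c , y , (there c∈ , clique c∈ p∈ c≢p , ~-sym x~c) ,
      (there y∈ , y≢p , (λ { refl → x∉ y∈ }) , inj₁ (clique y∈ p∈ y≢p)) , (λ { refl → far⇒≁ x-y x~c })
      where
      y≢p : y ≢ p
      y≢p refl = far⇒≁ x-y (~-sym p~x)
    rich {p} {q} (there p∈) (there q∈) p~q with c₁ Fin.≟ p | c₁ Fin.≟ q | c₂ Fin.≟ p | c₂ Fin.≟ q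
    ... | no c₁≢p | no c₁≢q | no c₂≢p | no c₂≢q = c₁ , c₂ , (there c₁∈ , clique c₁∈ p∈ c₁≢p , clique c₁∈ q∈ c₁≢q) ,
      (there c₂∈ , c₂≢p , c₂≢q , inj₁ (clique c₂∈ p∈ c₂≢p)) , c₁≢c₂
    ... | yes refl | _ | _ | _ = beside-x p∈ q∈ p~q (inj₁ x~c₁)
    ... | no _ | yes refl | _ | _ = beside-x p∈ q∈ p~q (inj₂ x~c₁)
    ... | no _ | no _ | yes refl | _ = beside-x p∈ q∈ p~q (inj₁ x~c₂)
    ... | no _ | no _ | no _ | yes refl = beside-x p∈ q∈ p~q (inj₂ x~c₂)

    N Y : List V
    N = filter (x ~?_) M
    Y = filter (λ v → ¬? (x ~? v)) M

    N∈ : ∀ {v} → v ∈ N → v ∈ M × x ~ v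
    N∈ = ∈-filter⁻ (x ~?_)

    Y∈ : ∀ {v} → v ∈ Y → v ∈ M × ¬ x ~ v
    Y∈ = ∈-filter⁻ (λ v → ¬? (x ~? v))

    uniqueN : Unique N
    uniqueN = Unique.filter⁺ (x ~?_) uniqueM

    uniqueY : Unique Y
    uniqueY = Unique.filter⁺ (λ v → ¬? (x ~? v)) uniqueM

    uniqueNY : Unique (N ++ Y)
    uniqueNY = Unique.++⁺ uniqueN uniqueY λ (v∈N , v∈Y) → proj₂ (Y∈ v∈Y) (proj₂ (N∈ v∈N))

    M⊆NY : ∀ {v} → v ∈ M → v ∈ N ++ Y
    M⊆NY {v} v∈ with x ~? v
    ... | yes x~v = ∈-++⁺ˡ (∈-filter⁺ (x ~?_) v∈ x~v)
    ... | no x≁v  = ∈-++⁺ʳ N (∈-filter⁺ (λ v → ¬? (x ~? v)) v∈ x≁v)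

    NY⊆M : ∀ {v} → v ∈ N ++ Y → v ∈ M
    NY⊆M v∈ with ∈-++⁻ N v∈
    ... | inj₁ v∈N = proj₁ (N∈ v∈N)
    ... | inj₂ v∈Y = proj₁ (Y∈ v∈Y)

    lengthNY : length N + length Y ≡ length M
    lengthNY = trans (sym (List.length-++ N))
      (≤-antisym (length-⊆ uniqueNY NY⊆M) (length-⊆ uniqueM M⊆NY))

    -- Since `M` is a clique, each vertex of `Y` has all of `N` as common neighbours with `x`, hence
    -- excess at least 2 |N| - 2.
    row : length Y * (2 * length N) ≤ R x M + 2 * length Y
    row = ≤-trans (≤-trans (≤-reflexive (sym (total-const (2 * length N) Y))) (total-mono Y (All.tabulate each)))
      (≤-trans (≤-reflexive (trans (total-+ (e x) (λ _ → 2) Y)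
          (cong (total (e x) Y +_) (trans (total-const 2 Y) (*-comm (length Y) 2)))))
        (+-monoˡ-≤ (2 * length Y) (total-⊆ (e x) uniqueY (proj₁ ∘ Y∈))))
      where
      each : ∀ {y} → y ∈ Y → 2 * length N ≤ e x y + 2
      each {y} y∈ = commons (far (λ { refl → x∉ (proj₁ (Y∈ y∈)) }) (proj₂ (Y∈ y∈))) uniqueN
        (All.tabulate λ c∈ → proj₂ (N∈ c∈) , clique (proj₁ (N∈ c∈)) (proj₁ (Y∈ y∈))
          (λ { refl → proj₂ (Y∈ y∈) (proj₂ (N∈ c∈)) }))

    -- R x M ≥ 2 (|N| - 1) |Y| = 2 (|M| - 2) + 2 i j.
    seed-bound : ∀ i j → length N ≡ 2 + i → length Y ≡ 1 + j → 4 * length S + 4 * (j * i) ≤ E S + 12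
    seed-bound i j N≡ Y≡ = lin 6
      (λ i j ij r es l → 2 :* i :+ 2 :* (2 :* j) :+ 2 :* ij :+ con 4 :≤ r :+ con 2 :+ 2 :* j ⇒ 2 :* r :≤ es ⇒
          l :≡ con 4 :+ i :+ j ⇒
        ⊢ 4 :* l :+ 4 :* ij :≤ es :+ con 12)
      i j (j * i) (R x M) (E S) (length S)
      (≤-trans (≤-reflexive (expand i j)) (≤-trans (subst₂ (λ a b → b * (2 * a) ≤ R x M + 2 * b) N≡ Y≡ row)
        (≤-reflexive (lin 2 (λ r j → ⊢ r :+ 2 :* (con 1 :+ j) :≡ r :+ con 2 :+ 2 :* j) (R x M) j))))
      (≤-trans (m≤n+m _ (E M)) (E-∷ x M))
      (cong suc (trans (sym lengthNY) (trans (cong₂ _+_ N≡ Y≡)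
          (lin 2 (λ i j → ⊢ con 2 :+ i :+ (con 1 :+ j) :≡ con 3 :+ i :+ j) i j))))
      where
      expand : ∀ i j → 2 * i + 2 * (2 * j) + 2 * (j * i) + 4 ≡ (1 + j) * (2 * (2 + i))
      expand = ℕ-solve-∀

    2≤N : 2 ≤ length N
    2≤N = length-⊆ {xs = c₁ ∷ c₂ ∷ []} ((c₁≢c₂ ∷ []) ∷ [] ∷ [])
      (All.lookup (∈-filter⁺ (x ~?_) c₁∈ x~c₁ ∷ ∈-filter⁺ (x ~?_) c₂∈ x~c₂ ∷ []))

    1≤Y : 1 ≤ length Y
    1≤Y = length-⊆ {xs = y ∷ []} ([] ∷ []) (All.lookup (∈-filter⁺ (λ v → ¬? (x ~? v)) y∈ (far⇒≁ x-y) ∷ []))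

    sizes : ∃₂ λ i j → length N ≡ 2 + i × length Y ≡ 1 + j
    sizes = length N ∸ 2 , length Y ∸ 1 , sym (m+[n∸m]≡n 2≤N) , sym (m+[n∸m]≡n 1≤Y)

    weak-bound : 4 * length S ≤ E S + (8 + 4)
    weak-bound with i , j , N≡ , Y≡ ← sizes = ≤-trans (m≤m+n _ _) (seed-bound i j N≡ Y≡)

-- Starting sets from kites and diamonds

module Dense {m : ℕ} (G : Graph (suc m)) (conn : Connected G) (conn₂ : StaysConnected G)
  (6≤n : 6 ≤ suc m) (unexceptional : Unexceptional G) where

  open Seeds G conn conn₂ public

  ≁-far : ∀ {S w v} → w ∉ S → v ∈ S → ¬ w ~ v → Far w v
  ≁-far w∉ v∈ = far (λ { refl → w∉ v∈ })

  some-outside : ∀ {S : List V} → length S < suc m → ∃ λ w → w ∉ S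
  some-outside {S} lt with outside? S
  ... | yes found = found
  ... | no none = contradiction (covers (all-inside none)) (<⇒≱ lt)

  module FromSeed {M : List V} (uniqueM : Unique M) (clique : Clique M) (maximal : Maximal M)
    {x c₁ c₂ y : V} (c₁∈ : c₁ ∈ M) (c₂∈ : c₂ ∈ M) (y∈ : y ∈ M) (c₁≢c₂ : c₁ ≢ c₂)
    (x~c₁ : x ~ c₁) (x~c₂ : x ~ c₂) (x-y : Far x y) where

    open Seed uniqueM clique maximal c₁∈ c₂∈ y∈ c₁≢c₂ x~c₁ x~c₂ x-y public

    -- The term 4 i j of `seed-bound` covers the missing 4 unless i = 0 or j = 0. Then `x` has
    -- exactly two neighbours or exactly one non-neighbour in the clique, and `G` is exceptional.
    spanning : (∀ v → v ∈ S) → Goal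
    spanning all∈ = go sizes
      where
      M≡m : length M ≡ m
      M≡m = suc-injective (≤-antisym (length≤n unique) (covers all∈))
      G≅K : G ≅ K (suc m) (length N)
      G≅K = isomorphic-K G {N = N} {Y} (trans (List.length-++ N) (trans lengthNY M≡m)) uniqueNY
        (λ v v≢x → M⊆NY (others v≢x (all∈ v))) (x∉ ∘ NY⊆M)
        (All.tabulate (proj₂ ∘ N∈)) (All.tabulate (proj₂ ∘ Y∈))
        (λ u∈ v∈ → clique (NY⊆M u∈) (NY⊆M v∈))
        where
        others : ∀ {v} → v ≢ x → v ∈ S → v ∈ M
        others v≢x (here eq)  = contradiction eq v≢x
        others v≢x (there v∈) = v∈
      go : ∃₂ (λ i j → length N ≡ 2 + i × length Y ≡ 1 + j) → Goal
      go (zero , j , N≡ , Y≡) = contradiction (inj₂ (inj₁ (subst (λ t → G ≅ K (suc m) t) N≡ G≅K))) unexceptional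
      go (suc i , zero , N≡ , Y≡) = contradiction (inj₂ (inj₂ (subst (λ t → G ≅ K (suc m) t) N≡n∸2 G≅K)))
          unexceptional
        where
        N≡n∸2 : length N ≡ suc m ∸ 2
        N≡n∸2 = trans (sym (m+n∸n≡m (length N) 1))
            (cong (_∸ 1) (trans (cong (length N +_) (sym Y≡)) (trans lengthNY M≡m)))
      go (suc i , suc j , N≡ , Y≡) = grown nice
        (lin 3 (λ l p es → 4 :* l :+ 4 :* (con 1 :+ p) :≤ es :+ con 12 ⇒ ⊢ 4 :* l :≤ es :+ con 8)
          (length S) (i + j * suc i) (E S) (seed-bound (suc i) (suc j) N≡ Y≡))

    from-seed : (∀ {w} → Attachment S w → Goal) → Goal
    from-seed attach = go (outside? S)
      where
      go : Dec (∃ λ w → w ∉ S) → Goal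
      go (yes out) = advance 4 nice weak-bound out attach ≤-refl (inj₂ diameter) (inj₂ rich)
      go (no none) = spanning (all-inside none)

    gain₄ : ∀ {w} → Attachment S w → 4 ≤ R w S → Goal
    gain₄ a 4≤R = attach-gain 4 nice weak-bound a (*-monoʳ-≤ 2 4≤R)

    module _ (4≤M : 4 ≤ length M) {w : V} (w∉ : w ∉ S) where

      private
        far-M : ∀ {v} → v ∈ M → ¬ w ~ v → Far w v
        far-M v∈ = ≁-far w∉ (there v∈)

      -- Let `s` be a non-neighbour of `w` in the clique and `z` a fourth clique vertex. Either `z`
      -- is a third common neighbour of `w` and `s`, or both `s` and `z` share `b` and `b′` with
      -- `w`.
      two-in-M : ∀ {b b′} → b ∈ M → b′ ∈ M → b ≢ b′ → w ~ b → w ~ b′ → 4 ≤ R w S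
      two-in-M {b} {b′} b∈ b′∈ b≢b′ w~b w~b′
        with s , s∈ , w≁s ← maximal (w∉ ∘ there)
        with z , z∈ , z≢b , z≢b′ , z≢s ← fresh₃ uniqueM 4≤M b b′ s
        with w ~? z
      ... | yes w~z = ≤-trans (commons₃ (far-M s∈ w≁s) b≢b′ (z≢b ∘ sym) (z≢b′ ∘ sym)
          w~b (clique b∈ s∈ λ { refl → w≁s w~b }) w~b′ (clique b′∈ s∈ λ { refl → w≁s w~b′ }) w~z (clique z∈ s∈ z≢s))
        (R≥₁ (there s∈))
      ... | no w≁z = two+two (there s∈) (there z∈) (z≢s ∘ sym)
        (commons₂ (far-M s∈ w≁s) b≢b′ w~b (clique b∈ s∈ λ { refl → w≁s w~b }) w~b′
            (clique b′∈ s∈ λ { refl → w≁s w~b′ }))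
        (commons₂ (far-M z∈ w≁z) b≢b′ w~b (clique b∈ z∈ (z≢b ∘ sym)) w~b′ (clique b′∈ z∈ (z≢b′ ∘ sym)))

      -- If `b` is the only neighbour of `w` in the clique and is not adjacent to `x`, then `c₁` and
      -- `c₂` share `x` and `b` with `w`. Otherwise one further neighbour `c` of `x` gives 2, and
      -- two more clique vertices give at least 1 each, by a cross through `x` and `c` if not
      -- adjacent to `x`.
      via-x : ∀ {b} → b ∈ M → w ~ x → w ~ b → 4 ≤ R w S
      via-x {b} b∈ w~x w~b with Fin.any? (λ b′ → (b′ ∈? M) ×-dec (¬? (b Fin.≟ b′) ×-dec (w ~? b′)))
      ... | yes (b′ , b′∈ , b≢b′ , w~b′) = two-in-M b∈ b′∈ b≢b′ w~b w~b′
      ... | no none with x ~? b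
      ... | no x≁b = two+two (there c₁∈) (there c₂∈) c₁≢c₂ (both c₁∈ x~c₁) (both c₂∈ x~c₂)
        where
        both : ∀ {c} → c ∈ M → x ~ c → 2 ≤ e w c
        both {c} c∈ x~c = commons₂ (far-M c∈ λ w~c → none (c , c∈ , (λ { refl → x≁b x~c }) , w~c))
          (x≢ b∈) w~x x~c w~b (clique b∈ c∈ λ { refl → x≁b x~c })
      ... | yes x~b
        with c , c∈ , x~c , c≢b ← other-neighbour b
        with v , v∈ , v≢b , v≢c , _ ← fresh₃ uniqueM 4≤M b c c
        with v′ , v′∈ , v′≢b , v′≢c , v′≢v ← fresh₃ uniqueM 4≤M b c v =
        ≤-trans (+-mono-≤ (+-mono-≤ (double c∈ c≢b x~c) (single v∈ v≢b v≢c)) (single v′∈ v′≢b v′≢c))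
          (R≥₃ (there c∈) (there v∈) (there v′∈) (v≢c ∘ sym) (v′≢c ∘ sym) (v′≢v ∘ sym))
        where
        w-far : ∀ {v} → v ∈ M → v ≢ b → Far w v
        w-far v∈ v≢b = far-M v∈ λ w~v → none (_ , v∈ , v≢b ∘ sym , w~v)
        double : ∀ {v} → v ∈ M → v ≢ b → x ~ v → 2 ≤ e w v
        double v∈ v≢b x~v = commons₂ (w-far v∈ v≢b) (x≢ b∈) w~x x~v w~b (clique b∈ v∈ (v≢b ∘ sym))
        single : ∀ {v} → v ∈ M → v ≢ b → v ≢ c → 1 ≤ e w v
        single {v} v∈ v≢b v≢c with x ~? v
        ... | yes x~v = ≤-trans (s≤s z≤n) (double v∈ v≢b x~v)
        ... | no x≁v = cross₁ (cross w~x x~c (clique c∈ v∈ (v≢c ∘ sym)) (far (x≢ v∈) x≁v) (w-far c∈ c≢b))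
          (d≢3 (w-far v∈ v≢b) w~b (clique b∈ v∈ (v≢b ∘ sym)))

      big-gain : Attachment S w → 4 ≤ R w S
      big-gain record { t∈ = here refl ; t′∈ = here refl ; t≢t′ = t≢t′ } = contradiction refl t≢t′
      big-gain record { t∈ = here refl ; t′∈ = there b∈ ; w~t = w~x ; w~t′ = w~b } = via-x b∈ w~x w~b
      big-gain record { t∈ = there b∈ ; t′∈ = here refl ; w~t = w~b ; w~t′ = w~x } = via-x b∈ w~x w~b
      big-gain record { t∈ = there b∈ ; t′∈ = there b′∈ ; t≢t′ = b≢b′ ; w~t = w~b ; w~t′ = w~b′ } =
        two-in-M b∈ b′∈ b≢b′ w~b w~b′

  -- The complete subgraph on `a`, `b`, `c`, `z` guarantees a seed clique of at least four vertices,
  -- for which every attachment makes good the whole deficit; adjacency of `v` and `z` is left open.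
  record Kite (a b c z v : V) : Set where
    constructor kite
    field
      ab : a ~ b
      ac : a ~ c
      az : a ~ z
      bc : b ~ c
      bz : b ~ z
      cz : c ~ z
      va : v ~ a
      vb : v ~ b
      v≢c : v ≢ c
      v≁c : ¬ v ~ c

  kite? : ∀ a b c z v → Dec (Kite a b c z v)
  kite? a b c z v = map′
    (λ ((ab , ac , az) , (bc , bz , cz) , (va , vb) , (p , q)) → kite ab ac az bc bz cz va vb p q)
    (λ (kite ab ac az bc bz cz va vb p q) → (ab , ac , az) , (bc , bz , cz) , (va , vb) , (p , q))
    (((a ~? b) ×-dec ((a ~? c) ×-dec (a ~? z))) ×-dec (((b ~? c) ×-dec ((b ~? z) ×-dec (c ~? z)))
      ×-dec (((v ~? a) ×-dec (v ~? b)) ×-dec (¬? (v Fin.≟ c) ×-dec ¬? (v ~? c)))))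

  from-kite : ∀ {a b c z v} → Kite a b c z v → Goal
  from-kite {a} {b} {c} {z} {v} k = from-seed λ a → gain₄ a (big-gain 4≤M (Attachment.w∉ a) a)
    where
    open Kite k
    four : Unique (a ∷ b ∷ c ∷ z ∷ [])
    four = (~⇒≢ ab ∷ ~⇒≢ ac ∷ ~⇒≢ az ∷ []) ∷ (~⇒≢ bc ∷ ~⇒≢ bz ∷ []) ∷ (~⇒≢ cz ∷ []) ∷ [] ∷ []
    open MaximalClique (maximise four (clique-∷
        (clique-∷ (clique-∷ (clique-∷ {M = []} (λ ()) []) (cz ∷ [])) (bc ∷ bz ∷ [])) (ab ∷ ac ∷ az ∷ [])))
    4≤M : 4 ≤ length M
    4≤M = length-⊆ four ⊇
    open FromSeed uniqueM clique maximal (⊇ (here refl)) (⊇ (there (here refl))) (⊇ (there (there (here refl))))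
      (~⇒≢ ab) va vb (far v≢c v≁c)

  record Diamond (a b x y : V) : Set where
    constructor diamond
    field
      ab : a ~ b
      xa : x ~ a
      xb : x ~ b
      ya : y ~ a
      yb : y ~ b
      x≢y : x ≢ y
      x≁y : ¬ x ~ y

  diamond? : ∀ a b x y → Dec (Diamond a b x y)
  diamond? a b x y = map′ (λ (ab , (xa , xb) , (ya , yb) , (p , q)) → diamond ab xa xb ya yb p q)
    (λ (diamond ab xa xb ya yb p q) → ab , (xa , xb) , (ya , yb) , (p , q))
    ((a ~? b) ×-dec (((x ~? a) ×-dec (x ~? b)) ×-dec
        (((y ~? a) ×-dec (y ~? b)) ×-dec (¬? (x Fin.≟ y) ×-dec ¬? (x ~? y)))))

  diamond-swap : ∀ {a b x y} → Diamond a b x y → Diamond b a x y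
  diamond-swap (diamond ab xa xb ya yb p q) = diamond (~-sym ab) xb xa yb ya p q

  diamond-flip : ∀ {a b x y} → Diamond a b x y → Diamond a b y x
  diamond-flip (diamond ab xa xb ya yb p q) = diamond ab ya yb xa xb (p ∘ sym) (q ∘ ~-sym)

  module NoKite (no-kite : ∀ {a b c z v} → ¬ Kite a b c z v) where

    -- Otherwise `a`, `b`, `x`, `w` would form a complete graph and `y` would complete a kite. Hence
    -- the triangles of a diamond are maximal cliques.
    no-K₄ : ∀ {a b x y w} → Diamond a b x y → w ~ a → w ~ b → ¬ w ~ x
    no-K₄ (diamond ab xa xb ya yb x≢y x≁y) w~a w~b w~x = no-kite
      (kite ab (~-sym xa) (~-sym w~a) (~-sym xb) (~-sym w~b) (~-sym w~x) ya yb (x≢y ∘ sym) (x≁y ∘ ~-sym))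

    -- Arises when a diamond is extended by a vertex adjacent to one vertex of degree three and one
    -- of degree two in it; that row is only bounded by 3, which leaves deficit 2.
    record Fan (c p₁ p₂ p₃ p₄ : V) : Set where
      field
        c₁ : c ~ p₁
        c₂ : c ~ p₂
        c₃ : c ~ p₃
        c₄ : c ~ p₄
        p₁₂ : p₁ ~ p₂
        p₂₃ : p₂ ~ p₃
        p₃₄ : p₃ ~ p₄
        f₁₃ : Far p₁ p₃
        f₂₄ : Far p₂ p₄
        f₁₄ : Far p₁ p₄

    fan-flip : ∀ {c p₁ p₂ p₃ p₄} → Fan c p₁ p₂ p₃ p₄ → Fan c p₄ p₃ p₂ p₁
    fan-flip F = record { c₁ = c₄ ; c₂ = c₃ ; c₃ = c₂ ; c₄ = c₁ ; p₁₂ = ~-sym p₃₄ ; p₂₃ = ~-sym p₂₃ ; p₃₄ = ~-sym p₁₂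
      ; f₁₃ = far-sym f₂₄ ; f₂₄ = far-sym f₁₃ ; f₁₄ = far-sym f₁₄ }
      where open Fan F

    module _ {S : List V} {v : V} (v∉ : v ∉ S) where

      module _ {c p₁ p₂ p₃ p₄} (F : Fan c p₁ p₂ p₃ p₄)
        (c∈ : c ∈ S) (p₁∈ : p₁ ∈ S) (p₂∈ : p₂ ∈ S) (p₃∈ : p₃ ∈ S) where
        open Fan F

        fan-inner : v ~ c → v ~ p₂ → 3 ≤ R v S
        fan-inner v~c v~p₂ = ≤-trans (s≤s (s≤s (s≤s z≤n))) (two+two p₁∈ p₃∈ (far⇒≢ f₁₃)
          (commons₂ (≁-far v∉ p₁∈ (no-K₄ D v~c v~p₂)) (~⇒≢ c₂) v~c c₁ v~p₂ (~-sym p₁₂))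
          (commons₂ (≁-far v∉ p₃∈ (no-K₄ (diamond-flip D) v~c v~p₂)) (~⇒≢ c₂) v~c c₃ v~p₂ p₂₃))
          where D = diamond c₂ (~-sym c₁) p₁₂ (~-sym c₃) (~-sym p₂₃) (far⇒≢ f₁₃) (far⇒≁ f₁₃)

        fan-outer : v ~ c → ¬ v ~ p₂ → ¬ v ~ p₃ → v ~ p₁ → 3 ≤ R v S
        fan-outer v~c v≁p₂ v≁p₃ v~p₁ = two+one p₂∈ p₃∈ (~⇒≢ p₂₃)
          (commons₂ v-p₂ (~⇒≢ c₁) v~c c₂ v~p₁ p₁₂)
          (cross₁ (cross v~p₁ p₁₂ p₂₃ f₁₃ v-p₂)
            (d≢3 (≁-far v∉ p₃∈ v≁p₃) v~c c₃))
          where v-p₂ = ≁-far v∉ p₂∈ v≁p₂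

      -- The centre `c` shares `p` and `q` with `v`, giving 2. The rim vertex `r` gives 1 more:
      -- either it shares `p` and `q` with `v` too, or the walk over `q` and `c` is a cross, at
      -- distance 2 because of `p`.
      off-centre₂ : ∀ {c p q r} → c ∈ S → r ∈ S → c ≢ r → ¬ v ~ c → c ~ p → c ~ q → c ~ r → p ≢ q →
        v ~ p → v ~ q → ¬ v ~ r → p ~ r → 3 ≤ R v S
      off-centre₂ {c} {p} {q} {r} c∈ r∈ c≢r v≁c c~p c~q c~r p≢q v~p v~q v≁r p~r =
        two+one c∈ r∈ c≢r (commons₂ v-c p≢q v~p (~-sym c~p) v~q (~-sym c~q)) single
        where
        v-c = ≁-far v∉ c∈ v≁c
        v-r = ≁-far v∉ r∈ v≁r
        single : 1 ≤ e v r
        single with q ~? r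
        ... | yes q~r = ≤-trans (s≤s z≤n) (commons₂ v-r p≢q v~p p~r v~q q~r)
        ... | no q≁r = cross₁ (cross v~q (~-sym c~q) c~r (far (λ { refl → v≁r v~q }) q≁r) v-c)
          (d≢3 v-r v~p p~r)

      off-centre₃ : ∀ {c p q r} → c ∈ S → ¬ v ~ c → c ~ p → c ~ q → c ~ r → p ≢ q → p ≢ r → q ≢ r →
        v ~ p → v ~ q → v ~ r → 3 ≤ R v S
      off-centre₃ c∈ v≁c c~p c~q c~r p≢q p≢r q≢r v~p v~q v~r = ≤-trans (n≤1+n 3) (≤-trans
        (commons₃ (≁-far v∉ c∈ v≁c) p≢q p≢r q≢r v~p (~-sym c~p) v~q (~-sym c~q) v~r (~-sym c~r)) (R≥₁ c∈))

      -- The value 3 is what deficit 2 requires, as 2 * 3 = 4 + 2. The cases run over the neighbours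
      -- of `v` in the fan, up to reflection; fewer than two contradict the attachment.
      fan-gain : ∀ {c p₁ p₂ p₃ p₄} → Fan c p₁ p₂ p₃ p₄ → c ∈ S → p₁ ∈ S → p₂ ∈ S → p₃ ∈ S → p₄ ∈ S →
        (∀ {u} → u ∈ S → u ∈ c ∷ p₁ ∷ p₂ ∷ p₃ ∷ p₄ ∷ []) → Attachment S v → 3 ≤ R v S
      fan-gain {c} {p₁} {p₂} {p₃} {p₄} F c∈ p₁∈ p₂∈ p₃∈ p₄∈ S⊆ a = go (v ~? c) (v ~? p₁) (v ~? p₂) (v ~? p₃) (v ~? p₄)
        where
        open Fan F
        p₁≢p₃ = far⇒≢ f₁₃
        p₂≢p₄ = far⇒≢ f₂₄
        p₁≢p₄ = far⇒≢ f₁₄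
        p₁≢p₂ = ~⇒≢ p₁₂
        p₂≢p₃ = ~⇒≢ p₂₃
        p₃≢p₄ = ~⇒≢ p₃₄
        only-one : ∀ {p} → ¬ v ~ c ⊎ c ≡ p → ¬ v ~ p₁ ⊎ p₁ ≡ p → ¬ v ~ p₂ ⊎ p₂ ≡ p → ¬ v ~ p₃ ⊎ p₃ ≡ p →
            ¬ v ~ p₄ ⊎ p₄ ≡ p → 3 ≤ R v S
        only-one h h₁ h₂ h₃ h₄ = ⊥-elim (not-single a λ u∈ → All.lookup (h ∷ h₁ ∷ h₂ ∷ h₃ ∷ h₄ ∷ []) (S⊆ u∈))
        go : Dec (v ~ c) → Dec (v ~ p₁) → Dec (v ~ p₂) → Dec (v ~ p₃) → Dec (v ~ p₄) → 3 ≤ R v S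
        go (yes y) _ (yes y₂) _ _ = fan-inner F c∈ p₁∈ p₂∈ p₃∈ y y₂
        go (yes y) _ (no _) (yes y₃) _ = fan-inner (fan-flip F) c∈ p₄∈ p₃∈ p₂∈ y y₃
        go (yes y) (yes y₁) (no n₂) (no n₃) _ = fan-outer F c∈ p₁∈ p₂∈ p₃∈ y n₂ n₃ y₁
        go (yes y) (no _) (no n₂) (no n₃) (yes y₄) = fan-outer (fan-flip F) c∈ p₄∈ p₃∈ p₂∈ y n₃ n₂ y₄
        go (yes _) (no n₁) (no n₂) (no n₃) (no n₄) = only-one (inj₂ refl) (inj₁ n₁) (inj₁ n₂) (inj₁ n₃) (inj₁ n₄)
        go (no n) (yes y₁) (yes y₂) (yes y₃) _ = off-centre₃ c∈ n c₁ c₂ c₃ p₁≢p₂ p₁≢p₃ p₂≢p₃ y₁ y₂ y₃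
        go (no n) (yes y₁) (yes y₂) (no _) (yes y₄) = off-centre₃ c∈ n c₁ c₂ c₄ p₁≢p₂ p₁≢p₄ p₂≢p₄ y₁ y₂ y₄
        go (no n) (yes y₁) (no _) (yes y₃) (yes y₄) = off-centre₃ c∈ n c₁ c₃ c₄ p₁≢p₃ p₁≢p₄ p₃≢p₄ y₁ y₃ y₄
        go (no n) (no _) (yes y₂) (yes y₃) (yes y₄) = off-centre₃ c∈ n c₂ c₃ c₄ p₂≢p₃ p₂≢p₄ p₃≢p₄ y₂ y₃ y₄
        go (no n) (yes y₁) (yes y₂) (no n₃) (no n₄) =
            off-centre₂ c∈ p₃∈ (~⇒≢ c₃) n c₂ c₁ c₃ (p₁≢p₂ ∘ sym) y₂ y₁ n₃ p₂₃
        go (no n) (yes y₁) (no n₂) (yes y₃) (no n₄) = off-centre₂ c∈ p₂∈ (~⇒≢ c₂) n c₁ c₃ c₂ p₁≢p₃ y₁ y₃ n₂ p₁₂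
        go (no n) (yes y₁) (no n₂) (no n₃) (yes y₄) = off-centre₂ c∈ p₂∈ (~⇒≢ c₂) n c₁ c₄ c₂ p₁≢p₄ y₁ y₄ n₂ p₁₂
        go (no n) (no n₁) (yes y₂) (yes y₃) (no n₄) =
            off-centre₂ c∈ p₁∈ (~⇒≢ c₁) n c₂ c₃ c₁ p₂≢p₃ y₂ y₃ n₁ (~-sym p₁₂)
        go (no n) (no n₁) (yes y₂) (no n₃) (yes y₄) = off-centre₂ c∈ p₃∈ (~⇒≢ c₃) n c₂ c₄ c₃ p₂≢p₄ y₂ y₄ n₃ p₂₃
        go (no n) (no n₁) (no n₂) (yes y₃) (yes y₄) =
            off-centre₂ c∈ p₂∈ (~⇒≢ c₂) n c₃ c₄ c₂ p₃≢p₄ y₃ y₄ n₂ (~-sym p₂₃)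
        go (no n) (yes _) (no n₂) (no n₃) (no n₄) = only-one (inj₁ n) (inj₂ refl) (inj₁ n₂) (inj₁ n₃) (inj₁ n₄)
        go (no n) (no n₁) (yes _) (no n₃) (no n₄) = only-one (inj₁ n) (inj₁ n₁) (inj₂ refl) (inj₁ n₃) (inj₁ n₄)
        go (no n) (no n₁) (no n₂) (yes _) (no n₄) = only-one (inj₁ n) (inj₁ n₁) (inj₁ n₂) (inj₂ refl) (inj₁ n₄)
        go (no n) (no n₁) (no n₂) (no n₃) (yes _) = only-one (inj₁ n) (inj₁ n₁) (inj₁ n₂) (inj₁ n₃) (inj₂ refl)
        go (no n) (no n₁) (no n₂) (no n₃) (no n₄) = only-one {c} (inj₁ n) (inj₁ n₁) (inj₁ n₂) (inj₁ n₃) (inj₁ n₄)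

    from-fan : ∀ {S c p₁ p₂ p₃ p₄} → Fan c p₁ p₂ p₃ p₄ → Nice S → length S ≡ 5 → 4 * length S ≤ E S + (8 + 2) →
      All (_∈ S) (c ∷ p₁ ∷ p₂ ∷ p₃ ∷ p₄ ∷ []) → (∀ {u} → u ∈ S → u ∈ c ∷ p₁ ∷ p₂ ∷ p₃ ∷ p₄ ∷ []) → Goal
    from-fan {S} {c} {p₁} {p₂} {p₃} {p₄} F nice len bound (c∈ ∷ p₁∈ ∷ p₂∈ ∷ p₃∈ ∷ p₄∈ ∷ []) S⊆ = advance 2 nice bound
      -- A fan has five vertices, so order at least six leaves one outside.
      (some-outside (subst (_< suc m) (sym len) 6≤n))
      (λ a → attach-gain 2 nice bound a (*-monoʳ-≤ 2 (fan-gain (Attachment.w∉ a) F c∈ p₁∈ p₂∈ p₃∈ p₄∈ S⊆ a)))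
      (s≤s (s≤s z≤n)) (inj₂ diameter) (inj₁ ≤-refl)
      where
      open Fan F
      to-centre : ∀ {u} → u ∈ S → d u c ≤ 1
      to-centre u∈ = All.lookup {P = λ u → d u c ≤ 1}
        (≤-trans (≤-reflexive (d-refl c)) z≤n ∷ near c₁ ∷ near c₂ ∷ near c₃ ∷ near c₄ ∷ []) (S⊆ u∈)
        where
        near : ∀ {p} → c ~ p → d p c ≤ 1
        near c~p = ≤-reflexive (~⇒d≡1 (~-sym c~p))
      diameter : Diameter₂ S
      diameter {u} {v} u∈ v∈ = lin 4 (λ uv uc cv vc → uv :≤ uc :+ cv ⇒ uc :≤ con 1 ⇒ vc :≤ con 1 ⇒ cv :≡ vc ⇒
          ⊢ uv :≤ con 2)
        (d u v) (d u c) (d c v) (d v c) (d-tri u c v) (to-centre u∈) (to-centre v∈) (d-sym c v)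

    from-diamond : ∀ {a b x y} → Diamond a b x y → Goal
    from-diamond {a} {b} {x} {y} D = advance 4 nice weak-bound (some-outside (≤-trans (n≤1+n 5) 6≤n)) attach
        ≤-refl (inj₂ diameter) (inj₂ rich)
      where
      open Diamond D
      maximal : Maximal (a ∷ b ∷ y ∷ [])
      maximal {w} w∉ with w ~? a | w ~? b
      ... | no w≁a | _ = a , here refl , w≁a
      ... | yes _ | no w≁b = b , there (here refl) , w≁b
      ... | yes w~a | yes w~b = y , there (there (here refl)) , no-K₄ (diamond-flip D) w~a w~b
      triangle : Clique (a ∷ b ∷ y ∷ [])
      triangle = clique-∷ (clique-∷ (clique-∷ {M = []} (λ ()) []) (~-sym yb ∷ [])) (ab ∷ ~-sym ya ∷ [])
      open FromSeed ((~⇒≢ ab ∷ ~⇒≢ (~-sym ya) ∷ []) ∷ (~⇒≢ (~-sym yb) ∷ []) ∷ [] ∷ []) triangle maximal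
        (here refl) (there (here refl)) (there (there (here refl))) (~⇒≢ ab) xa xb (far x≢y x≁y)
      x∈ : x ∈ S
      x∈ = here refl
      a∈ : a ∈ S
      a∈ = there (here refl)
      b∈ : b ∈ S
      b∈ = there (there (here refl))
      y∈S : y ∈ S
      y∈S = there (there (there (here refl)))
      attach : ∀ {w} → Attachment S w → Goal
      attach {w} A = go (w ~? a) (w ~? b) (w ~? x) (w ~? y)
        where
        w∉ = Attachment.w∉ A
        distant : ∀ {v} → v ∈ S → ¬ w ~ v → Far w v
        distant = ≁-far w∉
        only-one : ∀ {p} → ¬ w ~ x ⊎ x ≡ p → ¬ w ~ a ⊎ a ≡ p → ¬ w ~ b ⊎ b ≡ p → ¬ w ~ y ⊎ y ≡ p → Goal
        only-one h₁ h₂ h₃ h₄ = ⊥-elim (not-single A (All.lookup (h₁ ∷ h₂ ∷ h₃ ∷ h₄ ∷ [])))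
        -- The vertex `w` shares `a` and `y` with `b`, excess 2, and is joined to `x` by a cross
        -- over `y` and `b`, excess 1. This reduces the deficit from 4 to 2; the new set is the fan
        -- with centre `a` and rim `x`, `b`, `y`, `w`.
        to-fan : ∀ {a b x y} → Diamond a b x y → All (_∈ S) (a ∷ b ∷ x ∷ y ∷ []) →
          All (_∈ a ∷ b ∷ x ∷ y ∷ []) S → w ~ a → ¬ w ~ b → w ~ y → ¬ w ~ x → Goal
        to-fan {a} {b} {x} {y} (diamond ab xa xb ya yb x≢y x≁y) (a∈ ∷ b∈ ∷ x∈ ∷ y∈ ∷ []) S⊆ w~a w≁b w~y w≁x =
            from-fan F
          (nice-attach nice A) refl
          (lin 3 (λ es r es′ → con 16 :≤ es :+ con 12 ⇒ es :+ 2 :* r :≤ es′ ⇒ con 3 :≤ r ⇒ ⊢ con 20 :≤ es′ :+ con 10)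
            (E S) (R w S) (E (w ∷ S)) weak-bound (E-∷ w S)
            (two+one b∈ x∈ (~⇒≢ (~-sym xb)) (commons₂ w-b (~⇒≢ (~-sym ya)) w~a ab w~y yb)
              (cross₁ (cross w~y yb (~-sym xb) (far (x≢y ∘ sym) (x≁y ∘ ~-sym)) w-b)
                (d≢3 w-x w~a (~-sym xa)))))
          (there a∈ ∷ there x∈ ∷ there b∈ ∷ there y∈ ∷ here refl ∷ [])
          (λ { (here refl) → there (there (there (there (here refl)))) ; (there u∈) → place (All.lookup S⊆ u∈) })
          where
          w-b = distant b∈ w≁b
          w-x = distant x∈ w≁x
          F : Fan a x b y w
          F = record { c₁ = ~-sym xa ; c₂ = ab ; c₃ = ~-sym ya ; c₄ = ~-sym w~a ; p₁₂ = xb ; p₂₃ =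
              ~-sym yb ; p₃₄ = ~-sym w~y
            ; f₁₃ = far x≢y x≁y ; f₂₄ = far-sym w-b ; f₁₄ = far-sym w-x }
          place : ∀ {u} → u ∈ a ∷ b ∷ x ∷ y ∷ [] → u ∈ a ∷ x ∷ b ∷ y ∷ w ∷ []
          place (here eq)                         = here eq
          place (there (here eq))                 = there (there (here eq))
          place (there (there (here eq)))         = there (here eq)
          place (there (there (there (here eq)))) = there (there (there (here eq)))
        gain : 4 ≤ R w S → Goal
        gain = gain₄ A
        go : Dec (w ~ a) → Dec (w ~ b) → Dec (w ~ x) → Dec (w ~ y) → Goal
        go (yes p) (yes q) _ _ = gain (two+two x∈ y∈S x≢y
          (commons₂ (distant x∈ (no-K₄ D p q)) (~⇒≢ ab) p (~-sym xa) q (~-sym xb))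
          (commons₂ (distant y∈S (no-K₄ (diamond-flip D) p q)) (~⇒≢ ab) p (~-sym ya) q (~-sym yb)))
        go (yes p) (no q) (yes r) (yes s) = gain (≤-trans
            (commons₃ (distant b∈ q) (~⇒≢ (~-sym xa)) (~⇒≢ (~-sym ya)) x≢y p ab r xb s yb) (R≥₁ b∈))
        go (no p) (yes q) (yes r) (yes s) = gain (≤-trans
            (commons₃ (distant a∈ p) (~⇒≢ (~-sym xb)) (~⇒≢ (~-sym yb)) x≢y q (~-sym ab) r xa s ya) (R≥₁ a∈))
        go (no p) (no q) (yes r) (yes s) = gain (two+two a∈ b∈ (~⇒≢ ab)
          (commons₂ (distant a∈ p) x≢y r xa s ya) (commons₂ (distant b∈ q) x≢y r xb s yb))
        go (yes p) (no q) (no r) (yes s) = to-fan D (a∈ ∷ b∈ ∷ x∈ ∷ y∈S ∷ [])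
          (there (there (here refl)) ∷ here refl ∷ there (here refl) ∷ there (there (there (here refl))) ∷ []) p q s r
        go (yes p) (no q) (yes r) (no s) = to-fan (diamond-flip D) (a∈ ∷ b∈ ∷ y∈S ∷ x∈ ∷ [])
          (there (there (there (here refl))) ∷ here refl ∷ there (here refl) ∷ there (there (here refl)) ∷ []) p q r s
        go (no p) (yes q) (no r) (yes s) = to-fan (diamond-swap D) (b∈ ∷ a∈ ∷ x∈ ∷ y∈S ∷ [])
          (there (there (here refl)) ∷ there (here refl) ∷ here refl ∷ there (there (there (here refl))) ∷ []) q p s r
        go (no p) (yes q) (yes r) (no s) = to-fan (diamond-swap (diamond-flip D)) (b∈ ∷ a∈ ∷ y∈S ∷ x∈ ∷ [])
          (there (there (there (here refl))) ∷ there (here refl) ∷ here refl ∷ there (there (here refl)) ∷ []) q p r s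
        go (yes p) (no q) (no r) (no s) = only-one (inj₁ r) (inj₂ refl) (inj₁ q) (inj₁ s)
        go (no p) (yes q) (no r) (no s) = only-one (inj₁ r) (inj₁ p) (inj₂ refl) (inj₁ s)
        go (no p) (no q) (yes r) (no s) = only-one (inj₂ refl) (inj₁ p) (inj₁ q) (inj₁ s)
        go (no p) (no q) (no r) (yes s) = only-one (inj₁ r) (inj₁ p) (inj₁ q) (inj₂ refl)
        go (no p) (no q) (no r) (no s) = only-one {x} (inj₁ r) (inj₁ p) (inj₁ q) (inj₁ s)

-- Starting sets when there is no induced diamond

module Sparse {m : ℕ} (G : Graph (suc m)) (conn : Connected G) (conn₂ : StaysConnected G)
  (6≤n : 6 ≤ suc m) (unexceptional : Unexceptional G) where

  open Dense G conn conn₂ 6≤n unexceptional public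

  record Square (x c y c′ : V) : Set where
    constructor square
    field
      xc : x ~ c
      cy : c ~ y
      yc′ : y ~ c′
      c′x : c′ ~ x
      x≢y : x ≢ y
      x≁y : ¬ x ~ y
      c≢c′ : c ≢ c′
      c≁c′ : ¬ c ~ c′

  square? : ∀ x c y c′ → Dec (Square x c y c′)
  square? x c y c′ = map′ (λ ((p , q , r , s) , (t , u) , (v , w)) → square p q r s t u v w)
    (λ (square p q r s t u v w) → (p , q , r , s) , (t , u) , (v , w))
    (((x ~? c) ×-dec ((c ~? y) ×-dec ((y ~? c′) ×-dec (c′ ~? x)))) ×-dec
      ((¬? (x Fin.≟ y) ×-dec ¬? (x ~? y)) ×-dec (¬? (c Fin.≟ c′) ×-dec ¬? (c ~? c′))))

  module NoDiamond (no-diamond : ∀ {a b x y} → ¬ Diamond a b x y) where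

    -- Each diagonal has two common neighbours, hence excess 2; doubled this is 8 = 4 * 4 - 8,
    -- exactly what is required.
    from-square : ∀ {x c y c′} → Square x c y c′ → Goal
    from-square {x} {c} {y} {c′} (square xc cy yc′ c′x x≢y x≁y c≢c′ c≁c′) = grown nice
      (lin 6 (λ a b ra rb e₁ e₂ → con 0 :+ 2 :* ra :≤ a ⇒ a :+ 2 :* rb :≤ b ⇒ e₁ :≤ ra ⇒ e₂ :≤ rb ⇒
          con 2 :≤ e₁ ⇒ con 2 :≤ e₂ ⇒
          ⊢ con 16 :≤ b :+ con 8)
        (E (c ∷ y ∷ c′ ∷ [])) (E S) (R c (y ∷ c′ ∷ [])) (R x (c ∷ y ∷ c′ ∷ [])) (e c c′) (e x y)
        (≤-trans (+-monoˡ-≤ (2 * R c (y ∷ c′ ∷ [])) (z≤n {E (y ∷ c′ ∷ [])})) (E-∷ c (y ∷ c′ ∷ [])))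
            (E-∷ x (c ∷ y ∷ c′ ∷ []))
        (R≥₁ {c} {c′} {y ∷ c′ ∷ []} (there (here refl))) (R≥₁ {x} {y} {c ∷ y ∷ c′ ∷ []} (there (here refl)))
        (commons₂ (far c≢c′ c≁c′) x≢y (~-sym xc) (~-sym c′x) cy yc′)
        (commons₂ (far x≢y x≁y) c≢c′ xc cy (~-sym c′x) (~-sym yc′)))
      where
      S : List V
      S = x ∷ c ∷ y ∷ c′ ∷ []
      unique : Unique S
      unique = (~⇒≢ xc ∷ x≢y ∷ ~⇒≢ (~-sym c′x) ∷ []) ∷ (~⇒≢ cy ∷ c≢c′ ∷ []) ∷ (~⇒≢ yc′ ∷ []) ∷ [] ∷ []
      x∈ : x ∈ S
      x∈ = here refl
      c∈ : c ∈ S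
      c∈ = there (here refl)
      y∈ : y ∈ S
      y∈ = there (there (here refl))
      c′∈ : c′ ∈ S
      c′∈ = there (there (there (here refl)))
      link : ∀ r {u} → u ∈ S → u ≢ r → ∃ λ s → s ∈ x ∷ c ∷ [] × Chain (λ v → v ∈ S × v ≢ r) u s
      link r (here refl) u≢r = x , here refl , [ x∈ , u≢r ]
      link r (there (here refl)) u≢r = c , there (here refl) , [ c∈ , u≢r ]
      link r (there (there (here refl))) u≢r with c Fin.≟ r
      ... | no c≢r   = c , there (here refl) , (y∈ , u≢r) ∷⟨ ~-sym cy ⟩ [ c∈ , c≢r ]
      ... | yes refl = x , here refl , (y∈ , u≢r) ∷⟨ yc′ ⟩ (c′∈ , c≢c′ ∘ sym) ∷⟨ c′x ⟩ [ x∈ , ~⇒≢ xc ]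
      link r (there (there (there (here refl)))) u≢r with x Fin.≟ r
      ... | no x≢r   = x , here refl , (c′∈ , u≢r) ∷⟨ c′x ⟩ [ x∈ , x≢r ]
      ... | yes refl = c , there (here refl) , (c′∈ , u≢r) ∷⟨ ~-sym yc′ ⟩ (y∈ , x≢y ∘ sym) ∷⟨ ~-sym cy ⟩ [ c∈ ,
          ~⇒≢ (~-sym xc) ]
      undominated : ∀ {w} → w ∉ S → ∃ λ s → s ∈ S × ¬ w ~ s
      undominated {w} w∉ with w ~? x | w ~? c | w ~? y
      ... | no w≁x | _ | _ = x , x∈ , w≁x
      ... | yes _ | no w≁c | _ = c , c∈ , w≁c
      ... | yes _ | yes _ | no w≁y = y , y∈ , w≁y
      ... | yes w~x | yes w~c | yes w~y = contradiction
          (diamond w~c (~-sym w~x) xc (~-sym w~y) (~-sym cy) x≢y x≁y) no-diamond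
      nice : Nice S
      nice = record
        { unique = unique
        ; linked = extend-linked (clique-linked (clique-∷ (clique-∷ {M = []} (λ ()) []) (xc ∷ [])))
            (λ { (here refl) → x∈ ; (there (here refl)) → c∈ }) link
        ; undominated = undominated
        ; third = fresh₂ unique (s≤s (s≤s (s≤s z≤n)))
        }

    module NoSquare (no-square : ∀ {x c y c′} → ¬ Square x c y c′) where

      -- Two common neighbours of a non-adjacent pair would form a diamond with it if adjacent, and
      -- a square if not.
      unique-common : ∀ {x y c c′} → Far x y → x ~ c → c ~ y → x ~ c′ → c′ ~ y → c ≡ c′
      unique-common {x} {y} {c} {c′} x-y xc cy xc′ c′y with c Fin.≟ c′ | c ~? c′
      ... | yes c≡c′ | _ = c≡c′
      ... | no c≢c′ | yes cc′ = contradiction (diamond cc′ xc xc′ (~-sym cy) (~-sym c′y) (far⇒≢ x-y)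
          (far⇒≁ x-y)) no-diamond
      ... | no c≢c′ | no c≁c′ = contradiction (square xc cy (~-sym c′y) (~-sym xc′) (far⇒≢ x-y) (far⇒≁ x-y)
          c≢c′ c≁c′) no-square

      module _ {f : ℕ → V} {k : ℕ} (iso : IsoCycle f (2 + k)) (2≤k : 2 ≤ k) where

        open Around iso

        cycle-nice : Nice vertexCycle
        cycle-nice = record
          { unique = cycle-unique
          -- The closing edge is trivially linked, and the whole cycle is attached to it as an ear.
          ; linked = cycle-linked (clique-linked (clique-∷ (clique-∷ {M = []} (λ ()) []) (closing ∷ [])))
              (here refl) (there (here refl))
              (λ { (here refl) → cycle⁺ 0 ; (there (here refl)) → cycle⁺ (suc k) })
              (λ i _ → cycle⁺ i) (λ u∈ → let i , eq = cycle⁻ u∈ in inj₂ (toℕ i , Fin.toℕ<n i , eq))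
          ; undominated = undominated
          ; third = fresh₂ cycle-unique (subst (3 ≤_) (sym (List.length-tabulate (f ∘ toℕ)))
              (s≤s (s≤s (≤-trans (s≤s z≤n) 2≤k))))
          }
          where
          closing : f 0 ~ f (suc k)
          closing = ~-sym (subst (f (suc k) ~_) (IsoCycle.periodic iso 0) (f-adj (suc k)))
          undominated : ∀ {w} → w ∉ vertexCycle → ∃ λ s → s ∈ vertexCycle × ¬ w ~ s
          undominated {w} w∉ with w ~? f 0 | w ~? f 2
          ... | no w≁ | _ = f 0 , cycle⁺ 0 , w≁
          ... | yes _ | no w≁ = f 2 , cycle⁺ 2 , w≁
          ... | yes p | yes q = contradiction
            (subst (_∈ vertexCycle) (unique-common (IsoCycle.far₂ iso (s≤s (s≤s 2≤k)) 0) (f-adj 0) (f-adj 1)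
                (~-sym p) q) (cycle⁺ 1)) w∉

        cycle-E : ∀ c → (∀ i → c ≤ R (f i) vertexCycle) → c * (2 + k) ≤ E vertexCycle
        cycle-E c rows = ≤-trans (≤-reflexive (trans (*-comm c (2 + k))
            (trans (cong (_* c) (sym (List.length-tabulate {n = 2 + k} (f ∘ toℕ))))
            (sym (total-const c vertexCycle)))))
          (total-mono vertexCycle (All.tabulate λ u∈ →
              let i , eq = cycle⁻ u∈ in subst (λ u → c ≤ R u vertexCycle) (sym eq) (rows (toℕ i))))

      from-long-cycle : ∀ {f k} → IsoCycle f (2 + k) → 4 ≤ k → Goal
      from-long-cycle {f} {k} iso 4≤k = grown (cycle-nice iso 2≤k)
        (lin 3 (λ l es c → l :≡ c ⇒ 6 :* c :≤ es ⇒
            ⊢ 4 :* l :≤ es :+ con 8) (length vertexCycle) (E vertexCycle) (2 + k)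
          (List.length-tabulate (f ∘ toℕ)) (cycle-E iso 2≤k 6 (long-row iso (s≤s (s≤s 4≤k)) cycle⁺)))
        where
        open Around iso
        2≤k = ≤-trans (s≤s (s≤s z≤n)) 4≤k

      -- Each vertex has two partners at distance two, each with excess 1 from the opposite edge.
      -- The five rows give 10 where 12 is required, hence deficit 2.
      pentagon-row : ∀ {f X} → IsoCycle f 5 → (∀ j → f j ∈ X) → ∀ i → 2 ≤ R (f i) X
      pentagon-row {f} {X} iso f∈X i = subst (λ k → 2 ≤ R (f k) X) (+-identityʳ i) (≤-trans
        (+-mono-≤ (pentagon-e P) (subst (1 ≤_) (e-sym _ _) (pentagon-e (turn (turn (turn P))))))
        (R≥₂ (f∈X _) (f∈X _) (~⇒≢ (Pentagon.cx P))))
        where P = pentagon-of (IsoCycle.rotate iso i)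

      module FromPentagon {S : List V} (nice : Nice S) (len : length S ≡ 5) (bound : 10 ≤ E S) where

        -- The two sides of the pentagon give two crosses from `w` to the opposite vertex `z₃`. At
        -- distance 3 these are disjoint geodesics, and excess 3 repairs the deficit. At distance 2
        -- they give only 2; then the midpoint `u` between `w` and `z₃` is added too, and its row of
        -- 3, one unit each from `z₀`, `z₁` and `z₄`, supplies the rest.
        attach-edge : ∀ {f w} → IsoCycle f 5 → (∀ j → f j ∈ S) → All (_∈ tabulate {n = 5} (f ∘ toℕ)) S →
          w ∉ S → w ~ f 0 → w ~ f 1 → Goal
        attach-edge {f} {w} iso f∈ S⊆ w∉ w~z₀ w~z₁ = go (d w z₃ ≟ℕ 3)
          where
          z₀ = f 0
          z₁ = f 1
          z₂ = f 2
          z₃ = f 3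
          z₄ = f 4
          P = pentagon-of iso
          open Pentagon P
          no-other : ∀ {p q c} → Far p q → p ~ c → c ~ q → c ∈ S → w ~ p → ¬ w ~ q
          no-other p-q pc cq c∈ w~p w~q = w∉ (subst (_∈ S) (unique-common p-q pc cq (~-sym w~p) w~q) c∈)
          w-z₂ = ≁-far w∉ (f∈ 2) (no-other a-c ab bc (f∈ 1) w~z₀)
          w-z₃ = ≁-far w∉ (f∈ 3) (no-other (far-sym x-a) (~-sym ya) (~-sym xy) (f∈ 4) w~z₀)
          w-z₄ = ≁-far w∉ (f∈ 4) (no-other (far-sym y-b) (~-sym ab) (~-sym ya) (f∈ 0) w~z₁)
          c₁ : Cross w z₃ z₀ z₄
          c₁ = cross w~z₀ (~-sym ya) (~-sym xy) (far-sym x-a) w-z₄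
          c₂ : Cross w z₃ z₁ z₂
          c₂ = cross w~z₁ bc cx b-x w-z₂
          nice-w : Nice (w ∷ S)
          nice-w = nice-∷ nice w∉ (f∈ 0) (f∈ 1) (~⇒≢ ab) w~z₀ w~z₁
          go : Dec (d w z₃ ≡ 3) → Goal
          go (yes d≡3) = grown nice-w (subst (λ l → 4 * suc l ≤ E (w ∷ S) + 8) (sym len)
            (lin 4 (λ es r es′ ee → con 10 :≤ es ⇒ es :+ 2 :* r :≤ es′ ⇒ ee :≤ r ⇒ con 3 :≤ ee ⇒
                ⊢ con 24 :≤ es′ :+ con 8)
              (E S) (R w S) (E (w ∷ S)) (e w z₃) bound (E-∷ w S) (R≥₁ (f∈ 3))
                  (cross₃ c₁ c₂ (~⇒≢ ab) (far⇒≢ (far-sym c-y)) d≡3)))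
          go (no d≢3) = with-u (step d≡2′)
            where
            d≡2′ : d w z₃ ≡ 2
            d≡2′ = ≤-antisym (≤-pred (≤∧≢⇒< (d-minimal (w~z₀ ∷ ~-sym ya ∷ ~-sym xy ∷ [])) d≢3)) w-z₃
            with-u : (∃ λ u → w ~ u × d u z₃ ≡ 1) → Goal
            with-u (u , w~u , duz₃) = grown (nice-∷ nice-w u∉′ (here refl) (there (f∈ 3)) (far⇒≢ w-z₃)
                (~-sym w~u) u~z₃)
              (subst (λ l → 4 * suc (suc l) ≤ E (u ∷ w ∷ S) + 8) (sym len)
                (lin 6 (λ es rw es′ ru es″ ee → con 10 :≤ es ⇒ es :+ 2 :* rw :≤ es′ ⇒ es′ :+ 2 :* ru :≤ es″ ⇒
                    con 2 :≤ ee ⇒ ee :≤ rw ⇒ con 3 :≤ ru ⇒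
                    ⊢ con 28 :≤ es″ :+ con 8)
                  (E S) (R w S) (E (w ∷ S)) (R u (w ∷ S)) (E (u ∷ w ∷ S)) (e w z₃) bound (E-∷ w S) (E-∷ u (w ∷ S))
                  (cross₂ c₁ c₂ (≢ˡ (~⇒≢ ab))) (R≥₁ (f∈ 3)) row-u))
              where
              u~z₃ = d≡1⇒~ duz₃
              avoid-u : ∀ {p q c c′} → Far p q → p ~ c → c ~ q → p ~ c′ → c′ ~ q → c ∈ S → c′ ∉ S → ⊥
              avoid-u p-q pc cq pc′ c′q c∈ c′∉ = c′∉ (subst (_∈ S) (unique-common p-q pc cq pc′ c′q) c∈)
              u∉ : u ∉ S
              u∉ u∈ with All.lookup S⊆ u∈
              ... | here refl = far⇒≁ x-a (~-sym u~z₃)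
              ... | there (here refl) = far⇒≁ b-x u~z₃
              ... | there (there (here refl)) = far⇒≁ w-z₂ w~u
              ... | there (there (there (here refl))) = far⇒≁ w-z₃ w~u
              ... | there (there (there (there (here refl)))) = far⇒≁ w-z₄ w~u
              u∉′ : u ∉ w ∷ S
              u∉′ (here refl) = ~-irrefl w~u
              u∉′ (there u∈)  = u∉ u∈
              u-z₀ = ≁-far u∉ (f∈ 0) λ u~z₀ → avoid-u x-a xy ya (~-sym u~z₃) u~z₀ (f∈ 4) u∉
              u-z₁ = ≁-far u∉ (f∈ 1) λ u~z₁ → avoid-u b-x bc cx (~-sym u~z₁) u~z₃ (f∈ 2) u∉
              u-z₂ = ≁-far u∉ (f∈ 2) λ u~z₂ → avoid-u w-z₂ w~z₁ bc w~u u~z₂ (f∈ 1) u∉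
              u-z₄ = ≁-far u∉ (f∈ 4) λ u~z₄ → avoid-u w-z₄ w~z₀ (~-sym ya) w~u u~z₄ (f∈ 0) u∉
              close : ∀ {p q} → u ~ p → p ~ q → d u q ≢ 3
              close u~p p~q d≡3 = contradiction (subst (_≤ 2) d≡3 (d-minimal (u~p ∷ p~q ∷ []))) λ { (s≤s (s≤s ())) }
              row-u : 3 ≤ R u (w ∷ S)
              row-u = ≤-trans (+-mono-≤ (+-mono-≤
                  (cross₁ (cross u~z₃ xy ya x-a u-z₄) (close (~-sym w~u) w~z₀))
                  (cross₁ (cross u~z₃ (~-sym cx) (~-sym bc) (far-sym b-x) u-z₂) (close (~-sym w~u) w~z₁)))
                  (cross₁ (cross (~-sym w~u) w~z₀ (~-sym ya) w-z₄ u-z₀) (close u~z₃ xy)))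
                (R≥₃ (there (f∈ 0)) (there (f∈ 1)) (there (f∈ 4)) (~⇒≢ ab) (~⇒≢ (~-sym ya)) (far⇒≢ (far-sym y-b)))

      from-pentagon : ∀ {f} → IsoCycle f 5 → Goal
      from-pentagon {f} iso = advance 2 nice (+-monoˡ-≤ 10 bound)
          (some-outside 6≤n) attach (s≤s (s≤s z≤n)) (inj₂ diameter) (inj₁ ≤-refl)
        where
        open Around iso renaming (vertexCycle to S)
        open IsoCycle iso
        nice : Nice S
        nice = cycle-nice iso (s≤s (s≤s z≤n))
        bound : 10 ≤ E S
        bound = cycle-E iso (s≤s (s≤s z≤n)) 2 (pentagon-row iso cycle⁺)
        apart₂ : ∀ i g → g ≤ 4 → d (f i) (f (i + g)) ≤ 2
        apart₂ i 0 _ = ≤-trans (≤-reflexive (short i 0 z≤n)) z≤n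
        apart₂ i 1 _ = ≤-trans (≤-reflexive (short i 1 (s≤s (s≤s z≤n)))) (s≤s z≤n)
        apart₂ i 2 _ = ≤-reflexive (short i 2 (s≤s (s≤s (s≤s (s≤s z≤n)))))
        apart₂ i 3 _ = ≤-reflexive (long i 3 2 refl (s≤s (s≤s (s≤s (s≤s (s≤s z≤n))))))
        apart₂ i 4 _ = ≤-trans (≤-reflexive (long i 4 1 refl (s≤s (s≤s (s≤s (s≤s (s≤s z≤n))))))) (s≤s z≤n)
        apart₂ i (suc (suc (suc (suc (suc g))))) (s≤s (s≤s (s≤s (s≤s ()))))
        diameter-f : ∀ i j → i ≤ j → j ≤ 4 → d (f i) (f j) ≤ 2
        diameter-f i j i≤j j≤4 = subst (λ j → d (f i) (f j) ≤ 2) (m+[n∸m]≡n i≤j)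
            (apart₂ i (j ∸ i) (≤-trans (m∸n≤m j i) j≤4))
        diameter : Diameter₂ S
        diameter u∈ v∈ with i , refl ← cycle⁻ u∈ | j , refl ← cycle⁻ v∈ with ≤-total (toℕ i) (toℕ j)
        ... | inj₁ i≤j = diameter-f _ _ i≤j (≤-pred (Fin.toℕ<n j))
        ... | inj₂ j≤i = ≤-trans (≤-reflexive (d-sym (f (toℕ i)) _)) (diameter-f _ _ j≤i (≤-pred (Fin.toℕ<n i)))
        attach : ∀ {w} → Attachment S w → Goal
        attach {w} A with i , t≡ ← cycle⁻ (Attachment.t∈ A) | j , t′≡ ← cycle⁻ (Attachment.t′∈ A) =
          pick i j (λ { refl → Attachment.t≢t′ A (trans t≡ (sym t′≡)) })
            (subst (w ~_) t≡ (Attachment.w~t A)) (subst (w ~_) t′≡ (Attachment.w~t′ A))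
          where
          w∉ = Attachment.w∉ A
          edge : ∀ i → i ≤ 5 → w ~ f i → w ~ f (suc i) → Goal
          edge i i≤5 p q = FromPentagon.attach-edge nice refl bound (rotate i) (λ j → cycle⁺ (i + j))
            (All.tabulate rotated) w∉ (subst (λ j → w ~ f j) (sym (+-identityʳ i)) p)
                (subst (λ j → w ~ f j) (+-comm 1 i) q)
            where
            rotated : ∀ {v} → v ∈ S → v ∈ tabulate {n = 5} ((λ j → f (i + j)) ∘ toℕ)
            rotated v∈ with j , refl ← cycle⁻ v∈ = subst (_∈ tabulate {n = 5} ((λ j → f (i + j)) ∘ toℕ))
              (trans (cong f (trans (sym (+-assoc i (5 ∸ i) (toℕ j)))
                  (trans (cong (_+ toℕ j) (m+[n∸m]≡n i≤5)) (+-comm 5 (toℕ j))))) (periodic (toℕ j)))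
              (Around.cycle⁺ (rotate i) (5 ∸ i + toℕ j))
          skip : ∀ i → w ~ f i → w ~ f (2 + i) → Goal
          skip i p q = contradiction (subst (_∈ S)
              (unique-common (far₂ (n≤1+n 4) i) (f-adj i) (f-adj (suc i)) (~-sym p) q) (cycle⁺ (suc i))) w∉
          wrap₀ : w ~ f 0 → w ~ f 5
          wrap₀ = subst (w ~_) (sym (periodic 0))
          wrap₁ : w ~ f 1 → w ~ f 6
          wrap₁ = subst (w ~_) (sym (periodic 1))
          -- The indices differ by `suc g`. Differences 3 and 4 become 2 and 1 round the other side
          -- of the pentagon, using the period 5.
          ordered : ∀ i g → suc (g + i) ≤ 4 → w ~ f i → w ~ f (suc (g + i)) → Goal
          ordered i 0 le p q = edge i (≤-trans (<⇒≤ le) (n≤1+n 4)) p q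
          ordered i 1 le p q = skip i p q
          ordered 0 2 le p q = skip 3 q (wrap₀ p)
          ordered 1 2 le p q = skip 4 q (wrap₁ p)
          ordered 0 3 le p q = edge 4 (n≤1+n 4) q (wrap₀ p)
          ordered (suc (suc i)) 2 (s≤s (s≤s (s≤s (s≤s ())))) p q
          ordered (suc i) 3 (s≤s (s≤s (s≤s (s≤s ())))) p q
          ordered i (suc (suc (suc (suc g)))) (s≤s (s≤s (s≤s (s≤s ())))) p q
          sorted : ∀ i j → i < j → j ≤ 4 → w ~ f i → w ~ f j → Goal
          sorted i j i<j j≤4 p q = ordered i (j ∸ suc i) (subst (_≤ 4) (sym eq) j≤4) p
              (subst (λ j → w ~ f j) (sym eq) q)
            where
            eq : suc (j ∸ suc i + i) ≡ j
            eq = trans (sym (+-suc (j ∸ suc i) i)) (m∸n+n≡m i<j)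
          pick : ∀ (i j : Fin 5) → i ≢ j → w ~ f (toℕ i) → w ~ f (toℕ j) → Goal
          pick i j i≢j p q with <-cmp (toℕ i) (toℕ j)
          ... | tri< i<j _ _ = sorted _ _ i<j (≤-pred (Fin.toℕ<n j)) p q
          ... | tri≈ _ i≡j _ = contradiction (Fin.toℕ-injective i≡j) i≢j
          ... | tri> _ _ j<i = sorted _ _ j<i (≤-pred (Fin.toℕ<n i)) q p

      -- The list `K′` is the maximal clique containing `s t`; it is used only to find a cycle.
      -- Thinness rules out a mixed triangle and `unique-common` a mixed square, so the isometric
      -- cycle at its boundary has length at least five and is itself the starting set.
      from-edge : ∀ {s t p q} → s ~ t → Far p q → Goal
      from-edge {s} {t} {p} {q} s~t p-q = go (outside? K′)
        where
        Close : V → V → Set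
        Close u v = u ≡ v ⊎ u ~ v
        close? : ∀ u v → Dec (Close u v)
        close? u v = (u Fin.≟ v) ⊎-dec (u ~? v)
        both? : ∀ v → Dec (Close v s × Close v t)
        both? v = close? v s ×-dec close? v t
        K′ : List V
        K′ = filter both? vertices
        K⁻ : ∀ {v} → v ∈ K′ → Close v s × Close v t
        K⁻ v∈ = proj₂ (∈-filter⁻ both? {xs = vertices} v∈)
        K⁺ : ∀ {v} → Close v s → Close v t → v ∈ K′
        K⁺ c c′ = ∈-filter⁺ both? (∈-allFin _) (c , c′)
        s∈ : s ∈ K′
        s∈ = K⁺ (inj₁ refl) (inj₂ s~t)
        t∈ : t ∈ K′
        t∈ = K⁺ (inj₂ (~-sym s~t)) (inj₁ refl)
        clique : Clique K′
        clique {u} {v} u∈ v∈ u≢v with K⁻ u∈ | K⁻ v∈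
        ... | inj₁ refl , _ | inj₁ refl , _ = contradiction refl u≢v
        ... | inj₁ refl , _ | inj₂ v~s , _ = ~-sym v~s
        ... | inj₂ u~s , _ | inj₁ refl , _ = u~s
        ... | inj₂ u~s , inj₁ refl | inj₂ v~s , inj₁ refl = contradiction refl u≢v
        ... | inj₂ u~s , inj₁ refl | inj₂ v~s , inj₂ v~t = ~-sym v~t
        ... | inj₂ u~s , inj₂ u~t | inj₂ v~s , inj₁ refl = u~t
        ... | inj₂ u~s , inj₂ u~t | inj₂ v~s , inj₂ v~t with u ~? v
        ... | yes u~v = u~v
        ... | no u≁v = contradiction (unique-common (far u≢v u≁v) u~s (~-sym v~s) u~t (~-sym v~t)) (~⇒≢ s~t)
        meets-once : ∀ {c w a b} → c ∈ K′ → ¬ w ~ c → w ∉ K′ → a ∈ K′ → b ∈ K′ → w ~ a → w ~ b → a ≡ b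
        meets-once c∈ w≁c w∉ a∈ b∈ w~a w~b = unique-common (≁-far w∉ c∈ w≁c)
          w~a (clique a∈ c∈ λ { refl → w≁c w~a }) w~b (clique b∈ c∈ λ { refl → w≁c w~b })
        -- An outside vertex misses `s` or `t`; with that vertex it has at most one common
        -- neighbour, while all its neighbours in the clique are such.
        thin-K : Thin K′
        thin-K {w} w∉ a∈ b∈ w~a w~b with w ~? s | w ~? t
        ... | yes w~s | yes w~t = contradiction (K⁺ (inj₂ w~s) (inj₂ w~t)) w∉
        ... | no w≁s | _ = meets-once s∈ w≁s w∉ a∈ b∈ w~a w~b
        ... | yes _ | no w≁t = meets-once t∈ w≁t w∉ a∈ b∈ w~a w~b
        avoid₂ : ∀ u v → ∃ λ (r : V) → r ≢ u × r ≢ v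
        avoid₂ u v = let r , _ , r≢ = fresh₂ (Unique.allFin⁺ (suc m))
                           (subst (3 ≤_) (sym (List.length-tabulate id)) (≤-trans (s≤s (s≤s (s≤s z≤n))) 6≤n)) u
                               v in r , r≢
        by-cycle : MixedCycle K′ → Goal
        by-cycle record { k = 0 ; 1≤k = () }
        by-cycle record { k = 1 ; f = f ; iso = iso ; f₀∈ = f₀∈ ; f₁∉ = f₁∉ ; fₗ∈ = fₗ∈ } =
          contradiction (thin-K f₁∉ f₀∈ fₗ∈ (~-sym (f-adj 0)) (f-adj 1)) (≢-f 0 2 (s≤s z≤n) ≤-refl)
          where open Around iso
        by-cycle record { k = 2 ; f = f ; iso = iso } = contradiction
          (unique-common (IsoCycle.far₂ iso ≤-refl 0) (f-adj 0) (f-adj 1)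
            (~-sym (subst (f 3 ~_) (IsoCycle.periodic iso 0) (f-adj 3))) (~-sym (f-adj 2)))
          (≢-f 1 3 (s≤s (s≤s z≤n)) ≤-refl)
          where open Around iso
        by-cycle record { k = 3 ; iso = iso } = from-pentagon iso
        by-cycle record { k = suc (suc (suc (suc k))) ; iso = iso } = from-long-cycle iso (s≤s (s≤s (s≤s (s≤s z≤n))))
        go : Dec (∃ λ w → w ∉ K′) → Goal
        go (yes (v , v∉)) = by-cycle (boundary (clique-linked clique) s∈ t∈ (~⇒≢ s~t) avoid₂ v∉)
        go (no none) = contradiction (clique (all-inside none p) (all-inside none q) (far⇒≢ p-q)) (far⇒≁ p-q)

  far-pair? : Dec (∃ λ p → ∃ λ q → p ≢ q × ¬ p ~ q)
  far-pair? = Fin.any? λ p → Fin.any? λ q → ¬? (p Fin.≟ q) ×-dec ¬? (p ~? q)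

  goal : Goal
  goal = by-kite (Fin.any? λ a → Fin.any? λ b → Fin.any? λ c → Fin.any? λ z → Fin.any? λ v → kite? a b c z v)
    where
    by-far : (∀ {a b x y} → ¬ Diamond a b x y) → (∀ {x c y c′} → ¬ Square x c y c′) →
      Dec (∃ λ p → ∃ λ q → p ≢ q × ¬ p ~ q) → Goal
    -- Any edge would do; the first one on a geodesic from `p` to `q` is at hand.
    by-far no-diamond no-square (yes (p , q , p≢q , p≁q)) = NoDiamond.NoSquare.from-edge no-diamond no-square
      (proj₁ (proj₂ (step (sym (m+[n∸m]≡n (d-pos p≢q)))))) (far p≢q p≁q)
    by-far _ _ (no none) = contradiction (inj₁ (isomorphic-complete G adjacent-all)) unexceptional
      where
      adjacent-all : ∀ {u v} → u ≢ v → u ~ v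
      adjacent-all {u} {v} u≢v with u ~? v
      ... | yes u~v = u~v
      ... | no u≁v = contradiction (u , v , u≢v , u≁v) none
    by-square : (∀ {a b x y} → ¬ Diamond a b x y) → Dec (∃ λ x → ∃ λ c → ∃ λ y → ∃ λ c′ → Square x c y c′) → Goal
    by-square no-diamond (yes (_ , _ , _ , _ , sq)) = NoDiamond.from-square no-diamond sq
    by-square no-diamond (no none) = by-far no-diamond (λ sq → none (_ , _ , _ , _ , sq)) far-pair?
    by-diamond : (∀ {a b c z v} → ¬ Kite a b c z v) → Dec (∃ λ a → ∃ λ b → ∃ λ x → ∃ λ y → Diamond a b x y) → Goal
    by-diamond no-kite (yes (_ , _ , _ , _ , D)) = NoKite.from-diamond no-kite D
    by-diamond no-kite (no none) = by-square (λ D → none (_ , _ , _ , _ , D))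
      (Fin.any? λ x → Fin.any? λ c → Fin.any? λ y → Fin.any? λ c′ → square? x c y c′)
    by-kite : Dec (∃ λ a → ∃ λ b → ∃ λ c → ∃ λ z → ∃ λ v → Kite a b c z v) → Goal
    by-kite (yes (_ , _ , _ , _ , _ , k)) = from-kite k
    by-kite (no none) = by-diamond (λ k → none (_ , _ , _ , _ , _ , k))
      (Fin.any? λ a → Fin.any? λ b → Fin.any? λ x → Fin.any? λ y → diamond? a b x y)

-- From deleted to isolated vertices, and the theorem

stays-connected : ∀ {m} (G : Graph (suc m)) → (∀ t → Connected (G - t)) → StaysConnected G
stays-connected G conn t {u} {v} u≢t v≢t with k , p ← conn t (Fin.punchOut (u≢t ∘ sym)) (Fin.punchOut (v≢t ∘ sym)) =
  k , subst₂ (Walk (isolate G t) k) (Fin.punchIn-punchOut (u≢t ∘ sym)) (Fin.punchIn-punchOut (v≢t ∘ sym)) (lift p)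
  where
  lift : ∀ {k a b} → Walk (G - t) k a b → Walk (isolate G t) k (Fin.punchIn t a) (Fin.punchIn t b)
  lift []      = []
  lift (e ∷ p) = (e , Fin.punchInᵢ≢i t _ , Fin.punchInᵢ≢i t _) ∷ lift p

open import Data.Integer.Base using (+_)

theorem3 : ∀ (n : ℕ) (G : Graph n) → 6 ≤ n → TwoConnected G → Unexceptional G →
    η G ℤ.≥ + (2 * n) ℤ.- + 4
theorem3 (suc m) G 6≤n (_ , conn , conn-) unexceptional = Indices.gap-bound G conn
  (Sparse.goal G conn (stays-connected G conn-) 6≤n unexceptional)
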